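{- We have $$\lim_{n\to \infty}\frac{\#\{1\le k\le n\mid\mathrm{cp}_{3,1,4}(k) \text{ is even}\}}{n} = 1.$$ In particular, for a nonnegative integer $n$, $\mathrm{cp}_{3,1,4}(n)$ is even if some prime $p\equiv 3\pmod 4$ divides $24n+5$ to an odd power.
   Context: For integers $a,b,m\ge1$, an $(a,b,m)$-copartition is a triple of integer partitions $(\gamma,\rho,\sigma)$ such that every part of $\gamma$ is $\ge a$ and $\equiv a \pmod m$, every part of $\sigma$ is $\ge b$ and $\equiv b\pmod m$, and $\rho$ has exactly as many parts as $\sigma$, each part of $\rho$ being equal to $m$ times the number of parts of $\gamma$. Its size is the sum of all parts of $\gamma,\rho,\sigma$, and $\mathrm{cp}_{a,b,m}(n)$ denotes the number of $(a,b,m)$-copartitions of size $n$. -}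

module Defs where

open import Data.Nat using (ℕ; zero; suc; _+_; _*_; _∸_; _⊓_; _≤_; _≤?_)
open import Data.Nat.Divisibility using (_∣_; _∣?_)
open import Data.Nat.Properties using (_≟_)
open import Data.List using (List; []; _∷_; map; concatMap; applyUpTo; upTo; length; sum; filter; replicate)
open import Data.Bool using (Bool; true; _∧_; T?)
open import Data.Product using (_×_; _,_)
open import Relation.Nullary using (does; ¬_)
open import Relation.Nullary.Decidable using (¬?)

-- pb f n k : all partitions of n whose parts are ≤ k, as nonincreasing lists
-- of positive integers (largest part first). f is fuel; f ≥ n suffices.
pb : ℕ → ℕ → ℕ → List (List ℕ)
pb f       zero    k = [] ∷ []
pb zero    (suc n) k = []
pb (suc f) (suc n) k =
  concatMap (λ p → map (p ∷_) (pb f (suc n ∸ p) p)) (applyUpTo suc (suc n ⊓ k))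

partitions : ℕ → List (List ℕ)
partitions n = pb n n n

okPart : ℕ → ℕ → ℕ → Bool
okPart a m x = does (a ≤? x) ∧ does (m ∣? (x ∸ a))

okParts : ℕ → ℕ → List ℕ → Bool
okParts a m []       = true
okParts a m (x ∷ xs) = okPart a m x ∧ okParts a m xs

-- An (a,b,m)-copartition is a triple (γ, ρ, σ) where ρ is forced to be
-- replicate (length σ) (m * length γ). (When γ is empty, ρ consists of zeros,
-- contributing 0 to the size.) We therefore enumerate pairs
-- (γ, σ) of partitions with valid parts and let ρ be determined.
rho : ℕ → List ℕ → List ℕ → List ℕ
rho m γ σ = replicate (length σ) (m * length γ)

size : ℕ → List ℕ → List ℕ → ℕ
size m γ σ = sum γ + sum (rho m γ σ) + sum σ

pairs : ℕ → List (List ℕ × List ℕ)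
pairs n =
  concatMap (λ i → concatMap (λ γ →
    concatMap (λ j → map (λ σ → (γ , σ)) (partitions j)) (upTo (suc n)))
    (partitions i)) (upTo (suc n))

isCopart : ℕ → ℕ → ℕ → ℕ → List ℕ × List ℕ → Bool
isCopart a b m n (γ , σ) = okParts a m γ ∧ okParts b m σ ∧ does (size m γ σ ≟ n)

cp : ℕ → ℕ → ℕ → ℕ → ℕ
cp a b m n = length (filter (λ t → T? (isCopart a b m n t)) (pairs n))

evenCount : ℕ → ℕ
evenCount n = length (filter (λ k → 2 ∣? cp 3 1 4 k) (applyUpTo suc n))

{-# OPTIONS --safe #-}
module Submission where

-- Modulo 2 the generating function of cp_{3,1,4} is (q⁴;q⁴) / ((q;q⁴) (q³;q⁴)) ≡ (q;q) (q⁴;q⁴), so by the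
-- pentagonal number theorem cp(n) has the parity of the number of x, y > 0 with x² + 4 y² = N, where
-- N = 24 n + 5. Zagier's involution on x² + 4 y z = N turns this number, modulo 2, into the number of
-- factorisations N = x (x + 4 w), which is half the number of divisors of N. Hence cp(n) odd forces
-- N = p s² with p prime. A prime ≡ 3 (mod 4) dividing N to an odd power would have to be that p, and
-- then N ≡ 3 (mod 4), which is false. The numbers p s² have density 0: those with s > S number
-- at most Y / S up to Y, and for s ≤ S the primes have density 0, since the product of the primes up to
-- Y is at most 16^Y.

-- The residues of N = 24 n + 5 carry the argument. A generalised pentagonal number e satisfies 24 e
-- + 1 = x², so e + 4 e′ = n becomes x² + 4 y² = N. As N is 2 modulo 3, it is no square, and its
-- divisors fall into pairs x < y with x y = N. As N is 1 modulo 4, the two factors are congruent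
-- modulo 4, so every such pair does have the form x (x + 4 w). Every odd exponent in N contributes
-- an even factor to the number of divisors; if half of that number is odd, exactly one exponent is
-- odd.
--
-- Questions of convergence are avoided throughout. Series are compared below a bound, infinite
-- products are finite compositions of operators, and division is replaced by cancelling factors of
-- positive exponent. Sums run up to one bound `b` from which their terms vanish, so that a change
-- of variables does not have to track its range.

open import Defs
open import Algebra.Bundles using (CommutativeMonoid; CommutativeRing)
import Algebra.Properties.CommutativeSemigroup as CommutativeSemigroupProperties
open import Data.Bool using (Bool; true; false; _∧_; _xor_; not; T; T?; if_then_else_)
open import Data.Bool.Properties using (xor-∧-commutativeRing; xor-same; xor-comm; xor-identityʳ; xor-assoc; ∧-zeroʳ)
open import Data.Bool.Solver using (module xor-∧-Solver)
open import Data.List using (List; []; _∷_; map; concatMap; applyUpTo; upTo; length; filter; replicate; foldr; _++_)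
open import Data.List.Relation.Unary.All using (_∷_)
open import Data.Nat using (ℕ; zero; suc; _+_; _*_; _∸_; _^_; _!; _⊓_; _≤_; _<_; _<ᵇ_; _≡ᵇ_; _≟_; _≤?_; _/_; _%_; z≤n; s≤s; NonZero; >-nonZero; >-nonZero⁻¹; ≢-nonZero; nonTrivial⇒n>1)
open import Data.Nat.Combinatorics using (_C_; nCk+nC[k+1]≡[n+1]C[k+1]; k>n⇒nCk≡0; nCk≡n!/k![n-k]!; k![n∸k]!∣n!)
open import Data.Nat.Coprimality using (Coprime; coprime-divisor)
open import Data.Nat.Divisibility
open import Data.Nat.DivMod using (m≡m%n+[m/n]*n; [m+kn]%n≡m%n; m%n<n; m/n*n≡m)
open import Data.Nat.Induction using (<-rec)
open import Data.Nat.ListAction using () renaming (sum to listSum)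
open import Data.Nat.Primality using (Prime; prime?; euclidsLemma; prime⇒irreducible; prime⇒nonZero; prime⇒nonTrivial; ¬prime[0]; ¬prime[1])
open import Data.Nat.Primality.Factorisation using (factorise; PrimeFactorisation)
open import Data.Nat.Properties hiding (_≟_; _≤?_)
open import Data.Nat.Tactic.RingSolver using (solve-∀)
open import Data.Product using (_×_; _,_; ∃; ∃₂; proj₂)
open import Data.Sum using (_⊎_; inj₁; inj₂)
open import Data.Unit using (tt)
open import Function using (_∘_; id; mk⇔)
open import Level using (0ℓ)
open import Relation.Binary using (Setoid)
import Relation.Binary.PropositionalEquality as ≡
open ≡ using (_≡_; _≢_)
import Relation.Binary.Reasoning.Setoid as SetoidReasoning
open import Relation.Nullary using (Dec; ¬_; contradiction; does; yes; no)
open import Relation.Nullary.Decidable using (dec-true; dec-false; does-⇔)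

-- Finite sums

-- Stated for a commutative monoid because the same rearrangements serve for parities in 𝔽₂ and for
-- cardinalities in ℕ.
module FiniteSum {c ℓ} (M : CommutativeMonoid c ℓ) where
  open CommutativeMonoid M
  open SetoidReasoning setoid
  open CommutativeSemigroupProperties commutativeSemigroup using (interchange)

  sum : ℕ → (ℕ → Carrier) → Carrier
  sum zero    f = ε
  sum (suc n) f = sum n f ∙ f n

  Vanishes : ℕ → (ℕ → Carrier) → Set ℓ
  Vanishes b f = ∀ i → b ≤ i → f i ≈ ε

  sum-cong-< : ∀ n {f g} → (∀ i → i < n → f i ≈ g i) → sum n f ≈ sum n g
  sum-cong-< zero    h = refl
  sum-cong-< (suc n) h = ∙-cong (sum-cong-< n (λ i i<n → h i (m<n⇒m<1+n i<n))) (h n (n<1+n n))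

  sum-cong : ∀ n {f g} → (∀ i → f i ≈ g i) → sum n f ≈ sum n g
  sum-cong n h = sum-cong-< n (λ i _ → h i)

  sum-ε : ∀ n {f} → (∀ i → i < n → f i ≈ ε) → sum n f ≈ ε
  sum-ε zero    h = refl
  sum-ε (suc n) h = trans (∙-cong (sum-ε n (λ i i<n → h i (m<n⇒m<1+n i<n))) (h n (n<1+n n))) (identityˡ ε)

  sum-∙ : ∀ n f g → sum n (λ i → f i ∙ g i) ≈ sum n f ∙ sum n g
  sum-∙ zero    f g = sym (identityˡ ε)
  sum-∙ (suc n) f g = trans (∙-congʳ (sum-∙ n f g)) (interchange _ _ _ _)

  sum-swap : ∀ m n (f : ℕ → ℕ → Carrier) → sum m (λ i → sum n (λ j → f i j)) ≈ sum n (λ j → sum m (λ i → f i j))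
  sum-swap zero    n f = sym (sum-ε n (λ _ _ → refl))
  sum-swap (suc m) n f = trans (∙-congʳ (sum-swap m n f)) (sym (sum-∙ n _ _))

  sum-+ : ∀ k n f → sum (k + n) f ≈ sum k f ∙ sum n (λ i → f (k + i))
  sum-+ k zero    f = trans (reflexive (≡.cong (λ t → sum t f) (+-identityʳ k))) (sym (identityʳ _))
  sum-+ k (suc n) f = begin
    sum (k + suc n) f                                     ≡⟨ ≡.cong (λ t → sum t f) (+-suc k n) ⟩
    sum (k + n) f ∙ f (k + n)                             ≈⟨ ∙-congʳ (sum-+ k n f) ⟩
    (sum k f ∙ sum n (λ i → f (k + i))) ∙ f (k + n)       ≈⟨ assoc _ _ _ ⟩
    sum k f ∙ (sum n (λ i → f (k + i)) ∙ f (k + n))       ∎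

  sum-first : ∀ n f → sum (suc n) f ≈ f 0 ∙ sum n (f ∘ suc)
  sum-first n f = trans (sum-+ 1 n f) (∙-congʳ (identityˡ _))

  sum-extend : ∀ {b n f} → Vanishes b f → b ≤ n → sum n f ≈ sum b f
  sum-extend {b} {n} {f} v b≤n = begin
    sum n f                                     ≡⟨ ≡.cong (λ t → sum t f) (m+[n∸m]≡n b≤n) ⟨
    sum (b + (n ∸ b)) f                         ≈⟨ sum-+ b (n ∸ b) f ⟩
    sum b f ∙ sum (n ∸ b) (λ i → f (b + i))     ≈⟨ ∙-congˡ (sum-ε (n ∸ b) (λ i _ → v (b + i) (m≤m+n b i))) ⟩
    sum b f ∙ ε                                 ≈⟨ identityʳ _ ⟩
    sum b f                                     ∎

  -- Extending the range to b + k adds only vanishing terms. The tail keeps the bound `b`, and `k`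
  -- is allowed to exceed it.
  sum-split : ∀ k {b f} → Vanishes b f → sum b f ≈ sum k f ∙ sum b (λ i → f (k + i))
  sum-split k {b} {f} v = trans (sym (sum-extend v (m≤n+m b k))) (sum-+ k b f)

  sum-single : ∀ n k {f} → k < n → (∀ i → i < n → i ≢ k → f i ≈ ε) → sum n f ≈ f k
  sum-single (suc n) k {f} k<1+n h with k ≟ n
  ... | yes ≡.refl = trans (∙-congʳ (sum-ε n (λ i i<n → h i (m<n⇒m<1+n i<n) (<⇒≢ i<n)))) (identityˡ (f k))
  ... | no k≢n     = trans (∙-cong (sum-single n k (≤∧≢⇒< (≤-pred k<1+n) k≢n) (λ i i<n → h i (m<n⇒m<1+n i<n)))
                                   (h n (n<1+n n) (k≢n ∘ ≡.sym))) (identityʳ (f k))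

  sum-blocks : ∀ n k f → sum (n * k) f ≈ sum n (λ q → sum k (λ r → f (q * k + r)))
  sum-blocks zero    k f = refl
  sum-blocks (suc n) k f = begin
    sum (k + n * k) f                                        ≡⟨ ≡.cong (λ t → sum t f) (+-comm k (n * k)) ⟩
    sum (n * k + k) f                                        ≈⟨ sum-+ (n * k) k f ⟩
    sum (n * k) f ∙ sum k (λ r → f (n * k + r))              ≈⟨ ∙-congʳ (sum-blocks n k f) ⟩
    sum (suc n) (λ q → sum k (λ r → f (q * k + r)))          ∎

  private
    restrict : Bool → Carrier → Carrier
    restrict b x = if b then x else ε

    restrict-< : ∀ {x y} a → x < y → restrict (x <ᵇ y) a ≈ a
    restrict-< {x} {y} a x<y with x <ᵇ y | <⇒<ᵇ x<y
    ... | true | _ = refl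

    restrict-≥ : ∀ {x y} a → y ≤ x → restrict (x <ᵇ y) a ≈ ε
    restrict-≥ {x} {y} a y≤x with x <ᵇ y in eq
    ... | true  = contradiction (<ᵇ⇒< x y (≡.subst T (≡.sym eq) _)) (≤⇒≯ y≤x)
    ... | false = refl

    sum-restrict : ∀ {y b} f → y ≤ b → sum y f ≈ sum b (λ x → restrict (x <ᵇ y) (f x))
    sum-restrict {y} {b} f y≤b = begin
      sum y f                                      ≈⟨ sum-cong-< y (λ x x<y → sym (restrict-< (f x) x<y)) ⟩
      sum y (λ x → restrict (x <ᵇ y) (f x))        ≈⟨ sum-extend (λ x y≤x → restrict-≥ (f x) y≤x) y≤b ⟨
      sum b (λ x → restrict (x <ᵇ y) (f x))        ∎

    restrict-ε : ∀ t {a} → a ≈ ε → restrict t a ≈ ε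
    restrict-ε false _ = refl
    restrict-ε true  h = h

  -- The substitution y = x + 1 + e. The indicator `restrict` replaces the dependent range x < y by
  -- the whole square, where the sums can be exchanged; vanishing from `b` on then lets e run up to
  -- `b` again.
  sum-triangle-< : ∀ b (g : ℕ → ℕ → Carrier) → (∀ x → Vanishes b (g x)) →
    sum b (λ y → sum y (λ x → g x y)) ≈ sum b (λ x → sum b (λ e → g x (suc x + e)))
  sum-triangle-< b g v = begin
    sum b (λ y → sum y (λ x → g x y))
      ≈⟨ sum-cong-< b (λ y y<b → sum-restrict (λ x → g x y) (<⇒≤ y<b)) ⟩
    sum b (λ y → sum b (λ x → restrict (x <ᵇ y) (g x y)))
      ≈⟨ sum-swap b b (λ y x → restrict (x <ᵇ y) (g x y)) ⟩
    sum b (λ x → sum b (λ y → restrict (x <ᵇ y) (g x y)))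
      ≈⟨ sum-cong b (λ x → sum-split (suc x) (λ y b≤y → restrict-ε (x <ᵇ y) (v x y b≤y))) ⟩
    sum b (λ x → sum (suc x) (λ y → restrict (x <ᵇ y) (g x y)) ∙ sum b (λ e → restrict (x <ᵇ suc x + e) (g x (suc x + e))))
      ≈⟨ sum-cong b (λ x → ∙-cong (sum-ε (suc x) (λ y y≤x → restrict-≥ (g x y) (≤-pred y≤x)))
                                  (sum-cong b (λ e → restrict-< _ (m≤m+n (suc x) e)))) ⟩
    sum b (λ x → ε ∙ sum b (λ e → g x (suc x + e)))
      ≈⟨ sum-cong b (λ x → identityˡ _) ⟩
    sum b (λ x → sum b (λ e → g x (suc x + e))) ∎

  sum-triangle-≤ : ∀ b (g : ℕ → ℕ → Carrier) → (∀ x → Vanishes b (g x)) →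
    sum b (λ y → sum (suc y) (λ x → g x y)) ≈ sum b (λ x → sum b (λ e → g x (x + e)))
  sum-triangle-≤ b g v = begin
    sum b (λ y → sum (suc y) (λ x → g x y))
      ≈⟨ sum-∙ b _ _ ⟩
    sum b (λ y → sum y (λ x → g x y)) ∙ sum b (λ x → g x x)
      ≈⟨ ∙-congʳ (sum-triangle-< b g v) ⟩
    sum b (λ x → sum b (λ e → g x (suc x + e))) ∙ sum b (λ x → g x x)
      ≈⟨ sum-∙ b _ _ ⟨
    sum b (λ x → sum b (λ e → g x (suc x + e)) ∙ g x x)
      ≈⟨ sum-cong b step ⟩
    sum b (λ x → sum b (λ e → g x (x + e))) ∎
    where
    step : ∀ x → sum b (λ e → g x (suc x + e)) ∙ g x x ≈ sum b (λ e → g x (x + e))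
    step x = begin
      sum b (λ e → g x (suc x + e)) ∙ g x x
        ≈⟨ comm _ _ ⟩
      g x x ∙ sum b (λ e → g x (suc x + e))
        ≈⟨ ∙-cong (reflexive (≡.cong (g x) (≡.sym (+-identityʳ x)))) (sum-cong b (λ e → reflexive (≡.cong (g x) (≡.sym (+-suc x e))))) ⟩
      g x (x + 0) ∙ sum b (λ e → g x (x + suc e))
        ≈⟨ ∙-congʳ (identityˡ _) ⟨
      sum 1 (λ e → g x (x + e)) ∙ sum b (λ e → g x (x + suc e))
        ≈⟨ sum-split 1 (λ e b≤e → v x (x + e) (≤-trans b≤e (m≤n+m e x))) ⟨
      sum b (λ e → g x (x + e)) ∎

  -- The two triangles off the diagonal are equal. In 𝔽₂ they cancel and leave the diagonal; in ℕ
  -- they count each pair x < y twice. Both readings are used.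
  sum-symmetric : ∀ b (f : ℕ → ℕ → Carrier) → (∀ x y → f x y ≈ f y x) →
    let half = sum b (λ x → sum x (λ y → f y x)) in
    sum b (λ x → sum b (f x)) ≈ (half ∙ half) ∙ sum b (λ x → f x x)
  sum-symmetric zero    f s = sym (trans (identityʳ _) (identityʳ _))
  sum-symmetric (suc b) f s = begin
    sum b (λ x → sum b (f x) ∙ f x b) ∙ (sum b (f b) ∙ f b b)
      ≈⟨ ∙-cong (sum-∙ b _ _) (∙-congʳ (sum-cong b (s b))) ⟩
    (sum b (λ x → sum b (f x)) ∙ l) ∙ (l ∙ f b b)
      ≈⟨ ∙-congʳ (∙-congʳ (sum-symmetric b f s)) ⟩
    (((h ∙ h) ∙ d) ∙ l) ∙ (l ∙ f b b)
      ≈⟨ ∙-congʳ (trans (assoc _ _ _) (trans (∙-congˡ (comm _ _)) (sym (assoc _ _ _)))) ⟩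
    (((h ∙ h) ∙ l) ∙ d) ∙ (l ∙ f b b)
      ≈⟨ interchange _ _ _ _ ⟩
    (((h ∙ h) ∙ l) ∙ l) ∙ (d ∙ f b b)
      ≈⟨ ∙-congʳ (trans (assoc _ _ _) (interchange h h l l)) ⟩
    ((h ∙ l) ∙ (h ∙ l)) ∙ (d ∙ f b b) ∎
    where
    h = sum b (λ x → sum x (λ y → f y x))
    l = sum b (λ x → f x b)
    d = sum b (λ x → f x x)

open ≡ using (refl; sym; trans; cong; cong₂; subst; subst₂; module ≡-Reasoning)

module Σ = FiniteSum +-0-commutativeMonoid
module ⊕ = FiniteSum (CommutativeRing.+-commutativeMonoid xor-∧-commutativeRing)

isOdd : ℕ → Bool
isOdd zero    = false
isOdd (suc n) = not (isOdd n)

-- Power series over 𝔽₂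

xor-interchange : ∀ a b c d → (a xor b) xor (c xor d) ≡ (a xor c) xor (b xor d)
xor-interchange = solve 4 (λ a b c d → (a :+ b) :+ (c :+ d) := (a :+ c) :+ (b :+ d)) refl
  where open xor-∧-Solver

xor-move : ∀ {a b c} → a ≡ b xor c → a xor c ≡ b
xor-move {b = b} {c} refl = trans (xor-assoc b c c) (trans (cong (b xor_) (xor-same c)) (xor-identityʳ b))

Series : Set
Series = ℕ → Bool

infix 4 _≈[_]_
-- Congruence of power series modulo q^L.
record _≈[_]_ (f : Series) (L : ℕ) (g : Series) : Set where
  constructor coeffs
  field coeff : ∀ n → n < L → f n ≡ g n
open _≈[_]_

≈-setoid : ℕ → Setoid 0ℓ 0ℓ
≈-setoid L = record
  { Carrier       = Series
  ; _≈_           = _≈[ L ]_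
  ; isEquivalence = record
    { refl  = coeffs λ _ _ → refl
    ; sym   = λ p → coeffs λ n n<L → sym (coeff p n n<L)
    ; trans = λ p q → coeffs λ n n<L → trans (coeff p n n<L) (coeff q n n<L)
    }
  }

module ≈-Reasoning {L : ℕ} = SetoidReasoning (≈-setoid L)

≈-sym : ∀ {L f g} → f ≈[ L ] g → g ≈[ L ] f
≈-sym {L} = Setoid.sym (≈-setoid L)

≈-trans : ∀ {L f g h} → f ≈[ L ] g → g ≈[ L ] h → f ≈[ L ] h
≈-trans {L} = Setoid.trans (≈-setoid L)

≈-reflexive : ∀ {L f g} → f ≡ g → f ≈[ L ] g
≈-reflexive {L} = Setoid.reflexive (≈-setoid L)

≈-weaken : ∀ {L M f g} → L ≤ M → f ≈[ M ] g → f ≈[ L ] g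
≈-weaken L≤M p = coeffs λ n n<L → coeff p n (≤-trans n<L L≤M)

infixl 6 _⊞_

opaque
  _⊞_ : Series → Series → Series
  (f ⊞ g) n = f n xor g n

  ⊞-coeff : ∀ f g n → (f ⊞ g) n ≡ f n xor g n
  ⊞-coeff f g n = refl

  shift : ℕ → Series → Series
  shift zero    f n       = f n
  shift (suc c) f zero    = false
  shift (suc c) f (suc n) = shift c f n

  shift-zero : ∀ f n → shift 0 f n ≡ f n
  shift-zero f n = refl

  shift-suc-zero : ∀ c f → shift (suc c) f 0 ≡ false
  shift-suc-zero c f = refl

  shift-suc-suc : ∀ c f n → shift (suc c) f (suc n) ≡ shift c f n
  shift-suc-suc c f n = refl

  shift-coeff-cong : ∀ c {f g} n → (∀ m → m ≤ n → f m ≡ g m) → shift c f n ≡ shift c g n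
  shift-coeff-cong zero    n       h = h n ≤-refl
  shift-coeff-cong (suc c) zero    h = refl
  shift-coeff-cong (suc c) (suc n) h = shift-coeff-cong c n (λ m m≤n → h m (m≤n⇒m≤1+n m≤n))

  shift-coeff-⊞ : ∀ c f g n → shift c (f ⊞ g) n ≡ shift c f n xor shift c g n
  shift-coeff-⊞ zero    f g n       = refl
  shift-coeff-⊞ (suc c) f g zero    = refl
  shift-coeff-⊞ (suc c) f g (suc n) = shift-coeff-⊞ c f g n

  shift-coeff-shift : ∀ c d f n → shift c (shift d f) n ≡ shift (c + d) f n
  shift-coeff-shift zero    d f n       = refl
  shift-coeff-shift (suc c) d f zero    = refl
  shift-coeff-shift (suc c) d f (suc n) = shift-coeff-shift c d f n

  shift-small : ∀ c f n → n < c → shift c f n ≡ false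
  shift-small (suc c) f zero    _         = refl
  shift-small (suc c) f (suc n) (s≤s n<c) = shift-small c f n n<c

≈-refl : ∀ {L f} → f ≈[ L ] f
≈-refl = coeffs λ _ _ → refl

⊞-cong : ∀ {L f f′ g g′} → f ≈[ L ] f′ → g ≈[ L ] g′ → f ⊞ g ≈[ L ] f′ ⊞ g′
⊞-cong {f = f} {f′} {g} {g′} p q = coeffs λ n n<L →
  trans (⊞-coeff f g n) (trans (cong₂ _xor_ (coeff p n n<L) (coeff q n n<L)) (sym (⊞-coeff f′ g′ n)))

⊞-interchange : ∀ {L} f g h k → (f ⊞ g) ⊞ (h ⊞ k) ≈[ L ] (f ⊞ h) ⊞ (g ⊞ k)
⊞-interchange f g h k = coeffs λ n _ →
  trans (expand f g h k n) (trans (xor-interchange (f n) (g n) (h n) (k n)) (sym (expand f h g k n)))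
  where
  expand : ∀ f g h k n → ((f ⊞ g) ⊞ (h ⊞ k)) n ≡ (f n xor g n) xor (h n xor k n)
  expand f g h k n = trans (⊞-coeff _ _ n) (cong₂ _xor_ (⊞-coeff f g n) (⊞-coeff h k n))

⊞-assoc : ∀ {L} f g h → (f ⊞ g) ⊞ h ≈[ L ] f ⊞ (g ⊞ h)
⊞-assoc f g h = coeffs λ n _ → trans (⊞-coeff _ _ n) (trans (cong (_xor h n) (⊞-coeff f g n))
  (trans (xor-assoc (f n) (g n) (h n)) (sym (trans (⊞-coeff _ _ n) (cong (f n xor_) (⊞-coeff g h n))))))

⊞-comm : ∀ {L} f g → f ⊞ g ≈[ L ] g ⊞ f
⊞-comm f g = coeffs λ n _ → trans (⊞-coeff f g n) (trans (xor-comm (f n) (g n)) (sym (⊞-coeff g f n)))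

⊞-cancelʳ : ∀ {L} f g → (f ⊞ g) ⊞ g ≈[ L ] f
⊞-cancelʳ f g = coeffs λ n _ → trans (⊞-coeff _ _ n) (trans (cong (_xor g n) (⊞-coeff f g n)) (xor-move refl))

⊞-vanishʳ : ∀ {L} f g → (∀ n → n < L → g n ≡ false) → f ⊞ g ≈[ L ] f
⊞-vanishʳ f g v = coeffs λ n n<L → trans (⊞-coeff f g n) (trans (cong (f n xor_) (v n n<L)) (xor-identityʳ (f n)))

shift-0 : ∀ {L} f → shift 0 f ≈[ L ] f
shift-0 f = coeffs λ n _ → shift-zero f n

shift-cong : ∀ {L f g} c → f ≈[ L ] g → shift c f ≈[ L ] shift c g
shift-cong c p = coeffs λ n n<L → shift-coeff-cong c n (λ m m≤n → coeff p m (≤-<-trans m≤n n<L))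

shift-⊞ : ∀ {L} c f g → shift c (f ⊞ g) ≈[ L ] shift c f ⊞ shift c g
shift-⊞ c f g = coeffs λ n _ → trans (shift-coeff-⊞ c f g n) (sym (⊞-coeff _ _ n))

shift-shift : ∀ {L} c d f → shift c (shift d f) ≈[ L ] shift (c + d) f
shift-shift c d f = coeffs λ n _ → shift-coeff-shift c d f n

shift-comm : ∀ {L} c d f → shift c (shift d f) ≈[ L ] shift d (shift c f)
shift-comm c d f = ≈-trans (shift-shift c d f)
  (≈-trans (≈-reflexive (cong (λ t → shift t f) (+-comm c d))) (≈-sym (shift-shift d c f)))

opaque
  -- Multiplication by 1 + q^c, which over 𝔽₂ is 1 - q^c; `shift c` is multiplication by q^c. Two
  -- series are never multiplied: `prod` composes these operators.
  factor : ℕ → Series → Series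
  factor c f = f ⊞ shift c f

  factor-def : ∀ c f → factor c f ≡ f ⊞ shift c f
  factor-def c f = refl

  factor-cong : ∀ {L f g} c → f ≈[ L ] g → factor c f ≈[ L ] factor c g
  factor-cong c p = ⊞-cong p (shift-cong c p)

  factor-⊞ : ∀ {L} c f g → factor c (f ⊞ g) ≈[ L ] factor c f ⊞ factor c g
  factor-⊞ c f g = ≈-trans (⊞-cong ≈-refl (shift-⊞ c f g)) (⊞-interchange f g _ _)

  factor-shift : ∀ {L} c d f → factor c (shift d f) ≈[ L ] shift d (factor c f)
  factor-shift c d f = ≈-trans (⊞-cong ≈-refl (shift-comm c d f)) (≈-sym (shift-⊞ d f (shift c f)))

  factor-comm : ∀ {L} c d f → factor c (factor d f) ≈[ L ] factor d (factor c f)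
  factor-comm c d f = ≈-trans (factor-⊞ c f (shift d f)) (⊞-cong ≈-refl (factor-shift c d f))

  -- The Frobenius identity (1 + q^c)² = 1 + q^(2c): the middle terms cancel.
  factor-square : ∀ {L} c f → factor c (factor c f) ≈[ L ] factor (c + c) f
  factor-square c f = begin
    (f ⊞ s) ⊞ shift c (f ⊞ s)                 ≈⟨ ⊞-cong ≈-refl (shift-⊞ c f s) ⟩
    (f ⊞ s) ⊞ (s ⊞ shift c s)                 ≈⟨ ⊞-cong ≈-refl (⊞-comm _ _) ⟩
    (f ⊞ s) ⊞ (shift c s ⊞ s)                 ≈⟨ ⊞-interchange f s (shift c s) s ⟩
    (f ⊞ shift c s) ⊞ (s ⊞ s)                 ≈⟨ ⊞-vanishʳ _ _ (λ n _ → trans (⊞-coeff s s n) (xor-same (s n))) ⟩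
    f ⊞ shift c s                             ≈⟨ ⊞-cong ≈-refl (shift-shift c c f) ⟩
    f ⊞ shift (c + c) f                       ∎
    where
    open ≈-Reasoning
    s : Series
    s = shift c f

  factor-large : ∀ {L} c f → L ≤ c → factor c f ≈[ L ] f
  factor-large c f L≤c = ⊞-vanishʳ f _ (λ n n<L → shift-small c f n (<-≤-trans n<L L≤c))

  -- A coefficient of q^(c+1) f involves only strictly lower coefficients of f, so these are
  -- recovered one after another. Exponent 0 would give the zero operator, hence `suc c`.
  factor-cancel : ∀ {L} c {f g} → factor (suc c) f ≈[ L ] factor (suc c) g → f ≈[ L ] g
  factor-cancel {L} c {f} {g} p = coeffs λ n n<L → below (suc n) n<L n ≤-refl
    where
    below : ∀ k → k ≤ L → ∀ m → m < k → f m ≡ g m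
    agree : ∀ k → k ≤ L → ∀ m → m < k → shift (suc c) f m ≡ shift (suc c) g m
    below (suc k) k<L m m<1+k = trans (sym (xor-move {c = shift (suc c) f m} refl)) (trans
      (cong₂ _xor_ (trans (sym (⊞-coeff f _ m)) (trans (coeff p m (<-≤-trans m<1+k k<L)) (⊞-coeff g _ m))) (agree (suc k) k<L m m<1+k))
      (xor-move refl))
    agree (suc k) k<L zero    _         = trans (shift-suc-zero c f) (sym (shift-suc-zero c g))
    agree (suc k) k<L (suc m) (s≤s m<k) = trans (shift-suc-suc c f m)
      (trans (shift-coeff-cong c m λ i i≤m → below k (<⇒≤ k<L) i (≤-<-trans i≤m m<k)) (sym (shift-suc-suc c g m)))

prod : ℕ → (ℕ → ℕ) → Series → Series
prod zero    e f = f
prod (suc n) e f = factor (e n) (prod n e f)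

prod-cong : ∀ {L f g} n e → f ≈[ L ] g → prod n e f ≈[ L ] prod n e g
prod-cong zero    e p = p
prod-cong (suc n) e p = factor-cong (e n) (prod-cong n e p)

factor-prod : ∀ {L} c n e f → factor c (prod n e f) ≈[ L ] prod n e (factor c f)
factor-prod c zero    e f = ≈-refl
factor-prod c (suc n) e f = ≈-trans (factor-comm c (e n) _) (factor-cong (e n) (factor-prod c n e f))

prod-prod : ∀ {L} m d n e f → prod m d (prod n e f) ≈[ L ] prod n e (prod m d f)
prod-prod zero    d n e f = ≈-refl
prod-prod (suc m) d n e f = ≈-trans (factor-cong (d m) (prod-prod m d n e f)) (factor-prod (d m) n e _)

prod-cancel : ∀ {L f g} n e → prod n (suc ∘ e) f ≈[ L ] prod n (suc ∘ e) g → f ≈[ L ] g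
prod-cancel zero    e p = p
prod-cancel (suc n) e p = prod-cancel n e (factor-cancel (e n) p)

prod-first : ∀ {L} n e f → prod (suc n) e f ≈[ L ] factor (e 0) (prod n (e ∘ suc) f)
prod-first zero    e f = ≈-refl
prod-first (suc n) e f = ≈-trans (factor-cong (e (suc n)) (prod-first n e f)) (factor-comm (e (suc n)) (e 0) _)

-- Sorts the exponents 1, ..., 4 n by residue modulo 4, keeping the even ones together so that the
-- Frobenius identity applies to them.
prod-split : ∀ n f {L} → prod (n * 4) suc f ≈[ L ]
  prod n (λ i → 1 + 4 * i) (prod n (λ i → 3 + 4 * i) (prod (n * 2) (λ i → 2 + 2 * i) f))
prod-split n f = ≈-trans (quarters n) (≈-sym (≈-trans (prod-cong n _ (prod-cong n _ (halves n)))
   (prod-cong n _ (prod-prod n (λ i → 3 + 4 * i) n (λ i → 2 + 4 * i) _))))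
  where
  P : (ℕ → ℕ) → ℕ → Series → Series
  P e n = prod n e
  halves : ∀ n {L} → prod (n * 2) (λ i → 2 + 2 * i) f ≈[ L ] prod n (λ i → 2 + 4 * i) (prod n (λ i → 4 + 4 * i) f)
  halves zero    = ≈-refl
  halves (suc n) = begin
    factor (2 + 2 * suc (n * 2)) (factor (2 + 2 * (n * 2)) (prod (n * 2) (λ i → 2 + 2 * i) f))
      ≡⟨ cong₂ (λ s t → factor s (factor t (prod (n * 2) (λ i → 2 + 2 * i) f))) (arith₁ n) (arith₂ n) ⟩
    factor (4 + 4 * n) (factor (2 + 4 * n) (prod (n * 2) (λ i → 2 + 2 * i) f))
      ≈⟨ factor-cong _ (factor-cong _ (halves n)) ⟩
    factor (4 + 4 * n) (factor (2 + 4 * n) (prod n (λ i → 2 + 4 * i) (prod n (λ i → 4 + 4 * i) f)))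
      ≈⟨ factor-comm (4 + 4 * n) (2 + 4 * n) _ ⟩
    factor (2 + 4 * n) (factor (4 + 4 * n) (prod n (λ i → 2 + 4 * i) (prod n (λ i → 4 + 4 * i) f)))
      ≈⟨ factor-cong _ (factor-prod (4 + 4 * n) n _ _) ⟩
    prod (suc n) (λ i → 2 + 4 * i) (prod (suc n) (λ i → 4 + 4 * i) f) ∎
    where
    open ≈-Reasoning
    arith₁ : ∀ n → 2 + 2 * suc (n * 2) ≡ 4 + 4 * n
    arith₁ = solve-∀
    arith₂ : ∀ n → 2 + 2 * (n * 2) ≡ 2 + 4 * n
    arith₂ = solve-∀
  quarters : ∀ n {L} → prod (n * 4) suc f ≈[ L ]
    prod n (λ i → 1 + 4 * i) (prod n (λ i → 2 + 4 * i) (prod n (λ i → 3 + 4 * i) (prod n (λ i → 4 + 4 * i) f)))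
  quarters zero    = ≈-refl
  quarters (suc n) = begin
    factor (4 + n * 4) (factor (3 + n * 4) (factor (2 + n * 4) (factor (1 + n * 4) (prod (n * 4) suc f))))
      ≡⟨ cong (λ t → factor (4 + t) (factor (3 + t) (factor (2 + t) (factor (1 + t) (prod (n * 4) suc f))))) (*-comm n 4) ⟩
    F 4 (F 3 (F 2 (F 1 (prod (n * 4) suc f))))
      ≈⟨ reverse (prod (n * 4) suc f) ⟩
    F 1 (F 2 (F 3 (F 4 (prod (n * 4) suc f))))
      ≈⟨ factor-cong _ (factor-cong _ (factor-cong _ (factor-cong _ (quarters n)))) ⟩
    F 1 (F 2 (F 3 (F 4 (Q 1 (Q 2 (Q 3 (Q 4 f)))))))
      ≈⟨ factor-cong _ (factor-cong _ (factor-cong _ (factor-prod (4 + 4 * n) n (λ i → 1 + 4 * i) _))) ⟩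
    F 1 (F 2 (F 3 (Q 1 (F 4 (Q 2 (Q 3 (Q 4 f)))))))
      ≈⟨ factor-cong _ (factor-cong _ (factor-prod (3 + 4 * n) n (λ i → 1 + 4 * i) _)) ⟩
    F 1 (F 2 (Q 1 (F 3 (F 4 (Q 2 (Q 3 (Q 4 f)))))))
      ≈⟨ factor-cong _ (factor-prod (2 + 4 * n) n (λ i → 1 + 4 * i) _) ⟩
    F 1 (Q 1 (F 2 (F 3 (F 4 (Q 2 (Q 3 (Q 4 f)))))))
      ≈⟨ factor-cong _ (prod-cong n _ (factor-cong _ (factor-cong _ (factor-prod (4 + 4 * n) n (λ i → 2 + 4 * i) _)))) ⟩
    F 1 (Q 1 (F 2 (F 3 (Q 2 (F 4 (Q 3 (Q 4 f)))))))
      ≈⟨ factor-cong _ (prod-cong n _ (factor-cong _ (factor-prod (3 + 4 * n) n (λ i → 2 + 4 * i) _))) ⟩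
    F 1 (Q 1 (F 2 (Q 2 (F 3 (F 4 (Q 3 (Q 4 f)))))))
      ≈⟨ factor-cong _ (prod-cong n _ (factor-cong _ (prod-cong n _ (factor-cong _ (factor-prod (4 + 4 * n) n (λ i → 3 + 4 * i) _))))) ⟩
    F 1 (Q 1 (F 2 (Q 2 (F 3 (Q 3 (F 4 (Q 4 f))))))) ∎
    where
    open ≈-Reasoning
    F : ℕ → Series → Series
    F r = factor (r + 4 * n)
    Q : ℕ → Series → Series
    Q r = prod n (λ i → r + 4 * i)
    reverse : ∀ {L} g → F 4 (F 3 (F 2 (F 1 g))) ≈[ L ] F 1 (F 2 (F 3 (F 4 g)))
    reverse g = begin
      F 4 (F 3 (F 2 (F 1 g))) ≈⟨ factor-cong _ (factor-cong _ (factor-comm (2 + 4 * n) (1 + 4 * n) g)) ⟩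
      F 4 (F 3 (F 1 (F 2 g))) ≈⟨ factor-cong _ (factor-comm (3 + 4 * n) (1 + 4 * n) _) ⟩
      F 4 (F 1 (F 3 (F 2 g))) ≈⟨ factor-comm (4 + 4 * n) (1 + 4 * n) _ ⟩
      F 1 (F 4 (F 3 (F 2 g))) ≈⟨ factor-cong _ (factor-cong _ (factor-comm (3 + 4 * n) (2 + 4 * n) g)) ⟩
      F 1 (F 4 (F 2 (F 3 g))) ≈⟨ factor-cong _ (factor-comm (4 + 4 * n) (2 + 4 * n) _) ⟩
      F 1 (F 2 (F 4 (F 3 g))) ≈⟨ factor-cong _ (factor-cong _ (factor-comm (4 + 4 * n) (3 + 4 * n) g)) ⟩
      F 1 (F 2 (F 3 (F 4 g))) ∎

-- The pentagonal number theorem modulo 2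

prod-exponents : ∀ {L} n {e e′} f → (∀ i → e i ≡ e′ i) → prod n e f ≈[ L ] prod n e′ f
prod-exponents zero    f h = ≈-refl
prod-exponents (suc n) {e} {e′} f h = ≈-trans (≈-reflexive (cong (λ t → factor t (prod n e f)) (h n)))
  (factor-cong (e′ n) (prod-exponents n f h))

shift-exponent : ∀ {L c d} f → c ≡ d → shift c f ≈[ L ] shift d f
shift-exponent f refl = ≈-refl

triangular : ℕ → ℕ
triangular zero    = 0
triangular (suc n) = suc n + triangular n

-- The pentagonal number n (3 n + 1) / 2, written without division.
pent₊ : ℕ → ℕ
pent₊ n = n * n + triangular n

-- With m = n + 1 this is m (3 m - 1) / 2; the index is one behind, so `pent₋ 0` is 1.
pent₋ : ℕ → ℕ
pent₋ n = suc n * suc n + triangular n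

module Pentagonal (d : ℕ) where

  pentagonal : ℕ → Series → Series
  pentagonal zero    f = f
  pentagonal (suc n) f = (pentagonal n f ⊞ shift (d * pent₋ n) f) ⊞ shift (d * pent₊ (suc n)) f

  -- The s-th term in Shanks's finite form of Euler's identity, with q^d for q. The product is the
  -- quotient of the first n factors of (q;q) by the first s, written without division.
  term : ℕ → ℕ → Series → Series
  term n s f = shift (d * (s * n + triangular s)) (prod (n ∸ s) (λ i → d * (s + suc i)) f)

  partial : ℕ → ℕ → Series → Series
  partial n zero    f = term n 0 f
  partial n (suc m) f = partial n m f ⊞ term n (suc m) f

  -- In powers of q^d: passing from n to n + 1 adds the factor 1 + q^(n+1) to the product and
  -- multiplies the power in front by q^s.
  term-raise : ∀ {L} n s f → s ≤ n → term (suc n) s f ≈[ L ] shift (d * s) (factor (d * suc n) (term n s f))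
  term-raise n s f s≤n = begin
    shift (d * (s * suc n + triangular s)) (prod (suc n ∸ s) e f)
      ≡⟨ cong (λ t → shift (d * (s * suc n + triangular s)) (prod t e f)) (+-∸-assoc 1 s≤n) ⟩
    shift (d * (s * suc n + triangular s)) (factor (d * (s + suc (n ∸ s))) (prod (n ∸ s) e f))
      ≡⟨ cong₂ (λ t u → shift t (factor (d * u) (prod (n ∸ s) e f))) (arith d s n (triangular s)) (trans (+-suc s (n ∸ s)) (cong suc (m+[n∸m]≡n s≤n))) ⟩
    shift (d * s + d * (s * n + triangular s)) (factor (d * suc n) (prod (n ∸ s) e f))
      ≈⟨ shift-shift _ _ _ ⟨
    shift (d * s) (shift (d * (s * n + triangular s)) (factor (d * suc n) (prod (n ∸ s) e f)))
      ≈⟨ shift-cong _ (factor-shift (d * suc n) (d * (s * n + triangular s)) (prod (n ∸ s) e f)) ⟨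
    shift (d * s) (factor (d * suc n) (term n s f)) ∎
    where
    open ≈-Reasoning
    e = λ i → d * (s + suc i)
    arith : ∀ d s n t → d * (s * suc n + t) ≡ d * s + d * (s * n + t)
    arith = solve-∀

  -- Splitting off the lowest factor, of exponent s + 1, turns the product of term s into that of
  -- term s + 1, and the shift supplies the difference of the powers in front. This link makes the
  -- sum telescope.
  term-next : ∀ {L} n s f → s < n → shift (d * (s + suc n)) (term n s f) ≈[ L ] factor (d * suc s) (term n (suc s) f)
  term-next n s f s<n = begin
    shift (d * (s + suc n)) (shift (d * (s * n + triangular s)) (prod (n ∸ s) e f))
      ≈⟨ shift-shift _ _ _ ⟩
    shift (d * (s + suc n) + d * (s * n + triangular s)) (prod (n ∸ s) e f)
      ≡⟨ cong₂ (λ t u → shift t (prod u e f)) (arith d s n (triangular s)) (+-∸-assoc 1 s<n) ⟩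
    shift x (prod (suc (n ∸ suc s)) e f)
      ≈⟨ shift-cong x (prod-first (n ∸ suc s) e f) ⟩
    shift x (factor (d * (s + 1)) (prod (n ∸ suc s) (e ∘ suc) f))
      ≡⟨ cong (λ t → shift x (factor (d * t) (prod (n ∸ suc s) (e ∘ suc) f))) (+-comm s 1) ⟩
    shift x (factor (d * suc s) (prod (n ∸ suc s) (e ∘ suc) f))
      ≈⟨ shift-cong x (factor-cong (d * suc s) (prod-exponents (n ∸ suc s) f (λ i → cong (d *_) (+-suc s (suc i))))) ⟩
    shift x (factor (d * suc s) (prod (n ∸ suc s) (λ i → d * (suc s + suc i)) f))
      ≈⟨ factor-shift (d * suc s) x _ ⟨
    factor (d * suc s) (term n (suc s) f) ∎
    where
    open ≈-Reasoning
    e = λ i → d * (s + suc i)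
    x = d * (suc s * n + triangular (suc s))
    arith : ∀ d s n t → d * (s + suc n) + d * (s * n + t) ≡ d * (suc s * n + (suc s + t))
    arith = solve-∀

  -- In powers of q^d, q^s (1 + q^(n+1)) + 1 = (1 + q^s) + q^(s+n+1). For s > 0 the first summand
  -- yields a shift of the preceding term, by `term-next`.
  term-sum : ∀ {L} n s f → s ≤ n →
    term (suc n) s f ⊞ term n s f ≈[ L ] factor (d * s) (term n s f) ⊞ shift (d * (s + suc n)) (term n s f)
  term-sum n s f s≤n = begin
    term (suc n) s f ⊞ t                                            ≈⟨ ⊞-cong (term-raise n s f s≤n) ≈-refl ⟩
    shift (d * s) (factor (d * suc n) t) ⊞ t                        ≡⟨ cong (λ z → shift (d * s) z ⊞ t) (factor-def _ t) ⟩
    shift (d * s) (t ⊞ shift (d * suc n) t) ⊞ t                     ≈⟨ ⊞-cong (shift-⊞ (d * s) t _) ≈-refl ⟩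
    (shift (d * s) t ⊞ shift (d * s) (shift (d * suc n) t)) ⊞ t     ≈⟨ ⊞-comm _ t ⟩
    t ⊞ (shift (d * s) t ⊞ shift (d * s) (shift (d * suc n) t))     ≈⟨ ⊞-assoc t _ _ ⟨
    (t ⊞ shift (d * s) t) ⊞ shift (d * s) (shift (d * suc n) t)     ≈⟨ ⊞-cong (≈-reflexive (sym (factor-def (d * s) t)))
                                                                         (≈-trans (shift-shift _ _ t) (shift-exponent t (sym (*-distribˡ-+ d s (suc n))))) ⟩
    factor (d * s) t ⊞ shift (d * (s + suc n)) t                    ∎
    where
    open ≈-Reasoning
    t = term n s f

  -- The differences telescope: only the last shifted term survives.
  partial-raise : ∀ {L} n m f → m ≤ n →
    partial (suc n) m f ≈[ L ] partial n m f ⊞ shift (d * (m + suc n)) (term n m f)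
  partial-raise n zero f _ = begin
    term (suc n) 0 f                                          ≈⟨ term-raise n 0 f z≤n ⟩
    shift (d * 0) (factor (d * suc n) (term n 0 f))           ≈⟨ ≈-trans (shift-exponent _ (*-zeroʳ d)) (shift-0 _) ⟩
    factor (d * suc n) (term n 0 f)                           ≡⟨ factor-def _ _ ⟩
    term n 0 f ⊞ shift (d * (0 + suc n)) (term n 0 f)         ∎
    where open ≈-Reasoning
  partial-raise n (suc m) f m<n = begin
    partial (suc n) m f ⊞ u′                       ≈⟨ ⊞-cong (partial-raise n m f (<⇒≤ m<n)) ≈-refl ⟩
    (p ⊞ shift (d * (m + suc n)) (term n m f)) ⊞ u′ ≈⟨ ⊞-cong (⊞-cong ≈-refl (term-next n m f m<n)) (≈-sym (⊞-cancelʳ u′ u)) ⟩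
    (p ⊞ v) ⊞ ((u′ ⊞ u) ⊞ u)                       ≈⟨ ⊞-cong ≈-refl (⊞-cong (term-sum n (suc m) f m<n) ≈-refl) ⟩
    (p ⊞ v) ⊞ ((v ⊞ w) ⊞ u)                        ≈⟨ ⊞-cong ≈-refl (⊞-assoc v w u) ⟩
    (p ⊞ v) ⊞ (v ⊞ (w ⊞ u))                        ≈⟨ ⊞-assoc (p ⊞ v) v (w ⊞ u) ⟨
    ((p ⊞ v) ⊞ v) ⊞ (w ⊞ u)                        ≈⟨ ⊞-cong (⊞-cancelʳ p v) (⊞-comm w u) ⟩
    p ⊞ (u ⊞ w)                                    ≈⟨ ⊞-assoc p u w ⟨
    (p ⊞ u) ⊞ w                                    ∎
    where
    open ≈-Reasoning
    p  = partial n m f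
    u  = term n (suc m) f
    u′ = term (suc n) (suc m) f
    v  = factor (d * suc m) u
    w  = shift (d * (suc m + suc n)) u

  term-last : ∀ {L} n f → term n n f ≈[ L ] shift (d * pent₊ n) f
  term-last n f = ≈-reflexive (cong (λ t → shift (d * pent₊ n) (prod t (λ i → d * (n + suc i)) f)) (n∸n≡0 n))

  -- At m = n the product in the last term is empty, so raising n adds two bare powers: 2 n + 1 +
  -- `pent₊ n` = `pent₋ n` from `partial-raise`, and `pent₊ (suc n)` from the new term.
  partial-pentagonal : ∀ {L} n f → partial n n f ≈[ L ] pentagonal n f
  partial-pentagonal zero    f = ≈-trans (shift-exponent f (*-zeroʳ d)) (shift-0 f)
  partial-pentagonal (suc n) f = ⊞-cong (begin
    partial (suc n) n f                                               ≈⟨ partial-raise n n f ≤-refl ⟩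
    partial n n f ⊞ shift (d * (n + suc n)) (term n n f)              ≈⟨ ⊞-cong (partial-pentagonal n f) (shift-cong _ (term-last n f)) ⟩
    pentagonal n f ⊞ shift (d * (n + suc n)) (shift (d * pent₊ n) f)  ≈⟨ ⊞-cong ≈-refl (shift-shift _ _ f) ⟩
    pentagonal n f ⊞ shift (d * (n + suc n) + d * pent₊ n) f          ≈⟨ ⊞-cong ≈-refl (shift-exponent f (arith d n (triangular n))) ⟩
    pentagonal n f ⊞ shift (d * pent₋ n) f                            ∎)
    (term-last (suc n) f)
    where
    open ≈-Reasoning
    arith : ∀ d n t → d * (n + suc n) + d * (n * n + t) ≡ d * (suc n * suc n + t)
    arith = solve-∀

  -- The terms with s ≥ 1 start at an exponent of at least n + 1; below it only s = 0, the full
  -- product, is visible.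
  partial-truncated : ∀ n m f → .{{NonZero d}} → partial n m f ≈[ suc n ] term n 0 f
  partial-truncated n zero    f = ≈-refl
  partial-truncated n (suc m) f = ≈-trans (⊞-vanishʳ _ _ (λ i i<1+n → shift-small _ _ i (<-≤-trans i<1+n large)))
                                          (partial-truncated n m f)
    where
    large : suc n ≤ d * (suc m * n + triangular (suc m))
    large = ≤-trans (≤-trans (≤-reflexive (+-comm 1 n)) (+-mono-≤ (m≤m+n n (m * n)) (s≤s z≤n)))
                    (m≤n*m (suc m * n + triangular (suc m)) d)

  prod-pentagonal : ∀ n f → .{{NonZero d}} → prod n (λ i → d * suc i) f ≈[ suc n ] pentagonal n f
  prod-pentagonal n f = begin
    prod n (λ i → d * suc i) f   ≈⟨ ≈-trans (shift-exponent _ (*-zeroʳ d)) (shift-0 _) ⟨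
    term n 0 f                   ≈⟨ partial-truncated n n f ⟨
    partial n n f                ≈⟨ partial-pentagonal n f ⟩
    pentagonal n f               ∎
    where open ≈-Reasoning

-- The generating function of copartitions

≡ᵇ-false : ∀ m n → m ≢ n → (m ≡ᵇ n) ≡ false
≡ᵇ-false m n m≢n with m ≡ᵇ n in eq
... | true  = contradiction (≡ᵇ⇒≡ m n (subst T (sym eq) tt)) m≢n
... | false = refl

≡ᵇ-true : ∀ m n → m ≡ n → (m ≡ᵇ n) ≡ true
≡ᵇ-true zero    .zero    refl = refl
≡ᵇ-true (suc m) .(suc m) refl = ≡ᵇ-true m m refl

Weight : Set
Weight = ℕ → ℕ → Bool

VanishesFrom : ℕ → Weight → Set
VanishesFrom b φ = ∀ g i → b ≤ i → φ g i ≡ false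

-- The parts are a + 1, a + 5, a + 9, …; a weight φ is evaluated at the number and the sum of parts.
module Multisets (a : ℕ) where

  part : ℕ → ℕ
  part j = suc (j * 4 + a)

  insert : ℕ → Weight → Weight
  insert c φ g i = φ (suc g) (c + i)

  raise : Weight → Weight
  raise φ g i = φ g (i + 4 * g)

  -- Sums φ in 𝔽₂ over the multisets of at most `f` members drawn from the `j` smallest parts: the
  -- largest part is either excluded or taken once and kept available.
  multisets : ℕ → ℕ → Weight → Bool
  multisets zero    j       φ = φ 0 0
  multisets (suc f) zero    φ = φ 0 0
  multisets (suc f) (suc j) φ = multisets (suc f) j φ xor multisets f (suc j) (insert (part j) φ)

  multisets-cong : ∀ f j {φ ψ} → (∀ g i → φ g i ≡ ψ g i) → multisets f j φ ≡ multisets f j ψ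
  multisets-cong zero    j       h = h 0 0
  multisets-cong (suc f) zero    h = h 0 0
  multisets-cong (suc f) (suc j) h = cong₂ _xor_ (multisets-cong (suc f) j h) (multisets-cong f (suc j) (λ g i → h (suc g) (part j + i)))

  multisets-false : ∀ f j {φ} → (∀ g i → φ g i ≡ false) → multisets f j φ ≡ false
  multisets-false zero    j       h = h 0 0
  multisets-false (suc f) zero    h = h 0 0
  multisets-false (suc f) (suc j) h = cong₂ _xor_ (multisets-false (suc f) j h) (multisets-false f (suc j) (λ g i → h (suc g) (part j + i)))

  multisets-xor : ∀ f j φ ψ → multisets f j (λ g i → φ g i xor ψ g i) ≡ multisets f j φ xor multisets f j ψ
  multisets-xor zero    j       φ ψ = refl
  multisets-xor (suc f) zero    φ ψ = refl
  multisets-xor (suc f) (suc j) φ ψ = trans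
    (cong₂ _xor_ (multisets-xor (suc f) j φ ψ) (multisets-xor f (suc j) _ _))
    (xor-interchange (multisets (suc f) j φ) (multisets (suc f) j ψ) _ _)

  multisets-empty : ∀ f j {φ} → (∀ g i → φ (suc g) i ≡ false) → multisets f j φ ≡ φ 0 0
  multisets-empty zero    j       h = refl
  multisets-empty (suc f) zero    h = refl
  multisets-empty (suc f) (suc j) h = trans
    (cong₂ _xor_ (multisets-empty (suc f) j h) (multisets-false f (suc j) (λ g i → h g (part j + i))))
    (xor-identityʳ _)

  raise-insert : ∀ j φ g i → raise (insert (part (suc j)) φ) g i ≡ insert (part j) (raise φ) g i
  raise-insert j φ g i = cong (φ (suc g)) (arith j a g i)
    where
    arith : ∀ j a g i → suc (suc j * 4 + a) + (i + 4 * g) ≡ suc (j * 4 + a) + i + 4 * suc g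
    arith = solve-∀

  insert-insert : ∀ c d φ g i → insert c (insert d φ) g i ≡ insert d (insert c φ) g i
  insert-insert c d φ g i = cong (φ (suc (suc g))) (arith c d i)
    where
    arith : ∀ c d i → d + (c + i) ≡ c + (d + i)
    arith = solve-∀

  -- Either a smallest part a + 1 is removed, or every part is lowered by 4.
  multisets-smallest : ∀ f j φ →
    multisets (suc f) (suc j) φ ≡ multisets f (suc j) (insert (part 0) φ) xor multisets (suc f) j (raise φ)
  multisets-smallest f zero φ = xor-comm (φ 0 0) _
  multisets-smallest zero (suc j) φ = begin
    multisets 1 (suc j) φ xor φ 1 (part (suc j) + 0)
      ≡⟨ cong (_xor φ 1 (part (suc j) + 0)) (multisets-smallest 0 j φ) ⟩
    (φ 1 (part 0 + 0) xor multisets 1 j (raise φ)) xor φ 1 (part (suc j) + 0)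
      ≡⟨ xor-assoc (φ 1 (part 0 + 0)) _ _ ⟩
    φ 1 (part 0 + 0) xor (multisets 1 j (raise φ) xor φ 1 (part (suc j) + 0))
      ≡⟨ cong (λ t → φ 1 (part 0 + 0) xor (multisets 1 j (raise φ) xor t)) (raise-insert j φ 0 0) ⟩
    φ 1 (part 0 + 0) xor (multisets 1 j (raise φ) xor insert (part j) (raise φ) 0 0) ∎
    where open ≡-Reasoning
  multisets-smallest (suc f) (suc j) φ = begin
    multisets (suc (suc f)) (suc j) φ xor multisets (suc f) (suc (suc j)) (insert c φ)
      ≡⟨ cong₂ _xor_ (multisets-smallest (suc f) j φ) (multisets-smallest f (suc j) (insert c φ)) ⟩
    (A xor B) xor (multisets f (suc (suc j)) (insert (part 0) (insert c φ)) xor multisets (suc f) (suc j) (raise (insert c φ)))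
      ≡⟨ cong₂ (λ s t → (A xor B) xor (s xor t)) (multisets-cong f (suc (suc j)) (insert-insert (part 0) c φ))
                                                 (multisets-cong (suc f) (suc j) (raise-insert j φ)) ⟩
    (A xor B) xor (multisets f (suc (suc j)) (insert c (insert (part 0) φ)) xor multisets (suc f) (suc j) (insert (part j) (raise φ)))
      ≡⟨ xor-interchange A B _ _ ⟩
    multisets (suc f) (suc (suc j)) (insert (part 0) φ) xor multisets (suc (suc f)) (suc j) (raise φ) ∎
    where
    open ≡-Reasoning
    c = part (suc j)
    A = multisets (suc f) (suc j) (insert (part 0) φ)
    B = multisets (suc (suc f)) j (raise φ)

  insert-vanishes : ∀ c {b φ} → VanishesFrom (suc b) φ → VanishesFrom b (insert (suc c) φ)
  insert-vanishes c v g i b≤i = v (suc g) (suc c + i) (s≤s (≤-trans b≤i (m≤n+m i c)))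

  more-parts : ∀ f j {b φ} → VanishesFrom b φ → b ≤ j → multisets f (suc j) φ ≡ multisets f j φ
  more-parts zero    j v b≤j = refl
  more-parts (suc f) j {b} {φ} v b≤j = trans
    (cong (multisets (suc f) j φ xor_) (multisets-false f (suc j) (λ g i → v (suc g) (part j + i)
      (≤-trans b≤j (≤-trans (m≤m*n j 4) (≤-trans (m≤m+n (j * 4) a) (m≤n⇒m≤1+n (m≤m+n (j * 4 + a) i))))))))
    (xor-identityʳ _)

  -- Each member is at least 1 and so lowers by at least 1 the bound from which the weight vanishes.
  -- After `b` members nothing is left.
  more-members : ∀ f j {b φ} → VanishesFrom b φ → b ≤ f → multisets (suc f) j φ ≡ multisets f j φ
  more-members f       j       {zero}  v b≤f = trans (multisets-false (suc f) j (λ g i → v g i z≤n)) (sym (multisets-false f j (λ g i → v g i z≤n)))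
  more-members (suc f) zero    {suc b} v b≤f = refl
  more-members (suc f) (suc j) {suc b} v (s≤s b≤f) =
    cong₂ _xor_ (more-members (suc f) j v (s≤s b≤f)) (more-members f (suc j) (insert-vanishes (j * 4 + a) v) b≤f)

  -- The three terms of `multisets-smallest` have different bounds; since the weight vanishes from
  -- `b` on, all of them can be replaced by `b`.
  multisets-recurrence : ∀ b {φ} → VanishesFrom b φ →
    multisets b b φ ≡ multisets b b (raise φ) xor multisets b b (insert (part 0) φ)
  multisets-recurrence b {φ} v = begin
    multisets b b φ
      ≡⟨ trans (more-members b (suc b) v ≤-refl) (more-parts b b v ≤-refl) ⟨
    multisets (suc b) (suc b) φ
      ≡⟨ multisets-smallest b b φ ⟩
    multisets b (suc b) (insert (part 0) φ) xor multisets (suc b) b (raise φ)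
      ≡⟨ cong₂ _xor_ (more-parts b b (λ g i b≤i → v (suc g) (part 0 + i) (≤-trans b≤i (m≤n+m i (part 0)))) ≤-refl)
                     (more-members b b (λ g i b≤i → v g (i + 4 * g) (≤-trans b≤i (m≤m+n i (4 * g)))) ≤-refl) ⟩
    multisets b b (insert (part 0) φ) xor multisets b b (raise φ)
      ≡⟨ xor-comm (multisets b b (insert (part 0) φ)) _ ⟩
    multisets b b (raise φ) xor multisets b b (insert (part 0) φ) ∎
    where open ≡-Reasoning

module M₁ = Multisets 0
module M₃ = Multisets 2

δ : Series
δ n = 0 ≡ᵇ n

module Truncated (b : ℕ) where

  -- The size 4 g s + i + j of a copartition whose parts in γ and in σ are raised by 4 k and 4 l.
  weightedSize : ℕ → ℕ → ℕ → ℕ → ℕ → ℕ → ℕ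
  weightedSize k l g i s j = i + j + 4 * (g * s) + 4 * (k * g) + 4 * (l * s)

  count : ℕ → ℕ → ℕ → Series
  count k l c n = M₃.multisets b b λ g i → M₁.multisets b b λ s j → (c + weightedSize k l g i s j) ≡ᵇ n

  size≥₁ : ∀ k l g i s j → j ≤ weightedSize k l g i s j
  size≥₁ k l g i s j = ≤-trans (m≤n+m j i) (≤-trans (m≤m+n (i + j) (4 * (g * s)))
    (≤-trans (m≤m+n _ (4 * (k * g))) (m≤m+n _ (4 * (l * s)))))

  size≥₃ : ∀ k l g i s j → i ≤ weightedSize k l g i s j
  size≥₃ k l g i s j = ≤-trans (m≤m+n i j) (≤-trans (m≤m+n (i + j) (4 * (g * s)))
    (≤-trans (m≤m+n _ (4 * (k * g))) (m≤m+n _ (4 * (l * s)))))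

  exceeds : ∀ {m c n} t → n < b → b ≤ m → m ≤ t → ((c + t) ≡ᵇ n) ≡ false
  exceeds {c = c} {n} t n<b b≤m m≤t = ≡ᵇ-false (c + t) n (λ eq → <-irrefl (sym eq) (<-≤-trans n<b (≤-trans b≤m (≤-trans m≤t (m≤n+m t c)))))

  -- Removing a smallest part 3 + 4 k from γ also takes 4 from each of the s parts of ρ. These fours
  -- are booked as a raise of σ, which is why l becomes l + 1.
  count-recurrence₃ : ∀ k l c n → n < b → count k l c n ≡ count (suc k) l c n xor count k (suc l) (c + (3 + 4 * k)) n
  count-recurrence₃ k l c n n<b = trans
    (M₃.multisets-recurrence b (λ g i b≤i → M₁.multisets-false b b (λ s j → exceeds {c = c} (weightedSize k l g i s j) n<b b≤i (size≥₃ k l g i s j))))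
    (cong₂ _xor_
      (M₃.multisets-cong b b (λ g i → M₁.multisets-cong b b (λ s j → cong (_≡ᵇ n) (raised k l c g i s j))))
      (M₃.multisets-cong b b (λ g i → M₁.multisets-cong b b (λ s j → cong (_≡ᵇ n) (inserted k l c g i s j)))))
    where
    raised : ∀ k l c g i s j → c + (i + 4 * g + j + 4 * (g * s) + 4 * (k * g) + 4 * (l * s)) ≡
                               c + (i + j + 4 * (g * s) + 4 * (suc k * g) + 4 * (l * s))
    raised = solve-∀
    inserted : ∀ k l c g i s j → c + (3 + i + j + 4 * (suc g * s) + 4 * (k * suc g) + 4 * (l * s)) ≡
                                 c + (3 + 4 * k) + (i + j + 4 * (g * s) + 4 * (k * g) + 4 * (suc l * s))
    inserted = solve-∀

  -- Removing a smallest part 1 + 4 l from σ also takes away one part 4 g of ρ, booked as a raise of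
  -- γ. The symmetry of 4 g s makes both recurrences stay in the same two-parameter family.
  count-recurrence₁ : ∀ k l c n → n < b → count k l c n ≡ count k (suc l) c n xor count (suc k) l (c + (1 + 4 * l)) n
  count-recurrence₁ k l c n n<b = trans
    (M₃.multisets-cong b b (λ g i → trans
      (M₁.multisets-recurrence b (λ s j b≤j → exceeds {c = c} (weightedSize k l g i s j) n<b b≤j (size≥₁ k l g i s j)))
      (cong₂ _xor_
        (M₁.multisets-cong b b (λ s j → cong (_≡ᵇ n) (raised k l c g i s j)))
        (M₁.multisets-cong b b (λ s j → cong (_≡ᵇ n) (inserted k l c g i s j))))))
    (M₃.multisets-xor b b _ _)
    where
    raised : ∀ k l c g i s j → c + (i + (j + 4 * s) + 4 * (g * s) + 4 * (k * g) + 4 * (l * s)) ≡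
                               c + (i + j + 4 * (g * s) + 4 * (k * g) + 4 * (suc l * s))
    raised = solve-∀
    inserted : ∀ k l c g i s j → c + (i + (1 + j) + 4 * (g * suc s) + 4 * (k * g) + 4 * (l * suc s)) ≡
                                 c + (1 + 4 * l) + (i + j + 4 * (g * s) + 4 * (suc k * g) + 4 * (l * s))
    inserted = solve-∀

  count-shift : ∀ k l c n → count k l c n ≡ shift c (count k l 0) n
  count-shift k l zero    n       = sym (shift-zero _ n)
  count-shift k l (suc c) zero    = trans (M₃.multisets-false b b (λ g i → M₁.multisets-false b b (λ s j → refl)))
                                          (sym (shift-suc-zero c _))
  count-shift k l (suc c) (suc n) = trans (count-shift k l c n) (sym (shift-suc-suc c _ n))

  series : ℕ → ℕ → Series
  series k l = count k l 0

  series-recurrence₃ : ∀ k l → series k l ≈[ b ] series (suc k) l ⊞ shift (3 + 4 * k) (series k (suc l))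
  series-recurrence₃ k l = coeffs λ n n<b → trans (count-recurrence₃ k l 0 n n<b)
    (trans (cong (series (suc k) l n xor_) (count-shift k (suc l) (3 + 4 * k) n)) (sym (⊞-coeff _ _ n)))

  series-recurrence₁ : ∀ k l → series k l ≈[ b ] series k (suc l) ⊞ shift (1 + 4 * l) (series (suc k) l)
  series-recurrence₁ k l = coeffs λ n n<b → trans (count-recurrence₁ k l 0 n n<b)
    (trans (cong (series k (suc l) n xor_) (count-shift (suc k) l (1 + 4 * l) n)) (sym (⊞-coeff _ _ n)))

  -- Once every part is raised by 4 b, only the empty copartition has size below b.
  series-limit : series b b ≈[ b ] δ
  series-limit = coeffs λ n n<b → trans
    (M₃.multisets-empty b b (λ g i → M₁.multisets-false b b (λ s j →
      exceeds {c = 0} (weightedSize b b (suc g) i s j) n<b ≤-refl (≤-trans (large b g)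
        (≤-trans (m≤n+m (4 * (b * suc g)) (i + j + 4 * (suc g * s))) (m≤m+n _ (4 * (b * s))))))))
    (trans (M₁.multisets-empty b b (λ s j →
      exceeds {c = 0} (weightedSize b b 0 0 (suc s) j) n<b ≤-refl (≤-trans (large b s)
        (m≤n+m (4 * (b * suc s)) (j + 0 + 4 * (b * 0))))))
      (cong (_≡ᵇ n) (cong (λ z → 4 * z + 4 * z) (*-zeroʳ b))))
    where
    large : ∀ b g → b ≤ 4 * (b * suc g)
    large b g = ≤-trans (m≤m*n b (suc g)) (m≤n*m (b * suc g) 4)

  ⊞-move : ∀ {f g h} → f ≈[ b ] g ⊞ h → f ⊞ h ≈[ b ] g
  ⊞-move p = ≈-trans (⊞-cong p ≈-refl) (⊞-cancelʳ _ _)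

  -- Both recurrences contain `series k 1`; adding q^(3+4k) times the second to the first eliminates
  -- it. The surviving shift has exponent (3 + 4 k) + 1.
  factor-series₃ : ∀ k → factor (3 + 4 * k) (series k 0) ≈[ b ] factor (4 + 4 * k) (series (suc k) 0)
  factor-series₃ k = begin
    factor c (series k 0)
      ≡⟨ factor-def c _ ⟩
    series k 0 ⊞ shift c (series k 0)
      ≈⟨ ⊞-cong (series-recurrence₃ k 0) (shift-cong c (series-recurrence₁ k 0)) ⟩
    (series (suc k) 0 ⊞ shift c (series k 1)) ⊞ shift c (series k 1 ⊞ shift 1 (series (suc k) 0))
      ≈⟨ ⊞-cong ≈-refl (≈-trans (shift-⊞ c _ _) (⊞-comm _ _)) ⟩
    (series (suc k) 0 ⊞ shift c (series k 1)) ⊞ (shift c (shift 1 (series (suc k) 0)) ⊞ shift c (series k 1))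
      ≈⟨ ⊞-interchange _ _ _ _ ⟩
    (series (suc k) 0 ⊞ shift c (shift 1 (series (suc k) 0))) ⊞ (shift c (series k 1) ⊞ shift c (series k 1))
      ≈⟨ ⊞-vanishʳ _ _ (λ n _ → trans (⊞-coeff (shift c (series k 1)) (shift c (series k 1)) n) (xor-same (shift c (series k 1) n))) ⟩
    series (suc k) 0 ⊞ shift c (shift 1 (series (suc k) 0))
      ≈⟨ ⊞-cong ≈-refl (≈-trans (shift-shift c 1 _) (shift-exponent _ (+-comm c 1))) ⟩
    series (suc k) 0 ⊞ shift (4 + 4 * k) (series (suc k) 0)
      ≡⟨ factor-def (4 + 4 * k) _ ⟨
    factor (4 + 4 * k) (series (suc k) 0) ∎
    where
    open ≈-Reasoning
    c = 3 + 4 * k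

  prod-series₃ : ∀ k → prod k (λ i → 3 + 4 * i) (series 0 0) ≈[ b ] prod k (λ i → 4 + 4 * i) (series k 0)
  prod-series₃ zero    = ≈-refl
  prod-series₃ (suc k) = begin
    factor c (prod k (λ i → 3 + 4 * i) (series 0 0))            ≈⟨ factor-cong c (prod-series₃ k) ⟩
    factor c (prod k (λ i → 4 + 4 * i) (series k 0))            ≈⟨ factor-prod c k _ _ ⟩
    prod k (λ i → 4 + 4 * i) (factor c (series k 0))            ≈⟨ prod-cong k _ (factor-series₃ k) ⟩
    prod k (λ i → 4 + 4 * i) (factor (4 + 4 * k) (series (suc k) 0))  ≈⟨ factor-prod (4 + 4 * k) k _ _ ⟨
    prod (suc k) (λ i → 4 + 4 * i) (series (suc k) 0)           ∎
    where
    open ≈-Reasoning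
    c = 3 + 4 * k

  series-stable : ∀ l → series (suc b) l ≈[ b ] series b l
  series-stable l = ≈-sym (≈-trans (series-recurrence₃ b l)
    (⊞-vanishʳ _ _ (λ n n<b → shift-small (3 + 4 * b) _ n (<-≤-trans n<b (≤-trans (m≤n*m b 4) (m≤n+m (4 * b) 3))))))

  -- At k = b a nonempty γ is invisible modulo q^b, so raising it once more changes nothing, and the
  -- second recurrence becomes multiplication by 1 + q^(1+4l).
  prod-series₁ : ∀ l → prod l (λ i → 1 + 4 * i) (series b 0) ≈[ b ] series b l
  prod-series₁ zero    = ≈-refl
  prod-series₁ (suc l) = begin
    factor (1 + 4 * l) (prod l (λ i → 1 + 4 * i) (series b 0))   ≈⟨ factor-cong _ (prod-series₁ l) ⟩
    factor (1 + 4 * l) (series b l)                              ≡⟨ factor-def _ _ ⟩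
    series b l ⊞ shift (1 + 4 * l) (series b l)                  ≈⟨ ⊞-cong ≈-refl (shift-cong (1 + 4 * l) (series-stable l)) ⟨
    series b l ⊞ shift (1 + 4 * l) (series (suc b) l)            ≈⟨ ⊞-move (series-recurrence₁ b l) ⟩
    series b (suc l)                                             ∎
    where open ≈-Reasoning

  product-formula : prod b (λ i → 1 + 4 * i) (prod b (λ i → 3 + 4 * i) (series 0 0)) ≈[ b ] prod b (λ i → 4 + 4 * i) δ
  product-formula = begin
    prod b (λ i → 1 + 4 * i) (prod b (λ i → 3 + 4 * i) (series 0 0))   ≈⟨ prod-cong b _ (prod-series₃ b) ⟩
    prod b (λ i → 1 + 4 * i) (prod b (λ i → 4 + 4 * i) (series b 0))   ≈⟨ prod-prod b _ b _ _ ⟩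
    prod b (λ i → 4 + 4 * i) (prod b (λ i → 1 + 4 * i) (series b 0))   ≈⟨ prod-cong b _ (≈-trans (prod-series₁ b) series-limit) ⟩
    prod b (λ i → 4 + 4 * i) δ                                        ∎
    where open ≈-Reasoning

  prod-square : ∀ {L} n f → prod n (λ i → 2 + 2 * i) f ≈[ L ] prod n suc (prod n suc f)
  prod-square zero    f = ≈-refl
  prod-square (suc n) f = begin
    factor (2 + 2 * n) (prod n (λ i → 2 + 2 * i) f)          ≡⟨ cong (λ t → factor t (prod n (λ i → 2 + 2 * i) f)) (arith n) ⟩
    factor (suc n + suc n) (prod n (λ i → 2 + 2 * i) f)      ≈⟨ factor-square (suc n) _ ⟨
    factor (suc n) (factor (suc n) (prod n (λ i → 2 + 2 * i) f))  ≈⟨ factor-cong _ (factor-cong _ (prod-square n f)) ⟩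
    factor (suc n) (factor (suc n) (prod n suc (prod n suc f)))   ≈⟨ factor-cong _ (factor-prod (suc n) n suc _) ⟩
    prod (suc n) suc (prod (suc n) suc f)                    ∎
    where
    open ≈-Reasoning
    arith : ∀ n → 2 + 2 * n ≡ suc n + suc n
    arith = solve-∀

  prod-truncate : ∀ {L} m n f → L ≤ m → prod (n + m) suc f ≈[ L ] prod m suc f
  prod-truncate m zero    f L≤m = ≈-refl
  prod-truncate m (suc n) f L≤m = ≈-trans (factor-large _ _ (≤-trans L≤m (≤-trans (m≤n+m m n) (n≤1+n (n + m))))) (prod-truncate m n f L≤m)

  -- Multiplying by (q;q) clears the denominators of the product formula and leaves the even
  -- exponents, whose product (q²;q²) equals (q;q)² over 𝔽₂. One factor (q;q) then cancels.
  series-product : series 0 0 ≈[ b ] prod (b * 2) suc (prod b (λ i → 4 + 4 * i) δ)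
  series-product = prod-cancel (b * 2) (λ i → i) (begin
    prod (b * 2) suc (series 0 0)
      -- Factors of exponent above 2 b are 1 modulo q^b; adding them gives the 4 b exponents that
      -- split evenly by residue.
      ≈⟨ prod-truncate (b * 2) (b * 2) _ (m≤m*n b 2) ⟨
    prod (b * 2 + b * 2) suc (series 0 0)
      ≡⟨ cong (λ t → prod t suc (series 0 0)) (arith b) ⟩
    prod (b * 4) suc (series 0 0)
      ≈⟨ prod-split b (series 0 0) ⟩
    prod b (λ i → 1 + 4 * i) (prod b (λ i → 3 + 4 * i) (prod (b * 2) (λ i → 2 + 2 * i) (series 0 0)))
      ≈⟨ prod-cong b _ (prod-prod b (λ i → 3 + 4 * i) (b * 2) _ _) ⟩
    prod b (λ i → 1 + 4 * i) (prod (b * 2) (λ i → 2 + 2 * i) (prod b (λ i → 3 + 4 * i) (series 0 0)))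
      ≈⟨ prod-prod b (λ i → 1 + 4 * i) (b * 2) _ _ ⟩
    prod (b * 2) (λ i → 2 + 2 * i) (prod b (λ i → 1 + 4 * i) (prod b (λ i → 3 + 4 * i) (series 0 0)))
      ≈⟨ prod-cong (b * 2) _ product-formula ⟩
    prod (b * 2) (λ i → 2 + 2 * i) (prod b (λ i → 4 + 4 * i) δ)
      ≈⟨ prod-square (b * 2) _ ⟩
    prod (b * 2) suc (prod (b * 2) suc (prod b (λ i → 4 + 4 * i) δ)) ∎)
    where
    open ≈-Reasoning
    arith : ∀ b → b * 2 + b * 2 ≡ b * 4
    arith = solve-∀

  series-pentagonal : series 0 0 ≈[ b ] Pentagonal.pentagonal 1 (b * 2) (Pentagonal.pentagonal 4 b δ)
  series-pentagonal = begin
    series 0 0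
      ≈⟨ series-product ⟩
    prod (b * 2) suc (prod b (λ i → 4 + 4 * i) δ)
      ≈⟨ prod-cong (b * 2) suc (prod-exponents b δ (λ i → sym (*-suc 4 i))) ⟩
    prod (b * 2) suc (prod b (λ i → 4 * suc i) δ)
      ≈⟨ prod-cong (b * 2) suc (≈-weaken (n≤1+n b) (Pentagonal.prod-pentagonal 4 b δ)) ⟩
    prod (b * 2) suc (Pentagonal.pentagonal 4 b δ)
      ≈⟨ prod-exponents (b * 2) _ (λ i → sym (*-identityˡ (suc i))) ⟩
    prod (b * 2) (λ i → 1 * suc i) (Pentagonal.pentagonal 4 b δ)
      ≈⟨ ≈-weaken (m≤n⇒m≤1+n (m≤m*n b 2)) (Pentagonal.prod-pentagonal 1 (b * 2) _) ⟩
    Pentagonal.pentagonal 1 (b * 2) (Pentagonal.pentagonal 4 b δ) ∎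
    where open ≈-Reasoning

-- Enumerating copartitions

xorSum : ∀ {A : Set} → (A → Bool) → List A → Bool
xorSum p = foldr (λ x b → p x xor b) false

xorSum-++ : ∀ {A : Set} (p : A → Bool) xs ys → xorSum p (xs ++ ys) ≡ xorSum p xs xor xorSum p ys
xorSum-++ p []       ys = refl
xorSum-++ p (x ∷ xs) ys = trans (cong (p x xor_) (xorSum-++ p xs ys)) (sym (xor-assoc (p x) _ _))

xorSum-cong : ∀ {A : Set} {p q : A → Bool} → (∀ x → p x ≡ q x) → ∀ xs → xorSum p xs ≡ xorSum q xs
xorSum-cong h []       = refl
xorSum-cong h (x ∷ xs) = cong₂ _xor_ (h x) (xorSum-cong h xs)

xorSum-map : ∀ {A B : Set} (p : B → Bool) (f : A → B) xs → xorSum p (map f xs) ≡ xorSum (p ∘ f) xs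
xorSum-map p f []       = refl
xorSum-map p f (x ∷ xs) = cong (p (f x) xor_) (xorSum-map p f xs)

xorSum-concatMap : ∀ {A B : Set} (p : B → Bool) (f : A → List B) xs →
  xorSum p (concatMap f xs) ≡ xorSum (xorSum p ∘ f) xs
xorSum-concatMap p f []       = refl
xorSum-concatMap p f (x ∷ xs) = trans (xorSum-++ p (f x) _) (cong (xorSum p (f x) xor_) (xorSum-concatMap p f xs))

xorSum-applyUpTo : ∀ {A : Set} (p : A → Bool) f n → xorSum p (applyUpTo f n) ≡ ⊕.sum n (p ∘ f)
xorSum-applyUpTo p f zero    = refl
xorSum-applyUpTo p f (suc n) = trans (cong (p (f 0) xor_) (xorSum-applyUpTo p (f ∘ suc) n)) (sym (⊕.sum-first n (p ∘ f)))

isOdd-length-filter : ∀ {A : Set} (p : A → Bool) xs → isOdd (length (filter (λ x → T? (p x)) xs)) ≡ xorSum p xs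
isOdd-length-filter p []       = refl
isOdd-length-filter p (x ∷ xs) with p x
... | true  = cong not (isOdd-length-filter p xs)
... | false = isOdd-length-filter p xs

-- Sums over all nonincreasing lists with at most f entries, all between 1 and k.
chains : ℕ → ℕ → (List ℕ → Bool) → Bool
chains zero    k       F = F []
chains (suc f) zero    F = F []
chains (suc f) (suc k) F = chains (suc f) k F xor chains f (suc k) (F ∘ (suc k ∷_))

chains-cong : ∀ f k {F G} → (∀ γ → F γ ≡ G γ) → chains f k F ≡ chains f k G
chains-cong zero    k       h = h []
chains-cong (suc f) zero    h = h []
chains-cong (suc f) (suc k) h = cong₂ _xor_ (chains-cong (suc f) k h) (chains-cong f (suc k) (λ γ → h (suc k ∷ γ)))

chains-false : ∀ f k {F} → (∀ γ → F γ ≡ false) → chains f k F ≡ false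
chains-false zero    k       h = h []
chains-false (suc f) zero    h = h []
chains-false (suc f) (suc k) h = cong₂ _xor_ (chains-false (suc f) k h) (chains-false f (suc k) (λ γ → h (suc k ∷ γ)))

chains-xor : ∀ f k F G → chains f k (λ γ → F γ xor G γ) ≡ chains f k F xor chains f k G
chains-xor zero    k       F G = refl
chains-xor (suc f) zero    F G = refl
chains-xor (suc f) (suc k) F G = trans
  (cong₂ _xor_ (chains-xor (suc f) k F G) (chains-xor f (suc k) _ _))
  (xor-interchange (chains (suc f) k F) (chains (suc f) k G) _ _)

chains-sum : ∀ f k n (F : ℕ → List ℕ → Bool) → chains f k (λ γ → ⊕.sum n (λ i → F i γ)) ≡ ⊕.sum n (λ i → chains f k (F i))
chains-sum f k zero    F = chains-false f k (λ _ → refl)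
chains-sum f k (suc n) F = trans (chains-xor f k _ (F n)) (cong (_xor chains f k (F n)) (chains-sum f k n F))

chains-empty : ∀ f k {F} → (∀ p γ → F (suc p ∷ γ) ≡ false) → chains f k F ≡ F []
chains-empty zero    k       h = refl
chains-empty (suc f) zero    h = refl
chains-empty (suc f) (suc k) {F} h = trans
  (cong₂ _xor_ (chains-empty (suc f) k h) (chains-false f (suc k) (h k)))
  (xor-identityʳ (F []))

-- Bridges two recursions: `chains` lowers the largest allowed part by one, whereas `pb` chooses the
-- largest part at once.
chains-largest : ∀ f k F → chains (suc f) k F ≡ F [] xor ⊕.sum k (λ p → chains f (suc p) (F ∘ (suc p ∷_)))
chains-largest f zero    F = sym (xor-identityʳ (F []))
chains-largest f (suc k) F = trans (cong (_xor chains f (suc k) (F ∘ (suc k ∷_))) (chains-largest f k F)) (xor-assoc (F []) _ _)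

≡ᵇ-∸ : ∀ p s n → p ≤ n → (s ≡ᵇ n ∸ p) ≡ (p + s ≡ᵇ n)
≡ᵇ-∸ zero    s n       _         = refl
≡ᵇ-∸ (suc p) s (suc n) (s≤s p≤n) = ≡ᵇ-∸ p s n p≤n

-- `partitions i` uses i as fuel and as largest part, but one pair of bounds has to serve for all i.
-- Hence the independent `f′` and `k′`: fuel n suffices, and no part exceeds n, so only n ⊓ k
-- matters.
xorSum-pb : ∀ f n k {f′ k′} F → n ≤ f → n ≤ f′ → n ⊓ k ≡ n ⊓ k′ →
  xorSum F (pb f n k) ≡ chains f′ k′ (λ γ → (listSum γ ≡ᵇ n) ∧ F γ)
xorSum-pb zero    zero k {f′} {k′} F _ _ _ = trans (xor-identityʳ (F [])) (sym (chains-empty f′ k′ (λ p γ → refl)))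
xorSum-pb (suc f) zero k {f′} {k′} F _ _ _ = trans (xor-identityʳ (F [])) (sym (chains-empty f′ k′ (λ p γ → refl)))
xorSum-pb (suc f) (suc n) k {suc f′} {k′} F (s≤s n≤f) (s≤s n≤f′) k≈k′ = begin
  xorSum F (concatMap (λ p → map (p ∷_) (pb f (suc n ∸ p) p)) (applyUpTo suc (suc n ⊓ k)))
    ≡⟨ xorSum-concatMap F _ (applyUpTo suc (suc n ⊓ k)) ⟩
  xorSum (λ p → xorSum F (map (p ∷_) (pb f (suc n ∸ p) p))) (applyUpTo suc (suc n ⊓ k))
    ≡⟨ xorSum-applyUpTo (λ p → xorSum F (map (p ∷_) (pb f (suc n ∸ p) p))) suc (suc n ⊓ k) ⟩
  ⊕.sum (suc n ⊓ k) (λ p → xorSum F (map (suc p ∷_) (pb f (n ∸ p) (suc p))))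
    ≡⟨ cong (λ t → ⊕.sum t (λ p → xorSum F (map (suc p ∷_) (pb f (n ∸ p) (suc p))))) k≈k′ ⟩
  ⊕.sum (suc n ⊓ k′) (λ p → xorSum F (map (suc p ∷_) (pb f (n ∸ p) (suc p))))
    ≡⟨ ⊕.sum-cong-< (suc n ⊓ k′) (λ p p< → step p (≤-pred (<-≤-trans p< (m⊓n≤m (suc n) k′)))) ⟩
  ⊕.sum (suc n ⊓ k′) G
    ≡⟨ extend ⟨
  ⊕.sum k′ G
    ≡⟨ chains-largest f′ k′ _ ⟨
  chains (suc f′) k′ (λ γ → (listSum γ ≡ᵇ suc n) ∧ F γ) ∎
  where
  open ≡-Reasoning
  G : ℕ → Bool
  G p = chains f′ (suc p) (λ γ → (p + listSum γ ≡ᵇ n) ∧ F (suc p ∷ γ))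
  step : ∀ p → p ≤ n → xorSum F (map (suc p ∷_) (pb f (n ∸ p) (suc p))) ≡ G p
  step p p≤n = trans (xorSum-map F (suc p ∷_) (pb f (n ∸ p) (suc p)))
    (trans (xorSum-pb f (n ∸ p) (suc p) (F ∘ (suc p ∷_)) (≤-trans (m∸n≤m n p) n≤f) (≤-trans (m∸n≤m n p) n≤f′) refl)
      (chains-cong f′ (suc p) (λ γ → cong (_∧ F (suc p ∷ γ)) (≡ᵇ-∸ p (listSum γ) n p≤n))))
  large : ∀ p → suc n ≤ p → G p ≡ false
  large p n<p = chains-false f′ (suc p) (λ γ → cong (_∧ F (suc p ∷ γ))
    (≡ᵇ-false (p + listSum γ) n (λ eq → <-irrefl (sym eq) (<-≤-trans n<p (m≤m+n p (listSum γ))))))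
  extend : ⊕.sum k′ G ≡ ⊕.sum (suc n ⊓ k′) G
  extend with ≤-total (suc n) k′
  ... | inj₁ n<k′ = trans (⊕.sum-extend large n<k′) (cong (λ t → ⊕.sum t G) (sym (m≤n⇒m⊓n≡m n<k′)))
  ... | inj₂ k′≤  = cong (λ t → ⊕.sum t G) (sym (m≥n⇒m⊓n≡n k′≤))

sum-select : ∀ b s {x} → (b ≤ s → x ≡ false) → ⊕.sum b (λ i → (s ≡ᵇ i) ∧ x) ≡ x
sum-select zero    s h = sym (h z≤n)
sum-select (suc b) s {x} h with s ≟ b
... | yes refl = trans (cong₂ _xor_ (⊕.sum-ε b (λ i i<b → cong (_∧ x) (≡ᵇ-false b i (λ eq → <-irrefl (sym eq) i<b)))) (cong (_∧ x) (≡ᵇ-true b b refl))) refl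
... | no s≢b   = trans (cong (⊕.sum b (λ i → (s ≡ᵇ i) ∧ x) xor_) (cong (_∧ x) (≡ᵇ-false s b s≢b)))
  (trans (xor-identityʳ _) (sum-select b s (λ b≤s → h (≤∧≢⇒< b≤s (s≢b ∘ sym)))))

-- Every list has exactly one sum, so adding over all i below `b` removes the condition on the sum
-- wherever F can be nonzero.
sum-partitions : ∀ b k F → b ≤ k → (∀ γ → b ≤ listSum γ → F γ ≡ false) →
  ⊕.sum b (λ i → xorSum F (partitions i)) ≡ chains b k F
sum-partitions b k F b≤k v = begin
  ⊕.sum b (λ i → xorSum F (partitions i))
    ≡⟨ ⊕.sum-cong-< b (λ i i<b → xorSum-pb i i i F ≤-refl (<⇒≤ i<b) (trans (m≤n⇒m⊓n≡m ≤-refl) (sym (m≤n⇒m⊓n≡m (≤-trans (<⇒≤ i<b) b≤k))))) ⟩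
  ⊕.sum b (λ i → chains b k (λ γ → (listSum γ ≡ᵇ i) ∧ F γ))
    ≡⟨ chains-sum b k b _ ⟨
  chains b k (λ γ → ⊕.sum b (λ i → (listSum γ ≡ᵇ i) ∧ F γ))
    ≡⟨ chains-cong b k (λ γ → sum-select b (listSum γ) (v γ)) ⟩
  chains b k F ∎
  where open ≡-Reasoning

module Parts (a : ℕ) where
  open Multisets a

  weigh : Weight → List ℕ → Bool
  weigh φ γ = okParts (suc a) 4 γ ∧ φ (length γ) (listSum γ)

  okPart-small : ∀ {p} → p ≤ a → okPart (suc a) 4 p ≡ false
  okPart-small {p} p≤a = cong (_∧ does (4 ∣? (p ∸ suc a))) (dec-false (suc a ≤? p) (≤⇒≯ p≤a))

  okPart-large : ∀ r j → okPart (suc a) 4 (suc (r + (j * 4 + a))) ≡ does (4 ∣? (r + j * 4))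
  okPart-large r j = cong₂ _∧_
    (dec-true (suc a ≤? suc (r + (j * 4 + a))) (s≤s (≤-trans (m≤n+m a (j * 4)) (m≤n+m (j * 4 + a) r))))
    (cong (λ t → does (4 ∣? t)) (trans (cong (_∸ a) (sym (+-assoc r (j * 4) a))) (m+n∸n≡m (r + j * 4) a)))

  okPart-part : ∀ j → okPart (suc a) 4 (part j) ≡ true
  okPart-part j = trans (okPart-large 0 j) (dec-true (4 ∣? (j * 4)) (n∣m*n j))

  okPart-between : ∀ r j → suc r < 4 → okPart (suc a) 4 (suc (suc r + (j * 4 + a))) ≡ false
  okPart-between r j r<4 = trans (okPart-large (suc r) j) (dec-false (4 ∣? (suc r + j * 4))
    (λ d → >⇒∤ r<4 (∣m+n∣m⇒∣n (subst (4 ∣_) (+-comm (suc r) (j * 4)) d) (n∣m*n j))))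

  chains-skip : ∀ f k φ → okPart (suc a) 4 (suc k) ≡ false → chains f (suc k) (weigh φ) ≡ chains f k (weigh φ)
  chains-skip zero    k φ bad = refl
  chains-skip (suc f) k φ bad = trans
    (cong (chains (suc f) k (weigh φ) xor_) (chains-false f (suc k) (λ γ →
      cong (λ t → (t ∧ okParts (suc a) 4 γ) ∧ φ (suc (length γ)) (suc k + listSum γ)) bad)))
    (xor-identityʳ _)

  chains-skip₃ : ∀ f j φ → chains f (suc j * 4 + a) (weigh φ) ≡ chains f (part j) (weigh φ)
  chains-skip₃ f j φ =
    trans (chains-skip f (3 + (j * 4 + a)) φ (okPart-between 2 j (s≤s (s≤s (s≤s (s≤s z≤n))))))
    (trans (chains-skip f (2 + (j * 4 + a)) φ (okPart-between 1 j (s≤s (s≤s (s≤s z≤n)))))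
           (chains-skip f (1 + (j * 4 + a)) φ (okPart-between 0 j (s≤s (s≤s z≤n)))))

  chains-small : ∀ f k φ → k ≤ a → chains f k (weigh φ) ≡ φ 0 0
  chains-small zero    k       φ k≤a = refl
  chains-small (suc f) zero    φ k≤a = refl
  chains-small (suc f) (suc k) φ k<a = trans (chains-skip (suc f) k φ (okPart-small k<a)) (chains-small (suc f) k φ (<⇒≤ k<a))

  -- Exactly j admissible parts, a + 1, a + 5, ..., are at most j * 4 + a. All other values can be
  -- skipped, as `weigh` vanishes on every list that contains one.
  chains-multisets : ∀ f j φ → chains f (j * 4 + a) (weigh φ) ≡ multisets f j φ
  chains-multisets zero    j       φ = refl
  chains-multisets (suc f) zero    φ = chains-small (suc f) a φ ≤-refl
  chains-multisets (suc f) (suc j) φ = trans (chains-skip₃ (suc f) j φ)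
    (cong₂ _xor_ (chains-multisets (suc f) j φ)
      (trans (chains-cong f (part j) (λ γ →
               cong (λ t → (t ∧ okParts (suc a) 4 γ) ∧ φ (suc (length γ)) (part j + listSum γ)) (okPart-part j)))
      (trans (sym (chains-skip₃ f j (insert (part j) φ))) (chains-multisets f (suc j) (insert (part j) φ)))))

module Parts₁ = Parts 0
module Parts₃ = Parts 2

sum-replicate : ∀ n x → listSum (replicate n x) ≡ x * n
sum-replicate zero    x = sym (*-zeroʳ x)
sum-replicate (suc n) x = trans (cong (x +_) (sum-replicate n x)) (sym (*-suc x n))

isOdd-cp : ∀ n → isOdd (cp 3 1 4 n) ≡ Truncated.series (suc n) 0 0 n
isOdd-cp n = begin
  isOdd (cp 3 1 4 n)
    ≡⟨ isOdd-length-filter P (pairs n) ⟩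
  xorSum P (pairs n)
    ≡⟨ xorSum-concatMap P pairsᵢ (upTo b) ⟩
  xorSum (xorSum P ∘ pairsᵢ) (upTo b)
    ≡⟨ xorSum-applyUpTo (xorSum P ∘ pairsᵢ) id b ⟩
  ⊕.sum b (xorSum P ∘ pairsᵢ)
    ≡⟨ ⊕.sum-cong b (λ i → trans (xorSum-concatMap P pairsᵧ (partitions i)) (xorSum-cong inner (partitions i))) ⟩
  ⊕.sum b (λ i → xorSum (Parts₃.weigh outerWeight) (partitions i))
    ≡⟨ sum-partitions b (b * 4 + 2) (Parts₃.weigh outerWeight) (≤-trans (m≤m*n b 4) (m≤m+n (b * 4) 2)) (λ γ b≤γ →
         trans (cong (okParts 3 4 γ ∧_) (M₁.multisets-false b b (λ s j →
           Truncated.exceeds b {c = 0} (weightedSize 0 0 (length γ) (listSum γ) s j) (n<1+n n) b≤γ (size≥₃ 0 0 (length γ) (listSum γ) s j))))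
         (∧-zeroʳ (okParts 3 4 γ))) ⟩
  chains b (b * 4 + 2) (Parts₃.weigh outerWeight)
    ≡⟨ Parts₃.chains-multisets b b outerWeight ⟩
  Truncated.series b 0 0 n ∎
  where
  open ≡-Reasoning
  b = suc n
  open Truncated b using (weightedSize; size≥₁; size≥₃; exceeds)
  P : List ℕ × List ℕ → Bool
  P = isCopart 3 1 4 n
  pairsⱼ : List ℕ → ℕ → List (List ℕ × List ℕ)
  pairsⱼ γ j = map (λ σ → (γ , σ)) (partitions j)
  pairsᵧ : List ℕ → List (List ℕ × List ℕ)
  pairsᵧ γ = concatMap (pairsⱼ γ) (upTo b)
  pairsᵢ : ℕ → List (List ℕ × List ℕ)
  pairsᵢ i = concatMap pairsᵧ (partitions i)
  outerWeight : Weight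
  outerWeight g i = M₁.multisets b b (λ s j → weightedSize 0 0 g i s j ≡ᵇ n)
  size-weight : ∀ γ σ → size 4 γ σ ≡ weightedSize 0 0 (length γ) (listSum γ) (length σ) (listSum σ)
  size-weight γ σ = trans (cong (λ t → listSum γ + t + listSum σ) (sum-replicate (length σ) (4 * length γ)))
    (arith (listSum γ) (listSum σ) (length γ) (length σ))
    where
    arith : ∀ i j g s → i + 4 * g * s + j ≡ i + j + 4 * (g * s) + 0 + 0
    arith = solve-∀
  inner : ∀ γ → xorSum P (pairsᵧ γ) ≡ Parts₃.weigh outerWeight γ
  inner γ = begin
    xorSum P (pairsᵧ γ)
      ≡⟨ xorSum-concatMap P (pairsⱼ γ) (upTo b) ⟩
    xorSum (xorSum P ∘ pairsⱼ γ) (upTo b)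
      ≡⟨ xorSum-applyUpTo (xorSum P ∘ pairsⱼ γ) id b ⟩
    ⊕.sum b (xorSum P ∘ pairsⱼ γ)
      ≡⟨ ⊕.sum-cong b (λ j → trans (xorSum-map P (λ σ → (γ , σ)) (partitions j)) (xorSum-cong (λ σ →
           cong (λ t → okParts 3 4 γ ∧ (okParts 1 4 σ ∧ (t ≡ᵇ n))) (size-weight γ σ)) (partitions j))) ⟩
    ⊕.sum b (λ j → xorSum (λ σ → okParts 3 4 γ ∧ Parts₁.weigh φ σ) (partitions j))
      ≡⟨ sum-partitions b (b * 4 + 0) (λ σ → okParts 3 4 γ ∧ Parts₁.weigh φ σ) (≤-trans (m≤m*n b 4) (m≤m+n (b * 4) 0)) (λ σ b≤σ →
           trans (cong (λ t → okParts 3 4 γ ∧ (okParts 1 4 σ ∧ t))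
             (exceeds {c = 0} (weightedSize 0 0 (length γ) (listSum γ) (length σ) (listSum σ)) (n<1+n n) b≤σ (size≥₁ 0 0 (length γ) (listSum γ) (length σ) (listSum σ))))
           (trans (cong (okParts 3 4 γ ∧_) (∧-zeroʳ (okParts 1 4 σ))) (∧-zeroʳ (okParts 3 4 γ)))) ⟩
    chains b (b * 4 + 0) (λ σ → okParts 3 4 γ ∧ Parts₁.weigh φ σ)
      ≡⟨ pull (okParts 3 4 γ) ⟩
    okParts 3 4 γ ∧ chains b (b * 4 + 0) (Parts₁.weigh φ)
      ≡⟨ cong (okParts 3 4 γ ∧_) (Parts₁.chains-multisets b b φ) ⟩
    Parts₃.weigh outerWeight γ ∎
    where
    φ : Weight
    φ s j = weightedSize 0 0 (length γ) (listSum γ) s j ≡ᵇ n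
    pull : ∀ t → chains b (b * 4 + 0) (λ σ → t ∧ Parts₁.weigh φ σ) ≡ t ∧ chains b (b * 4 + 0) (Parts₁.weigh φ)
    pull true  = refl
    pull false = chains-false b (b * 4 + 0) (λ _ → refl)

-- Zagier's involution

m≤m*m : ∀ m → m ≤ m * m
m≤m*m zero    = z≤n
m≤m*m (suc m) = m≤m*n (suc m) (suc m)

-- Zagier's involution on x² + 4 y z = N, as substitutions in the sum over the solutions: the
-- solutions with x ≥ 2 y match those with x < y and z < y - x, the remaining ones with x ≠ y match
-- each other, and x = y is left.
module Zagier (N b : ℕ) (N<b : N < b) (nonsquare : ∀ x → x * x ≢ N) (not-4∣ : ∀ k → 4 * k ≢ N) where

  E : ℕ → Bool
  E a = a ≡ᵇ N

  E-big : ∀ {m} a → b ≤ m → m ≤ a → E a ≡ false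
  E-big a b≤m m≤a = ≡ᵇ-false a N (λ eq → <-irrefl (sym eq) (<-≤-trans N<b (≤-trans b≤m m≤a)))

  F : ℕ → ℕ → ℕ → Bool
  F x y z = E (x * x + 4 * (y * z))

  F-comm : ∀ x y z → F x y z ≡ F x z y
  F-comm x y z = cong (λ t → E (x * x + 4 * t)) (*-comm y z)

  F-vanish-x : ∀ x y z → b ≤ x → F x y z ≡ false
  F-vanish-x x y z b≤x = E-big (x * x + 4 * (y * z)) b≤x (≤-trans (m≤m*m x) (m≤m+n (x * x) _))

  F-zero : ∀ x y → F x y 0 ≡ false
  F-zero x y = ≡ᵇ-false _ N (λ eq → nonsquare x (trans (sym (arith x y)) eq))
    where
    arith : ∀ x y → x * x + 4 * (y * 0) ≡ x * x
    arith = solve-∀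

  F-vanish-y : ∀ x y z → b ≤ y → F x y z ≡ false
  F-vanish-y x y zero    b≤y = F-zero x y
  F-vanish-y x y (suc z) b≤y = E-big (x * x + 4 * (y * suc z)) b≤y
    (≤-trans (m≤m*n y (suc z)) (≤-trans (m≤n*m (y * suc z) 4) (m≤n+m _ (x * x))))

  F-vanish-z : ∀ x y z → b ≤ z → F x y z ≡ false
  F-vanish-z x y z b≤z = trans (F-comm x y z) (F-vanish-y x z y b≤z)

  ∑ : (ℕ → Bool) → Bool
  ∑ = ⊕.sum b

  ∑-cong : ∀ {f g} → (∀ i → f i ≡ g i) → ∑ f ≡ ∑ g
  ∑-cong = ⊕.sum-cong b

  ∑-swap : ∀ (f : ℕ → ℕ → Bool) → ∑ (λ x → ∑ (f x)) ≡ ∑ (λ y → ∑ (λ x → f x y))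
  ∑-swap = ⊕.sum-swap b b

  ∑-xor : ∀ f g → ∑ (λ i → f i xor g i) ≡ ∑ f xor ∑ g
  ∑-xor = ⊕.sum-∙ b

  ∑-false : ∀ {f} → (∀ i → f i ≡ false) → ∑ f ≡ false
  ∑-false h = ⊕.sum-ε b (λ i _ → h i)

  -- Collects the solutions with x = y + e. Since x² + 4 y (y - x + w) = (2 y - x)² + 4 y w, the
  -- solutions with x < y and z ≥ y - x are sent here as well, with e = y - x.
  G : ℕ → ℕ → Bool
  G e y = ∑ (λ w → E ((y + e) * (y + e) + 4 * (y * w)))

  G-vanish : ∀ e y → b ≤ y + e → G e y ≡ false
  G-vanish e y b≤ = ∑-false (λ w → E-big ((y + e) * (y + e) + 4 * (y * w)) b≤ (≤-trans (m≤m*m (y + e)) (m≤m+n _ _)))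

  -- The boundary x = 2 y between two regions, where the left side would be a multiple of 4.
  G-diagonal : ∀ e → G e e ≡ false
  G-diagonal e = ∑-false (λ w → ≡ᵇ-false _ N (λ eq → not-4∣ (e * e + e * w) (trans (arith e w) eq)))
    where
    arith : ∀ e w → 4 * (e * e + e * w) ≡ (e + e) * (e + e) + 4 * (e * w)
    arith = solve-∀

  total low mid low-low low-high middle high : Bool
  total    = ∑ (λ y → ∑ (λ z → ∑ (λ x → F x y z)))
  low      = ∑ (λ y → ∑ (λ z → ⊕.sum y (λ x → F x y z)))
  mid      = ∑ (λ y → ∑ (λ z → ⊕.sum y (λ e → F (y + e) y z)))
  low-low  = ∑ (λ x → ∑ (λ z → ∑ (λ t → F x (suc x + (z + t)) z)))
  low-high = ∑ (λ e → ∑ (λ x → G (suc e) (suc e + x)))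
  middle   = ∑ (λ e → ∑ (λ x → G e (suc e + x)))
  high     = ∑ (λ y → ∑ (λ z → ∑ (λ u → F (y + (y + u)) y z)))

  total-split : total ≡ low xor (mid xor high)
  total-split = trans
    (∑-cong (λ y → trans (∑-cong (λ z → trans
        (⊕.sum-split y (λ x → F-vanish-x x y z))
        (cong (⊕.sum y (λ x → F x y z) xor_) (⊕.sum-split y (λ e b≤e → F-vanish-x (y + e) y z (≤-trans b≤e (m≤n+m e y)))))))
      (trans (∑-xor _ _) (cong (∑ (λ z → ⊕.sum y (λ x → F x y z)) xor_) (∑-xor _ _)))))
    (trans (∑-xor _ _) (cong (low xor_) (∑-xor _ _)))

  middle-eq : mid ≡ middle
  middle-eq = trans (∑-cong (λ y → ⊕.sum-swap b y (λ z e → F (y + e) y z)))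
    (⊕.sum-triangle-< b G (λ e y b≤y → G-vanish e y (≤-trans b≤y (m≤m+n y e))))

  low-eq : low ≡ low-low xor low-high
  low-eq = begin
    ∑ (λ y → ∑ (λ z → ⊕.sum y (λ x → F x y z)))
      ≡⟨ ∑-cong (λ y → ⊕.sum-swap b y (λ z x → F x y z)) ⟩
    ∑ (λ y → ⊕.sum y (λ x → ∑ (F x y)))
      ≡⟨ ⊕.sum-triangle-< b (λ x y → ∑ (F x y)) (λ x y b≤y → ∑-false (λ z → F-vanish-y x y z b≤y)) ⟩
    ∑ (λ x → ∑ (λ e → ∑ (F x (suc x + e))))
      ≡⟨ ∑-cong (λ x → trans (∑-cong (λ e → ⊕.sum-split (suc e) (F-vanish-z x (suc x + e)))) (∑-xor _ _)) ⟩
    ∑ (λ x → ∑ (λ e → ⊕.sum (suc e) (F x (suc x + e))) xor ∑ (λ e → ∑ (λ w → F x (suc x + e) (suc e + w))))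
      ≡⟨ ∑-xor _ _ ⟩
    ∑ (λ x → ∑ (λ e → ⊕.sum (suc e) (F x (suc x + e)))) xor ∑ (λ x → ∑ (λ e → ∑ (λ w → F x (suc x + e) (suc e + w))))
      ≡⟨ cong₂ _xor_
           (∑-cong (λ x → ⊕.sum-triangle-≤ b (λ z e → F x (suc x + e) z) (λ z e b≤e → F-vanish-y x (suc x + e) z (≤-trans b≤e (m≤n+m e (suc x))))))
           (trans (∑-cong (λ x → ∑-cong (λ e → ∑-cong (λ w → cong E (arith x e w))))) (∑-swap (λ x e → G (suc e) (suc e + x)))) ⟩
    low-low xor low-high ∎
    where
    open ≡-Reasoning
    arith : ∀ x e w → x * x + 4 * ((suc x + e) * (suc e + w)) ≡
                      (suc e + x + suc e) * (suc e + x + suc e) + 4 * ((suc e + x) * w)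
    arith = solve-∀

  high-eq : high ≡ low-low
  high-eq = begin
    ∑ (λ y → ∑ (λ z → ∑ (λ u → F (y + (y + u)) y z)))
      ≡⟨ ∑-cong (λ y → ∑-swap (λ z u → F (y + (y + u)) y z)) ⟩
    ∑ (λ y → ∑ (λ u → ∑ (λ z → F (y + (y + u)) y z)))
      ≡⟨ ∑-cong (λ y → ∑-cong (λ u → trans (⊕.sum-split 1 (F-vanish-z (y + (y + u)) y))
           (cong (_xor ∑ (λ t → F (y + (y + u)) y (suc t))) (F-zero (y + (y + u)) y)))) ⟩
    ∑ (λ y → ∑ (λ u → ∑ (λ t → F (y + (y + u)) y (suc t))))
      ≡⟨ ∑-swap (λ y u → ∑ (λ t → F (y + (y + u)) y (suc t))) ⟩
    ∑ (λ u → ∑ (λ y → ∑ (λ t → F (y + (y + u)) y (suc t))))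
      ≡⟨ ∑-cong (λ u → ∑-cong (λ y → ∑-cong (λ t → cong E (arith u y t)))) ⟩
    low-low ∎
    where
    open ≡-Reasoning
    arith : ∀ x z t → (z + (z + x)) * (z + (z + x)) + 4 * (z * suc t) ≡ x * x + 4 * ((suc x + (z + t)) * z)
    arith = solve-∀

  -- The sum of `G e y` over y ≥ e is cut in two ways: splitting off e = 0 leaves `low-high`,
  -- splitting off the vanishing diagonal y = e leaves `middle`. So e = 0, that is x = y, is what
  -- the matching misses.
  shifted-middle : ∑ (λ x → G 0 x) xor low-high ≡ middle
  shifted-middle = begin
    ∑ (G 0) xor low-high
      ≡⟨ ⊕.sum-split 1 (λ e b≤e → ∑-false (λ x → G-vanish e (e + x) (≤-trans b≤e (m≤n+m e (e + x))))) ⟨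
    ∑ (λ e → ∑ (λ x → G e (e + x)))
      ≡⟨ ∑-cong (λ e → trans (⊕.sum-split 1 (λ x b≤x → G-vanish e (e + x) (≤-trans b≤x (≤-trans (m≤n+m x e) (m≤m+n (e + x) e)))))
           (cong₂ _xor_ (trans (cong (G e) (+-identityʳ e)) (G-diagonal e)) (∑-cong (λ x → cong (G e) (+-suc e x))))) ⟩
    middle ∎
    where open ≡-Reasoning

  total-factorisations : total ≡ ∑ (G 0)
  total-factorisations = begin
    total
      ≡⟨ total-split ⟩
    low xor (mid xor high)
      ≡⟨ cong₂ _xor_ low-eq (cong₂ _xor_ (trans middle-eq (sym shifted-middle)) high-eq) ⟩
    (low-low xor low-high) xor ((∑ (G 0) xor low-high) xor low-low)
      ≡⟨ cancel low-low low-high (∑ (G 0)) ⟩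
    ∑ (G 0) ∎
    where
    open ≡-Reasoning
    cancel : ∀ a c g → (a xor c) xor ((g xor c) xor a) ≡ g
    cancel = solve 3 (λ a c g → (a :+ c) :+ ((g :+ c) :+ a) := g) refl
      where open xor-∧-Solver

  -- The other involution exchanges y and z; its fixed points y = z are the representations by x² +
  -- 4 y².
  total-squares : total ≡ ∑ (λ x → ∑ (λ y → F x y y))
  total-squares = begin
    ∑ (λ y → ∑ (λ z → ∑ (λ x → F x y z)))      ≡⟨ ∑-cong (λ y → ∑-swap (λ z x → F x y z)) ⟩
    ∑ (λ y → ∑ (λ x → ∑ (F x y)))              ≡⟨ ∑-swap (λ y x → ∑ (F x y)) ⟩
    ∑ (λ x → ∑ (λ y → ∑ (F x y)))              ≡⟨ ∑-cong (λ x → trans (⊕.sum-symmetric b (F x) (F-comm x))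
                                                  (cong (_xor ∑ (λ y → F x y y)) (xor-same (⊕.sum b (λ y → ⊕.sum y (λ z → F x z y)))))) ⟩
    ∑ (λ x → ∑ (λ y → F x y y))                ∎
    where open ≡-Reasoning

  squares-factorisations : ∑ (λ x → ∑ (λ y → (x * x + 4 * (y * y)) ≡ᵇ N)) ≡ ∑ (λ x → ∑ (λ w → x * (x + 4 * w) ≡ᵇ N))
  squares-factorisations = trans (sym total-squares) (trans total-factorisations
    (∑-cong (λ x → ∑-cong (λ w → cong E (arith x w)))))
    where
    arith : ∀ x w → (x + 0) * (x + 0) + 4 * (x * w) ≡ x * (x + 4 * w)
    arith = solve-∀

-- Representations by x² + 4 y²

≡ᵇ-cancelˡ : ∀ k m n → (k + m ≡ᵇ k + n) ≡ (m ≡ᵇ n)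
≡ᵇ-cancelˡ zero    m n = refl
≡ᵇ-cancelˡ (suc k) m n = ≡ᵇ-cancelˡ k m n

triangular-double : ∀ n → triangular n * 2 ≡ n * suc n
triangular-double zero    = refl
triangular-double (suc n) = begin
  (suc n + triangular n) * 2    ≡⟨ *-distribʳ-+ 2 (suc n) (triangular n) ⟩
  suc n * 2 + triangular n * 2  ≡⟨ cong (suc n * 2 +_) (triangular-double n) ⟩
  suc n * 2 + n * suc n         ≡⟨ arith n ⟩
  suc n * suc (suc n)           ∎
  where
  open ≡-Reasoning
  arith : ∀ n → suc n * 2 + n * suc n ≡ suc n * suc (suc n)
  arith = solve-∀

pent₋-square : ∀ n → 1 + pent₋ n * 24 ≡ (n * 6 + 5) * (n * 6 + 5)
pent₋-square n = begin
  1 + (suc n * suc n + triangular n) * 24           ≡⟨ arith₁ n (triangular n) ⟩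
  1 + suc n * suc n * 24 + triangular n * 2 * 12    ≡⟨ cong (λ t → 1 + suc n * suc n * 24 + t * 12) (triangular-double n) ⟩
  1 + suc n * suc n * 24 + n * suc n * 12           ≡⟨ arith₂ n ⟩
  (n * 6 + 5) * (n * 6 + 5)                         ∎
  where
  open ≡-Reasoning
  arith₁ : ∀ n t → 1 + (suc n * suc n + t) * 24 ≡ 1 + suc n * suc n * 24 + t * 2 * 12
  arith₁ = solve-∀
  arith₂ : ∀ n → 1 + suc n * suc n * 24 + n * suc n * 12 ≡ (n * 6 + 5) * (n * 6 + 5)
  arith₂ = solve-∀

pent₊-square : ∀ n → 1 + pent₊ n * 24 ≡ (n * 6 + 1) * (n * 6 + 1)
pent₊-square n = begin
  1 + (n * n + triangular n) * 24               ≡⟨ arith₁ n (triangular n) ⟩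
  1 + n * n * 24 + triangular n * 2 * 12        ≡⟨ cong (λ t → 1 + n * n * 24 + t * 12) (triangular-double n) ⟩
  1 + n * n * 24 + n * suc n * 12               ≡⟨ arith₂ n ⟩
  (n * 6 + 1) * (n * 6 + 1)                     ∎
  where
  open ≡-Reasoning
  arith₁ : ∀ n t → 1 + (n * n + t) * 24 ≡ 1 + n * n * 24 + t * 2 * 12
  arith₁ = solve-∀
  arith₂ : ∀ n → 1 + n * n * 24 + n * suc n * 12 ≡ (n * 6 + 1) * (n * 6 + 1)
  arith₂ = solve-∀

-- The pentagonal exponents e are those with 24 e + 1 = x², so completing the square turns
-- the exponents d e into d x².
module CompleteSquare (c d k : ℕ) (c<24 : c < 24) (q : ℕ → ℕ) (f : Series)
  (f-coeff : ∀ n → f n ≡ ⊕.sum k (λ y → q y ≡ᵇ n * 24 + c)) where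

  solutions : ℕ → ℕ → Bool
  solutions n x = ⊕.sum k (λ y → d * (x * x) + q y ≡ᵇ n * 24 + (c + d))

  -- The bound `c < 24` settles n = 0: for positive e the left side is at least 24, the right side
  -- is c, and the shifted coefficient is indeed false.
  shift-coeff : ∀ e n → shift e f n ≡ ⊕.sum k (λ y → e * 24 + q y ≡ᵇ n * 24 + c)
  shift-coeff zero    n       = trans (shift-zero f n) (f-coeff n)
  shift-coeff (suc e) zero    = trans (shift-suc-zero e f) (sym (⊕.sum-ε k (λ y _ →
    ≡ᵇ-false (suc e * 24 + q y) c (λ eq → <-irrefl (sym eq) (<-≤-trans c<24 (≤-trans (m≤m+n 24 (e * 24)) (m≤m+n _ (q y))))))))
  shift-coeff (suc e) (suc n) = trans (shift-suc-suc e f n) (shift-coeff e n)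

  shift-solutions : ∀ e x n → 1 + e * 24 ≡ x * x → shift (d * e) f n ≡ solutions n x
  shift-solutions e x n eq = trans (shift-coeff (d * e) n) (⊕.sum-cong k (λ y →
    trans (sym (≡ᵇ-cancelˡ d (d * e * 24 + q y) (n * 24 + c)))
          (cong₂ _≡ᵇ_ (trans (arith₁ d e (q y)) (cong (λ t → d * t + q y) eq)) (arith₂ d n c))))
    where
    arith₁ : ∀ d e q → d + (d * e * 24 + q) ≡ d * (1 + e * 24) + q
    arith₁ = solve-∀
    arith₂ : ∀ d n c → d + (n * 24 + c) ≡ n * 24 + (c + d)
    arith₂ = solve-∀

  open Pentagonal d using (pentagonal)

  pentagonal-coeff : ∀ m n → pentagonal m f n ≡
    ⊕.sum m (λ s → solutions n (s * 6 + 1) xor solutions n (s * 6 + 5)) xor solutions n (m * 6 + 1)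
  pentagonal-coeff zero    n = trans (sym (trans (cong (λ e → shift e f n) (*-zeroʳ d)) (shift-zero f n))) (shift-solutions 0 1 n refl)
  pentagonal-coeff (suc m) n = begin
    ((pentagonal m f ⊞ A) ⊞ B) n
      ≡⟨ trans (⊞-coeff _ B n) (cong (_xor B n) (⊞-coeff _ A n)) ⟩
    (pentagonal m f n xor A n) xor B n
      ≡⟨ cong₂ _xor_ (cong₂ _xor_ (pentagonal-coeff m n) (shift-solutions (pent₋ m) (m * 6 + 5) n (pent₋-square m)))
                     (shift-solutions (pent₊ (suc m)) (suc m * 6 + 1) n (pent₊-square (suc m))) ⟩
    ((⊕.sum m _ xor solutions n (m * 6 + 1)) xor solutions n (m * 6 + 5)) xor solutions n (suc m * 6 + 1)
      ≡⟨ cong (_xor solutions n (suc m * 6 + 1)) (xor-assoc (⊕.sum m (λ s → solutions n (s * 6 + 1) xor solutions n (s * 6 + 5))) _ _) ⟩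
    ⊕.sum (suc m) (λ s → solutions n (s * 6 + 1) xor solutions n (s * 6 + 5)) xor solutions n (suc m * 6 + 1) ∎
    where
    open ≡-Reasoning
    A = shift (d * pent₋ m) f
    B = shift (d * pent₊ (suc m)) f

  -- The pentagonal exponents yield exactly the x congruent to 1 or 5 modulo 6. The other four
  -- residues contribute nothing by hypothesis, and including them lets x run through an interval.
  pentagonal-solutions : ∀ m n →
    (∀ s → solutions n (s * 6 + 0) ≡ false) → (∀ s → solutions n (s * 6 + 2) ≡ false) →
    (∀ s → solutions n (s * 6 + 3) ≡ false) → (∀ s → solutions n (s * 6 + 4) ≡ false) →
    pentagonal m f n ≡ ⊕.sum (m * 6 + 2) (solutions n)
  pentagonal-solutions m n v₀ v₂ v₃ v₄ = sym (begin
    ⊕.sum (m * 6 + 2) R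
      ≡⟨ ⊕.sum-+ (m * 6) 2 R ⟩
    ⊕.sum (m * 6) R xor ((R (m * 6 + 0)) xor R (m * 6 + 1))
      ≡⟨ cong₂ _xor_ (trans (⊕.sum-blocks m 6 R) (⊕.sum-cong m block)) (cong (_xor R (m * 6 + 1)) (v₀ m)) ⟩
    ⊕.sum m (λ s → R (s * 6 + 1) xor R (s * 6 + 5)) xor R (m * 6 + 1)
      ≡⟨ pentagonal-coeff m n ⟨
    pentagonal m f n ∎)
    where
    open ≡-Reasoning
    R : ℕ → Bool
    R = solutions n
    block : ∀ s → ⊕.sum 6 (λ r → R (s * 6 + r)) ≡ R (s * 6 + 1) xor R (s * 6 + 5)
    block s = cong (_xor R (s * 6 + 5)) (begin
      (((R (s * 6 + 0) xor R (s * 6 + 1)) xor R (s * 6 + 2)) xor R (s * 6 + 3)) xor R (s * 6 + 4)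
        ≡⟨ cong₂ _xor_ (cong₂ _xor_ (cong₂ _xor_ (cong (_xor R (s * 6 + 1)) (v₀ s)) (v₂ s)) (v₃ s)) (v₄ s) ⟩
      ((R (s * 6 + 1) xor false) xor false) xor false
        ≡⟨ trans (xor-identityʳ _) (trans (xor-identityʳ _) (xor-identityʳ _)) ⟩
      R (s * 6 + 1) ∎)

-- Modulo 24 the value 4 (6 s + r)² depends only on r, and among r < 6 it is 4 only for r = 1 and r
-- = 5.
four-square : ∀ s r n → 4 * (r * r) % 24 ≢ 4 → 4 * ((s * 6 + r) * (s * 6 + r)) + 0 ≢ n * 24 + (0 + 4)
four-square s r n bad eq = bad (begin
  4 * (r * r) % 24                                  ≡⟨ [m+kn]%n≡m%n (4 * (r * r)) (6 * (s * s) + 2 * (s * r)) 24 ⟨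
  (4 * (r * r) + (6 * (s * s) + 2 * (s * r)) * 24) % 24    ≡⟨ cong (_% 24) (arith s r) ⟩
  (4 * ((s * 6 + r) * (s * 6 + r)) + 0) % 24        ≡⟨ cong (_% 24) (trans eq (+-comm (n * 24) 4)) ⟩
  (4 + n * 24) % 24                                 ≡⟨ [m+kn]%n≡m%n 4 n 24 ⟩
  4                                                 ∎)
  where
  open ≡-Reasoning
  arith : ∀ s r → 4 * (r * r) + (6 * (s * s) + 2 * (s * r)) * 24 ≡ 4 * ((s * 6 + r) * (s * 6 + r)) + 0
  arith = solve-∀

-- Modulo 12 the first square is r² and 4 y² depends only on y modulo 3, so each r is excluded by
-- three cases.
square-plus-four-square : ∀ s r y n → (∀ e → e < 3 → (r * r + 4 * (e * e)) % 12 ≢ 5) →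
  1 * ((s * 6 + r) * (s * 6 + r)) + (4 * (y * y) + 0) ≢ n * 24 + (0 + 4 + 1)
square-plus-four-square s r y n bad eq = bad e (m%n<n y 3) (begin
  (r * r + 4 * (e * e)) % 12
    ≡⟨ [m+kn]%n≡m%n (r * r + 4 * (e * e)) (3 * (s * s) + s * r + 3 * (j * j) + 2 * (e * j)) 12 ⟨
  (r * r + 4 * (e * e) + (3 * (s * s) + s * r + 3 * (j * j) + 2 * (e * j)) * 12) % 12
    ≡⟨ cong (_% 12) (arith s r e j) ⟩
  (1 * ((s * 6 + r) * (s * 6 + r)) + (4 * ((e + j * 3) * (e + j * 3)) + 0)) % 12
    ≡⟨ cong (λ t → (1 * ((s * 6 + r) * (s * 6 + r)) + (4 * (t * t) + 0)) % 12) (m≡m%n+[m/n]*n y 3) ⟨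
  (1 * ((s * 6 + r) * (s * 6 + r)) + (4 * (y * y) + 0)) % 12
    ≡⟨ cong (_% 12) (trans eq (arith′ n)) ⟩
  (5 + n * 2 * 12) % 12
    ≡⟨ [m+kn]%n≡m%n 5 (n * 2) 12 ⟩
  5 ∎)
  where
  open ≡-Reasoning
  e = y % 3
  j = y / 3
  arith : ∀ s r e j → r * r + 4 * (e * e) + (3 * (s * s) + s * r + 3 * (j * j) + 2 * (e * j)) * 12 ≡
                      1 * ((s * 6 + r) * (s * 6 + r)) + (4 * ((e + j * 3) * (e + j * 3)) + 0)
  arith = solve-∀
  arith′ : ∀ n → n * 24 + (0 + 4 + 1) ≡ 5 + n * 2 * 12
  arith′ = solve-∀

δ-coeff : ∀ n → δ n ≡ ⊕.sum 1 (λ _ → 0 ≡ᵇ n * 24 + 0)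
δ-coeff zero    = refl
δ-coeff (suc n) = refl

isOdd-cp-squares : ∀ n → let b = 24 * n + 25 in
  isOdd (cp 3 1 4 n) ≡ ⊕.sum b (λ x → ⊕.sum b (λ y → (x * x + 4 * (y * y)) ≡ᵇ 24 * n + 5))
isOdd-cp-squares n = begin
  isOdd (cp 3 1 4 n)
    ≡⟨ isOdd-cp n ⟩
  Truncated.series (suc n) 0 0 n
    ≡⟨ _≈[_]_.coeff (Truncated.series-pentagonal (suc n)) n (n<1+n n) ⟩
  Pentagonal.pentagonal 1 m f₄ n
    ≡⟨ S₁.pentagonal-solutions m n (no-solution 0 λ { 0 _ () ; 1 _ () ; 2 _ () ; (suc (suc (suc _))) (s≤s (s≤s (s≤s ()))) })
                                    (no-solution 2 λ { 0 _ () ; 1 _ () ; 2 _ () ; (suc (suc (suc _))) (s≤s (s≤s (s≤s ()))) })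
                                    (no-solution 3 λ { 0 _ () ; 1 _ () ; 2 _ () ; (suc (suc (suc _))) (s≤s (s≤s (s≤s ()))) })
                                    (no-solution 4 λ { 0 _ () ; 1 _ () ; 2 _ () ; (suc (suc (suc _))) (s≤s (s≤s (s≤s ()))) }) ⟩
  ⊕.sum X (λ x → ⊕.sum Y (λ y → 1 * (x * x) + (4 * (y * y) + 0) ≡ᵇ n * 24 + (0 + 4 + 1)))
    ≡⟨ ⊕.sum-cong X (λ x → ⊕.sum-cong Y (λ y → cong₂ _≡ᵇ_ (arith₁ x y) (arith₂ n))) ⟩
  ⊕.sum X (λ x → ⊕.sum Y (λ y → x * x + 4 * (y * y) ≡ᵇ N))
    ≡⟨ ⊕.sum-cong X (λ x → sym (⊕.sum-extend (λ y Y≤y → big (x * x + 4 * (y * y)) (≤-trans (large-y y Y≤y) (m≤n+m _ (x * x)))) Y≤b)) ⟩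
  ⊕.sum X (λ x → ⊕.sum b (λ y → x * x + 4 * (y * y) ≡ᵇ N))
    ≡⟨ ⊕.sum-extend (λ x X≤x → ⊕.sum-ε b (λ y _ → big (x * x + 4 * (y * y)) (≤-trans (large-x x X≤x) (m≤m+n (x * x) _)))) X≤b ⟨
  ⊕.sum b (λ x → ⊕.sum b (λ y → x * x + 4 * (y * y) ≡ᵇ N)) ∎
  where
  open ≡-Reasoning
  m = suc n * 2
  X = m * 6 + 2
  Y = suc n * 6 + 2
  N = 24 * n + 5
  -- One bound for all later sums: it exceeds N as well as X = 12 n + 14 and Y = 6 n + 8.
  b = 24 * n + 25
  f₄ = Pentagonal.pentagonal 4 (suc n) δ
  module S₄ = CompleteSquare 0 4 1 (s≤s z≤n) (λ _ → 0) δ δ-coeff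
  f₄-coeff : ∀ n′ → f₄ n′ ≡ ⊕.sum Y (λ y → 4 * (y * y) + 0 ≡ᵇ n′ * 24 + 4)
  f₄-coeff n′ = S₄.pentagonal-solutions (suc n) n′ (none 0 (λ ())) (none 2 (λ ())) (none 3 (λ ())) (none 4 (λ ()))
    where
    none : ∀ r → 4 * (r * r) % 24 ≢ 4 → ∀ s → S₄.solutions n′ (s * 6 + r) ≡ false
    none r bad s = ≡ᵇ-false _ (n′ * 24 + (0 + 4)) (four-square s r n′ bad)
  -- The coefficients of `f₄` already count solutions of 4 y² = 24 n + 4; the square x² is completed
  -- on top of them.
  module S₁ = CompleteSquare 4 1 Y (s≤s (s≤s (s≤s (s≤s (s≤s z≤n))))) (λ y → 4 * (y * y) + 0) f₄ f₄-coeff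
  no-solution : ∀ r → (∀ e → e < 3 → (r * r + 4 * (e * e)) % 12 ≢ 5) → ∀ s → S₁.solutions n (s * 6 + r) ≡ false
  no-solution r bad s = ⊕.sum-ε Y (λ y _ → ≡ᵇ-false _ (n * 24 + (0 + 4 + 1)) (square-plus-four-square s r y n bad))
  arith₁ : ∀ x y → 1 * (x * x) + (4 * (y * y) + 0) ≡ x * x + 4 * (y * y)
  arith₁ = solve-∀
  arith₂ : ∀ n → n * 24 + 5 ≡ 24 * n + 5
  arith₂ = solve-∀
  big : ∀ a → suc N ≤ a → (a ≡ᵇ N) ≡ false
  big a N<a = ≡ᵇ-false a N (λ eq → <-irrefl (sym eq) N<a)
  Y≤b : Y ≤ b
  Y≤b = subst₂ _≤_ (arithY n) (arithb n) (m≤m+n (6 * n + 8) (18 * n + 17))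
    where
    arithY : ∀ n → 6 * n + 8 ≡ suc n * 6 + 2
    arithY = solve-∀
    arithb : ∀ n → 6 * n + 8 + (18 * n + 17) ≡ 24 * n + 25
    arithb = solve-∀
  X≤b : X ≤ b
  X≤b = subst₂ _≤_ (arithX n) (arithb n) (m≤m+n (12 * n + 14) (12 * n + 11))
    where
    arithX : ∀ n → 12 * n + 14 ≡ suc n * 2 * 6 + 2
    arithX = solve-∀
    arithb : ∀ n → 12 * n + 14 + (12 * n + 11) ≡ 24 * n + 25
    arithb = solve-∀
  large-y : ∀ y → Y ≤ y → suc N ≤ 4 * (y * y)
  large-y y Y≤y = ≤-trans (subst (suc N ≤_) (arith n) (m≤m+n (suc N) 26)) (*-monoʳ-≤ 4 (≤-trans Y≤y (m≤m*m y)))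
    where
    arith : ∀ n → suc (24 * n + 5) + 26 ≡ 4 * (suc n * 6 + 2)
    arith = solve-∀
  large-x : ∀ x → X ≤ x → suc N ≤ x * x
  large-x x X≤x = ≤-trans (subst (suc N ≤_) (arith n) (m≤m+n (suc N) 22)) (*-mono-≤ (≤-trans (m≤n+m 2 (m * 6)) X≤x) X≤x)
    where
    arith : ∀ n → suc (24 * n + 5) + 22 ≡ 2 * (suc n * 2 * 6 + 2)
    arith = solve-∀

-- Counting divisors

isOdd-+ : ∀ m n → isOdd (m + n) ≡ isOdd m xor isOdd n
isOdd-+ zero    n = refl
isOdd-+ (suc m) n = trans (cong not (isOdd-+ m n)) (not-xor (isOdd m) (isOdd n))
  where
  not-xor : ∀ a b → not (a xor b) ≡ not a xor b
  not-xor false b     = refl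
  not-xor true  false = refl
  not-xor true  true  = refl

isOdd-* : ∀ m n → isOdd (m * n) ≡ isOdd m ∧ isOdd n
isOdd-* zero    n = refl
isOdd-* (suc m) n = trans (isOdd-+ n (m * n)) (trans (cong (isOdd n xor_) (isOdd-* m n)) (absorb (isOdd m) (isOdd n)))
  where
  absorb : ∀ a b → b xor (a ∧ b) ≡ not a ∧ b
  absorb false b     = xor-identityʳ b
  absorb true  b     = xor-same b

isOdd-double : ∀ m → isOdd (m + m) ≡ false
isOdd-double m = trans (isOdd-+ m m) (xor-same (isOdd m))

even-or-odd : ∀ n → ∃ λ k → (n ≡ k + k) ⊎ (n ≡ suc (k + k))
even-or-odd zero    = 0 , inj₁ refl
even-or-odd (suc n) with even-or-odd n
... | k , inj₁ refl = k , inj₂ refl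
... | k , inj₂ refl = suc k , inj₁ (cong suc (sym (+-suc k k)))

⟦_⟧ : Bool → ℕ
⟦ true  ⟧ = 1
⟦ false ⟧ = 0

isOdd-⟦⟧ : ∀ b → isOdd ⟦ b ⟧ ≡ b
isOdd-⟦⟧ true  = refl
isOdd-⟦⟧ false = refl

isOdd-sum : ∀ n f → isOdd (Σ.sum n f) ≡ ⊕.sum n (isOdd ∘ f)
isOdd-sum zero    f = refl
isOdd-sum (suc n) f = trans (isOdd-+ (Σ.sum n f) (f n)) (cong (_xor isOdd (f n)) (isOdd-sum n f))

-- The number of divisors of n, provided 0 < n < b.
τ : ℕ → ℕ → ℕ
τ b n = Σ.sum b (λ x → ⟦ does (x ∣? n) ⟧)

cofactors : ∀ b n x → 0 < n → n < b → Σ.sum b (λ y → ⟦ x * y ≡ᵇ n ⟧) ≡ ⟦ does (x ∣? n) ⟧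
cofactors b n x 0<n n<b with x ∣? n
... | no x∤n = trans (Σ.sum-ε b (λ y _ → cong ⟦_⟧ (≡ᵇ-false (x * y) n (λ eq → x∤n (divides y (trans (sym eq) (*-comm x y)))))))
                     refl
... | yes (divides q n≡q*x) with x
...   | zero  = contradiction (subst (0 <_) (trans n≡q*x (*-zeroʳ q)) 0<n) (<-irrefl refl)
...   | suc k = trans (Σ.sum-single b q q<b (λ y _ y≢q → cong ⟦_⟧ (≡ᵇ-false (suc k * y) n (λ eq →
                  y≢q (*-cancelˡ-≡ y q (suc k) (trans eq (trans n≡q*x (*-comm q (suc k)))))))))
                (cong ⟦_⟧ (≡ᵇ-true (suc k * q) n (trans (*-comm (suc k) q) (sym n≡q*x))))
  where
  q<b : q < b
  q<b = ≤-<-trans (≤-trans (m≤m*n q (suc k)) (≤-reflexive (sym n≡q*x))) n<b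

τ-pairs : ∀ b n → 0 < n → n < b → Σ.sum b (λ x → Σ.sum b (λ y → ⟦ x * y ≡ᵇ n ⟧)) ≡ τ b n
τ-pairs b n 0<n n<b = Σ.sum-cong b (λ x → cofactors b n x 0<n n<b)

module DivisorPairs (N b : ℕ) (N<b : N < b) (nonsquare : ∀ x → x * x ≢ N) (N%4≡1 : N % 4 ≡ 1) where

  0<N : 0 < N
  0<N = n≢0⇒n>0 (nonsquare 0 ∘ sym)

  gap : ℕ → ℕ → ℕ
  gap x e = ⟦ x * (x + e) ≡ᵇ N ⟧

  gap-vanish : ∀ x e → b ≤ x + e → gap x e ≡ 0
  gap-vanish zero    e b≤ = cong ⟦_⟧ (≡ᵇ-false 0 N (<⇒≢ 0<N))
  gap-vanish (suc x) e b≤ = cong ⟦_⟧ (≡ᵇ-false (suc x * (suc x + e)) N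
    (λ eq → <-irrefl (sym eq) (<-≤-trans N<b (≤-trans b≤ (m≤n*m (suc x + e) (suc x))))))

  small : ℕ
  small = Σ.sum b (λ x → Σ.sum b (λ e → gap x (suc e)))

  τ-double : τ b N ≡ small + small
  τ-double = begin
    τ b N
      ≡⟨ τ-pairs b N 0<N N<b ⟨
    Σ.sum b (λ x → Σ.sum b (λ y → ⟦ x * y ≡ᵇ N ⟧))
      ≡⟨ Σ.sum-symmetric b (λ x y → ⟦ x * y ≡ᵇ N ⟧) (λ x y → cong (λ t → ⟦ t ≡ᵇ N ⟧) (*-comm x y)) ⟩
    half + half + Σ.sum b (λ x → ⟦ x * x ≡ᵇ N ⟧)
      ≡⟨ cong (half + half +_) (Σ.sum-ε b (λ x _ → cong ⟦_⟧ (≡ᵇ-false (x * x) N (nonsquare x)))) ⟩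
    half + half + 0
      ≡⟨ +-identityʳ _ ⟩
    half + half
      ≡⟨ cong (λ t → t + t) half≡small ⟩
    small + small ∎
    where
    open ≡-Reasoning
    half : ℕ
    half = Σ.sum b (λ y → Σ.sum y (λ x → ⟦ x * y ≡ᵇ N ⟧))
    half≡small : half ≡ small
    half≡small = trans
      (Σ.sum-triangle-< b (λ x y → ⟦ x * y ≡ᵇ N ⟧) vanish)
      (Σ.sum-cong b (λ x → Σ.sum-cong b (λ e → cong (λ t → ⟦ x * t ≡ᵇ N ⟧) (sym (+-suc x e)))))
      where
      vanish : ∀ x y → b ≤ y → ⟦ x * y ≡ᵇ N ⟧ ≡ 0
      vanish zero    y b≤y = cong ⟦_⟧ (≡ᵇ-false 0 N (<⇒≢ 0<N))
      vanish (suc x) y b≤y = cong ⟦_⟧ (≡ᵇ-false (suc x * y) N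
        (λ eq → <-irrefl (sym eq) (<-≤-trans N<b (≤-trans b≤y (m≤n*m y (suc x))))))

  residue : ∀ x w r → (∀ i → i < 4 → i * (i + r) % 4 ≢ 1) → gap x (w * 4 + r) ≡ 0
  residue x w r bad = cong ⟦_⟧ (≡ᵇ-false (x * (x + (w * 4 + r))) N (λ eq → bad i (m%n<n x 4) (begin
    i * (i + r) % 4
      ≡⟨ [m+kn]%n≡m%n (i * (i + r)) (i * (j + w) + j * (i + r) + j * (j + w) * 4) 4 ⟨
    (i * (i + r) + (i * (j + w) + j * (i + r) + j * (j + w) * 4) * 4) % 4
      ≡⟨ cong (_% 4) (arith i j w r) ⟩
    ((i + j * 4) * ((i + j * 4) + (w * 4 + r))) % 4
      ≡⟨ cong (λ t → t * (t + (w * 4 + r)) % 4) (m≡m%n+[m/n]*n x 4) ⟨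
    x * (x + (w * 4 + r)) % 4
      ≡⟨ trans (cong (_% 4) eq) N%4≡1 ⟩
    1 ∎)))
    where
    open ≡-Reasoning
    i = x % 4
    j = x / 4
    arith : ∀ i j w r → i * (i + r) + (i * (j + w) + j * (i + r) + j * (j + w) * 4) * 4 ≡
                        (i + j * 4) * ((i + j * 4) + (w * 4 + r))
    arith = solve-∀

  -- The gap 0, absent because N is no square, is put back so that the gaps fall into aligned blocks
  -- of four; in each block only the multiple of 4 survives.
  small-blocks : small ≡ Σ.sum b (λ x → Σ.sum b (λ w → ⟦ x * (x + 4 * w) ≡ᵇ N ⟧))
  small-blocks = Σ.sum-cong b λ x → begin
    Σ.sum b (λ e → gap x (suc e))
      ≡⟨ cong (_+ Σ.sum b (λ e → gap x (suc e))) (square-gap x) ⟨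
    Σ.sum 1 (gap x) + Σ.sum b (λ e → gap x (suc e))
      ≡⟨ Σ.sum-split 1 (vanish x) ⟨
    Σ.sum b (gap x)
      ≡⟨ Σ.sum-extend (vanish x) (m≤m*n b 4) ⟨
    Σ.sum (b * 4) (gap x)
      ≡⟨ Σ.sum-blocks b 4 (gap x) ⟩
    Σ.sum b (λ w → Σ.sum 4 (λ r → gap x (w * 4 + r)))
      ≡⟨ Σ.sum-cong b (λ w → trans
           (cong₂ _+_ (cong₂ _+_ (cong (gap x (w * 4 + 0) +_) (residue x w 1 bad₁)) (residue x w 2 bad₂)) (residue x w 3 bad₃))
           (trans (trans (+-identityʳ _) (trans (+-identityʳ _) (+-identityʳ _)))
                  (cong (gap x) (trans (+-identityʳ (w * 4)) (*-comm w 4))))) ⟩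
    Σ.sum b (λ w → gap x (4 * w)) ∎
    where
    open ≡-Reasoning
    vanish : ∀ x e → b ≤ e → gap x e ≡ 0
    vanish x e b≤e = gap-vanish x e (≤-trans b≤e (m≤n+m e x))
    square-gap : ∀ x → Σ.sum 1 (gap x) ≡ 0
    square-gap x = cong ⟦_⟧ (≡ᵇ-false (x * (x + 0)) N (λ eq → nonsquare x (trans (cong (x *_) (sym (+-identityʳ x))) eq)))
    bad₁ : ∀ i → i < 4 → i * (i + 1) % 4 ≢ 1
    bad₁ 0 _ ()
    bad₁ 1 _ ()
    bad₁ 2 _ ()
    bad₁ 3 _ ()
    bad₁ (suc (suc (suc (suc _)))) (s≤s (s≤s (s≤s (s≤s ()))))
    bad₂ : ∀ i → i < 4 → i * (i + 2) % 4 ≢ 1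
    bad₂ 0 _ ()
    bad₂ 1 _ ()
    bad₂ 2 _ ()
    bad₂ 3 _ ()
    bad₂ (suc (suc (suc (suc _)))) (s≤s (s≤s (s≤s (s≤s ()))))
    bad₃ : ∀ i → i < 4 → i * (i + 3) % 4 ≢ 1
    bad₃ 0 _ ()
    bad₃ 1 _ ()
    bad₃ 2 _ ()
    bad₃ 3 _ ()
    bad₃ (suc (suc (suc (suc _)))) (s≤s (s≤s (s≤s (s≤s ()))))

  isOdd-small : isOdd small ≡ ⊕.sum b (λ x → ⊕.sum b (λ w → x * (x + 4 * w) ≡ᵇ N))
  isOdd-small = trans (cong isOdd small-blocks) (trans (isOdd-sum b _) (⊕.sum-cong b (λ x →
    trans (isOdd-sum b _) (⊕.sum-cong b (λ w → isOdd-⟦⟧ (x * (x + 4 * w) ≡ᵇ N))))))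

-- The number of divisors and prime powers

∤⇒coprime : ∀ {p x} → Prime p → ¬ p ∣ x → Coprime x p
∤⇒coprime pr p∤x {d} (d∣x , d∣p) with prime⇒irreducible pr d∣p
... | inj₁ d≡1  = d≡1
... | inj₂ refl = contradiction d∣x p∤x

∤-^-divisor : ∀ {p x} e m → Prime p → ¬ p ∣ x → x ∣ p ^ e * m → x ∣ m
∤-^-divisor zero    m pr p∤x d = subst (_ ∣_) (+-identityʳ m) d
∤-^-divisor {p} {x} (suc e) m pr p∤x d = ∤-^-divisor e m pr p∤x
  (coprime-divisor (∤⇒coprime pr p∤x) (subst (x ∣_) (*-assoc p (p ^ e) m) d))

-- Divisors that are multiples of p become, after division by p, the divisors of p^e m; the others
-- are coprime to p and divide m. Blocks of length p separate the two kinds.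
τ-^-step : ∀ {p} → Prime p → ∀ b e m → 0 < m → ¬ p ∣ m → p ^ suc e * m < b → τ b (p ^ suc e * m) ≡ τ b (p ^ e * m) + τ b m
τ-^-step {zero}  pr  = contradiction pr ¬prime[0]
τ-^-step {suc k} prP b e m 0<m p∤m <b = begin
  τ b n
    ≡⟨ blocks n 0<n <b ⟩
  Σ.sum b (λ q → [ q * P + 0 ∣ n ]) + Σ.sum b (λ q → Σ.sum k (λ r → [ q * P + suc r ∣ n ]))
    ≡⟨ cong₂ _+_ (Σ.sum-cong b multiple) (Σ.sum-cong b (λ q → Σ.sum-cong-< k (nonmultiple q))) ⟩
  τ b (P ^ e * m) + Σ.sum b (λ q → Σ.sum k (λ r → [ q * P + suc r ∣ m ]))
    ≡⟨ cong (τ b (P ^ e * m) +_) (trans (blocks m 0<m m<b) (cong (_+ Σ.sum b (λ q → Σ.sum k (λ r → [ q * P + suc r ∣ m ])))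
         (Σ.sum-ε b (λ q _ → cong ⟦_⟧ (dec-false (q * P + 0 ∣? m) (λ d → p∤m (∣-trans (divides q (+-identityʳ _)) d))))))) ⟨
  τ b (P ^ e * m) + τ b m ∎
  where
  open ≡-Reasoning
  P = suc k
  n = P ^ suc e * m
  [_∣_] : ℕ → ℕ → ℕ
  [ x ∣ y ] = ⟦ does (x ∣? y) ⟧
  m≤n : m ≤ n
  m≤n = m≤n*m m (P ^ suc e) {{m^n≢0 P (suc e)}}
  m<b = ≤-<-trans m≤n <b
  0<n = <-≤-trans 0<m m≤n
  blocks : ∀ n → 0 < n → n < b → τ b n ≡ Σ.sum b (λ q → [ q * P + 0 ∣ n ]) + Σ.sum b (λ q → Σ.sum k (λ r → [ q * P + suc r ∣ n ]))
  blocks n 0<n n<b = begin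
    Σ.sum b (λ x → [ x ∣ n ])
      ≡⟨ Σ.sum-extend (λ x b≤x → cong ⟦_⟧ (dec-false (x ∣? n) (>⇒∤ {{>-nonZero 0<n}} (<-≤-trans n<b b≤x)))) (m≤m*n b P) ⟨
    Σ.sum (b * P) (λ x → [ x ∣ n ])
      ≡⟨ Σ.sum-blocks b P (λ x → [ x ∣ n ]) ⟩
    Σ.sum b (λ q → Σ.sum P (λ r → [ q * P + r ∣ n ]))
      ≡⟨ Σ.sum-cong b (λ q → Σ.sum-first k (λ r → [ q * P + r ∣ n ])) ⟩
    Σ.sum b (λ q → [ q * P + 0 ∣ n ] + Σ.sum k (λ r → [ q * P + suc r ∣ n ]))
      ≡⟨ Σ.sum-∙ b (λ q → [ q * P + 0 ∣ n ]) (λ q → Σ.sum k (λ r → [ q * P + suc r ∣ n ])) ⟩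
    _ ∎
  multiple : ∀ q → [ q * P + 0 ∣ n ] ≡ [ q ∣ P ^ e * m ]
  multiple q = cong ⟦_⟧ (does-⇔ (mk⇔ to from) (q * P + 0 ∣? n) (q ∣? P ^ e * m))
    where
    n≡ : n ≡ P * (P ^ e * m)
    n≡ = *-assoc P (P ^ e) m
    x≡ : q * P + 0 ≡ P * q
    x≡ = trans (+-identityʳ _) (*-comm q P)
    to : q * P + 0 ∣ n → q ∣ P ^ e * m
    to d = *-cancelˡ-∣ P (subst₂ _∣_ x≡ n≡ d)
    from : q ∣ P ^ e * m → q * P + 0 ∣ n
    from d = subst₂ _∣_ (sym x≡) (sym n≡) (*-monoʳ-∣ P d)
  nonmultiple : ∀ q r → r < k → [ q * P + suc r ∣ n ] ≡ [ q * P + suc r ∣ m ]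
  nonmultiple q r r<k = cong ⟦_⟧ (does-⇔ (mk⇔ (∤-^-divisor (suc e) m prP P∤x) (λ d → ∣n⇒∣m*n (P ^ suc e) d))
                                        (q * P + suc r ∣? n) (q * P + suc r ∣? m))
    where
    P∤x : ¬ P ∣ q * P + suc r
    P∤x d = >⇒∤ (s≤s r<k) (∣m+n∣m⇒∣n d (n∣m*n q))

module _ {p} (pr : Prime p) where
  private instance
    p≢0 : NonZero p
    p≢0 = prime⇒nonZero pr

  τ-^ : ∀ b e m → 0 < m → ¬ p ∣ m → p ^ e * m < b → τ b (p ^ e * m) ≡ suc e * τ b m
  τ-^ b zero    m 0<m p∤m <b = trans (cong (τ b) (+-identityʳ m)) (sym (+-identityʳ _))
  τ-^ b (suc e) m 0<m p∤m <b = trans (τ-^-step pr b e m 0<m p∤m <b) (trans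
    (cong (_+ τ b m) (τ-^ b e m 0<m p∤m (≤-<-trans (*-monoˡ-≤ m (m≤n*m (p ^ e) p)) <b)))
    (+-comm _ (τ b m)))

  p-part : ∀ n → 0 < n → ∃₂ λ e m → n ≡ p ^ e * m × ¬ p ∣ m
  p-part = <-rec (λ n → 0 < n → ∃₂ λ e m → n ≡ p ^ e * m × ¬ p ∣ m) step
    where
    step : ∀ n → (∀ {k} → k < n → 0 < k → ∃₂ λ e m → k ≡ p ^ e * m × ¬ p ∣ m) → 0 < n → ∃₂ λ e m → n ≡ p ^ e * m × ¬ p ∣ m
    step n rec 0<n with p ∣? n
    ... | no p∤n = 0 , n , sym (+-identityʳ n) , p∤n
    ... | yes (divides q n≡q*p) with rec q<n 0<q
      where
      0<q : 0 < q
      0<q = n≢0⇒n>0 (λ { refl → <-irrefl (sym n≡q*p) 0<n })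
      q<n : q < n
      q<n = subst (q <_) (sym n≡q*p) (m<m*n q p {{>-nonZero 0<q}} (nonTrivial⇒n>1 p {{prime⇒nonTrivial pr}}))
    ...   | e , m , q≡ , p∤m = suc e , m , trans n≡q*p (trans (*-comm q p) (trans (cong (p *_) q≡) (sym (*-assoc p (p ^ e) m)))) , p∤m

prime-divisor : ∀ n → 1 < n → ∃ λ p → Prime p × p ∣ n
prime-divisor n 1<n with factorise n {{>-nonZero (<-trans (s≤s z≤n) 1<n)}}
... | record { factors = []     ; isFactorisation = eq } = contradiction (sym eq) (<⇒≢ 1<n)
... | record { factors = p ∷ ps ; isFactorisation = eq ; factorsPrime = pr ∷ _ } = p , pr , subst (p ∣_) (sym eq) (m∣m*n _)

-- A view for induction over the factorisation, one prime at a time. The full power of p is removed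
-- so that `τ-^` applies, and m < n feeds the well-founded recursion.
data Peeled : ℕ → Set where
  one  : Peeled 1
  peel : ∀ p e m → Prime p → 0 < m → ¬ p ∣ m → m < p ^ suc e * m → Peeled (p ^ suc e * m)

peeled : ∀ n → 0 < n → Peeled n
peeled (suc zero)        _   = one
peeled n@(suc (suc _)) 0<n with prime-divisor n (s≤s (s≤s z≤n))
... | p , pr , p∣n with p-part pr n 0<n
...   | zero  , m , n≡ , p∤m = contradiction (subst (p ∣_) (trans n≡ (+-identityʳ m)) p∣n) p∤m
...   | suc e , m , n≡ , p∤m = subst Peeled (sym n≡) (peel p e m pr 0<m p∤m m<)
  where
  0<m : 0 < m
  0<m = n≢0⇒n>0 (λ { refl → contradiction (trans n≡ (*-zeroʳ (p ^ suc e))) (λ ()) })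
  1<p : 1 < p
  1<p = nonTrivial⇒n>1 p {{prime⇒nonTrivial pr}}
  m< : m < p ^ suc e * m
  m< = subst (m <_) (*-comm m (p ^ suc e)) (m<m*n m (p ^ suc e) {{>-nonZero 0<m}} (<-≤-trans 1<p (m≤m*n p (p ^ e) {{m^n≢0 p e {{prime⇒nonZero pr}}}})))

∧-true : ∀ a {b} → a ∧ b ≡ true → a ≡ true × b ≡ true
∧-true true eq = refl , eq

double-injective : ∀ m n → m + m ≡ n + n → m ≡ n
double-injective m n eq = *-cancelˡ-≡ m n 2 (trans (cong (m +_) (+-identityʳ m)) (trans eq (cong (n +_) (sym (+-identityʳ n)))))

-- A removed power p^(e+1) contributes the factor e + 2, which has to be odd, so every exponent is
-- even.
τ-odd⇒square : ∀ b n → 0 < n → n < b → isOdd (τ b n) ≡ true → ∃ λ t → n ≡ t * t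
τ-odd⇒square b = <-rec (λ n → 0 < n → n < b → isOdd (τ b n) ≡ true → ∃ λ t → n ≡ t * t) step
  where
  step : ∀ n → (∀ {k} → k < n → 0 < k → k < b → isOdd (τ b k) ≡ true → ∃ λ t → k ≡ t * t) →
         0 < n → n < b → isOdd (τ b n) ≡ true → ∃ λ t → n ≡ t * t
  step n rec 0<n n<b odd with peeled n 0<n
  ... | one = 1 , refl
  ... | peel p e m pr 0<m p∤m m<n
    with even-or-odd (suc e)
       | ∧-true (isOdd (suc (suc e))) (trans (sym (isOdd-* (suc (suc e)) (τ b m))) (trans (cong isOdd (sym (τ-^ pr b (suc e) m 0<m p∤m n<b))) odd))
  ...   | k , inj₂ e≡ | oddₑ , _ = contradiction (trans (sym oddₑ) (trans (cong (isOdd ∘ suc) e≡) (cong (not ∘ not) (isOdd-double k)))) (λ ())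
  ...   | k , inj₁ e≡ | _ , oddₘ with rec m<n 0<m (<-trans m<n n<b) oddₘ
  ...     | t , refl = p ^ k * t , trans (cong (_* (t * t)) (trans (cong (p ^_) e≡) (^-distribˡ-+-* p k k))) (arith (p ^ k) t)
    where
    arith : ∀ a t → a * a * (t * t) ≡ a * t * (a * t)
    arith = solve-∀

τ-one : ∀ b → 1 < b → τ b 1 ≡ 1
τ-one b 1<b = trans
  (Σ.sum-single b 1 1<b (λ x _ x≢1 → cong ⟦_⟧ (dec-false (x ∣? 1) (x≢1 ∘ ∣1⇒≡1))))
  (cong ⟦_⟧ (dec-true (1 ∣? 1) n∣n))

-- If the removed exponent is 2 k + 1, then h = (k + 1) τ(m), so τ(m) is odd and m is a square. If
-- it is even, τ(m) is again twice an odd number, and the recursion continues with m.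
τ-oddly-even⇒prime*square : ∀ b n h → 0 < n → n < b → τ b n ≡ h + h → isOdd h ≡ true →
  ∃₂ λ p s → Prime p × n ≡ p * (s * s)
τ-oddly-even⇒prime*square b = <-rec OddlyEven step
  where
  OddlyEven : ℕ → Set
  OddlyEven n = ∀ h → 0 < n → n < b → τ b n ≡ h + h → isOdd h ≡ true → ∃₂ λ p s → Prime p × n ≡ p * (s * s)
  step : ∀ n → (∀ {k} → k < n → OddlyEven k) → OddlyEven n
  step n rec h 0<n n<b τ≡ odd with peeled n 0<n
  ... | one = contradiction (trans (sym (cong isOdd (τ-one b n<b))) (trans (cong isOdd τ≡) (isOdd-double h))) (λ ())
  ... | peel p e m pr 0<m p∤m m<n with even-or-odd (suc e) | trans (sym (τ-^ pr b (suc e) m 0<m p∤m n<b)) τ≡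
  ...   | k , inj₂ e≡ | eq with τ-odd⇒square b m 0<m (<-trans m<n n<b) (proj₂ (∧-true (isOdd (suc k)) (trans (sym (isOdd-* (suc k) (τ b m))) (trans (cong isOdd half) odd))))
    where
    half : suc k * τ b m ≡ h
    half = double-injective _ _ (trans (sym (*-distribʳ-+ (τ b m) (suc k) (suc k)))
      (trans (cong (_* τ b m) (trans (cong suc (+-suc k k)) (cong suc (sym e≡)))) eq))
  ...     | t , refl = p , p ^ k * t , pr , trans (cong (_* (t * t)) (trans (cong (p ^_) e≡) (cong (p *_) (^-distribˡ-+-* p k k)))) (arith p (p ^ k) t)
    where
    arith : ∀ p a t → p * (a * a) * (t * t) ≡ p * (a * t * (a * t))
    arith = solve-∀
  step n rec h 0<n n<b τ≡ odd | peel p e m pr 0<m p∤m m<n | k , inj₁ e≡ | eq with even-or-odd (τ b m)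
  ...     | h′ , inj₂ τₘ = contradiction (trans (sym oddₕ) (isOdd-double h)) (λ ())
    where
    odd₁ : isOdd (suc (suc e)) ≡ true
    odd₁ = trans (cong (isOdd ∘ suc) e≡) (cong not (isOdd-double k))
    odd₂ : isOdd (τ b m) ≡ true
    odd₂ = trans (cong isOdd τₘ) (cong not (isOdd-double h′))
    oddₕ : isOdd (h + h) ≡ true
    oddₕ = trans (cong isOdd (sym eq)) (trans (isOdd-* (suc (suc e)) (τ b m)) (cong₂ _∧_ odd₁ odd₂))
  ...     | h′ , inj₁ τₘ with rec m<n h′ 0<m (<-trans m<n n<b) τₘ (proj₂ (∧-true (isOdd (suc (suc e))) (trans (sym (isOdd-* (suc (suc e)) h′)) (trans (cong isOdd half) odd))))
    where
    half : suc (suc e) * h′ ≡ h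
    half = double-injective _ _ (trans (sym (*-distribˡ-+ (suc (suc e)) h′ h′)) (trans (cong (suc (suc e) *_) (sym τₘ)) eq))
  ...       | q , s , prq , refl = q , p ^ k * s , prq , trans (cong (_* (q * (s * s))) (trans (cong (p ^_) e≡) (^-distribˡ-+-* p k k))) (arith (p ^ k) q s)
    where
    arith : ∀ a q s → a * a * (q * (s * s)) ≡ q * (a * s * (a * s))
    arith = solve-∀

-- Odd values and the form p s²

24n+5-nonsquare : ∀ n x → x * x ≢ 24 * n + 5
24n+5-nonsquare n x eq = bad i (m%n<n x 3) (begin
  i * i % 3                                         ≡⟨ [m+kn]%n≡m%n (i * i) (j * j * 3 + i * j * 2) 3 ⟨
  (i * i + (j * j * 3 + i * j * 2) * 3) % 3         ≡⟨ cong (_% 3) (arith i j) ⟩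
  (i + j * 3) * (i + j * 3) % 3                     ≡⟨ cong (λ t → t * t % 3) (m≡m%n+[m/n]*n x 3) ⟨
  x * x % 3                                         ≡⟨ cong (_% 3) (trans eq (arith′ n)) ⟩
  (2 + (8 * n + 1) * 3) % 3                         ≡⟨ [m+kn]%n≡m%n 2 (8 * n + 1) 3 ⟩
  2                                                 ∎)
  where
  open ≡-Reasoning
  i = x % 3
  j = x / 3
  arith : ∀ i j → i * i + (j * j * 3 + i * j * 2) * 3 ≡ (i + j * 3) * (i + j * 3)
  arith = solve-∀
  arith′ : ∀ n → 24 * n + 5 ≡ 2 + (8 * n + 1) * 3
  arith′ = solve-∀
  bad : ∀ i → i < 3 → i * i % 3 ≢ 2
  bad 0 _ ()
  bad 1 _ ()
  bad 2 _ ()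
  bad (suc (suc (suc _))) (s≤s (s≤s (s≤s ())))

[24n+5]%4≡1 : ∀ n → (24 * n + 5) % 4 ≡ 1
[24n+5]%4≡1 n = trans (cong (_% 4) (arith n)) ([m+kn]%n≡m%n 1 (6 * n + 1) 4)
  where
  arith : ∀ n → 24 * n + 5 ≡ 1 + (6 * n + 1) * 4
  arith = solve-∀

cp-odd⇒prime*square : ∀ n → isOdd (cp 3 1 4 n) ≡ true → ∃₂ λ p s → Prime p × 24 * n + 5 ≡ p * (s * s)
cp-odd⇒prime*square n odd = τ-oddly-even⇒prime*square b N D.small (m<n⇒0<n (m<m+n (24 * n) (s≤s z≤n))) N<b D.τ-double
  (trans D.isOdd-small (trans (sym Z.squares-factorisations) (trans (sym (isOdd-cp-squares n)) odd)))
  where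
  N = 24 * n + 5
  b = 24 * n + 25
  N<b : N < b
  N<b = +-monoʳ-< (24 * n) (s≤s (s≤s (s≤s (s≤s (s≤s (s≤s z≤n))))))
  not-4∣ : ∀ k → 4 * k ≢ N
  not-4∣ k eq = contradiction (trans (sym ([24n+5]%4≡1 n)) (trans (cong (_% 4) (trans (sym eq) (*-comm 4 k))) ([m+kn]%n≡m%n 0 k 4))) (λ ())
  module Z = Zagier N b N<b (24n+5-nonsquare n) not-4∣
  module D = DivisorPairs N b N<b (24n+5-nonsquare n) ([24n+5]%4≡1 n)

-- Chebyshev's bound on the number of primes

primeOrOne : ℕ → ℕ
primeOrOne k = if does (prime? k) then k else 1

primesAbove : ℕ → ℕ → ℕ
primesAbove m zero    = 1
primesAbove m (suc t) = primeOrOne (suc (m + t)) * primesAbove m t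

primorial : ℕ → ℕ
primorial = primesAbove 0

primesAbove-+ : ∀ m t → primorial (m + t) ≡ primesAbove m t * primorial m
primesAbove-+ m zero    = trans (cong primorial (+-identityʳ m)) (sym (+-identityʳ _))
primesAbove-+ m (suc t) = begin
  primorial (m + suc t)                                            ≡⟨ cong primorial (+-suc m t) ⟩
  primeOrOne (suc (m + t)) * primorial (m + t)                     ≡⟨ cong (primeOrOne (suc (m + t)) *_) (primesAbove-+ m t) ⟩
  primeOrOne (suc (m + t)) * (primesAbove m t * primorial m)       ≡⟨ *-assoc (primeOrOne (suc (m + t))) _ _ ⟨
  primesAbove m (suc t) * primorial m                              ∎
  where open ≡-Reasoning

prime∤1 : ∀ {p} → Prime p → ¬ p ∣ 1
prime∤1 pr p∣1 = ¬prime[1] (subst Prime (∣1⇒≡1 p∣1) pr)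

prime-∣-primesAbove : ∀ {p} → Prime p → ∀ m t → p ∣ primesAbove m t → p ≤ m + t
prime-∣-primesAbove pr m zero    p∣ = contradiction p∣ (prime∤1 pr)
prime-∣-primesAbove {p} pr m (suc t) p∣ with euclidsLemma (primeOrOne (suc (m + t))) (primesAbove m t) pr p∣
... | inj₂ p∣r = ≤-trans (prime-∣-primesAbove pr m t p∣r) (+-monoʳ-≤ m (n≤1+n t))
... | inj₁ p∣k with prime? (suc (m + t))
...   | yes _ = ≤-trans (∣⇒≤ p∣k) (≤-reflexive (sym (+-suc m t)))
...   | no  _ = contradiction p∣k (prime∤1 pr)

-- The newest prime exceeds all earlier ones and is coprime to their product, so divisibility by
-- each gives divisibility by the product.
primesAbove-∣ : ∀ m t c → (∀ k → m < k → k ≤ m + t → Prime k → k ∣ c) → primesAbove m t ∣ c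
primesAbove-∣ m zero    c h = 1∣ c
primesAbove-∣ m (suc t) c h with prime? (suc (m + t)) | primesAbove-∣ m t c (λ k m<k k≤ → h k m<k (≤-trans k≤ (+-monoʳ-≤ m (n≤1+n t))))
... | no  _  | rest = subst (_∣ c) (sym (+-identityʳ _)) rest
... | yes pr | rest with h (suc (m + t)) (s≤s (m≤m+n m t)) (≤-reflexive (sym (+-suc m t))) pr
...   | divides q c≡ = subst (k * primesAbove m t ∣_) (sym c≡k*q) (*-monoʳ-∣ k
          (coprime-divisor (∤⇒coprime pr (λ d → 1+n≰n (prime-∣-primesAbove pr m t d))) (subst (primesAbove m t ∣_) c≡k*q rest)))
  where
  k = suc (m + t)
  c≡k*q : c ≡ k * q
  c≡k*q = trans c≡ (*-comm q k)

∣n! : ∀ {k} n → 0 < k → k ≤ n → k ∣ n !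
∣n! {suc k} n _ k≤n = ∣-trans (m∣m*n (k !)) (m≤n⇒m!∣n! k≤n)

prime-∣n!⇒≤ : ∀ {p} n → Prime p → p ∣ n ! → p ≤ n
prime-∣n!⇒≤ zero    pr p∣ = contradiction p∣ (prime∤1 pr)
prime-∣n!⇒≤ (suc n) pr p∣ with euclidsLemma (suc n) (n !) pr p∣
... | inj₁ p∣n  = ∣⇒≤ p∣n
... | inj₂ p∣n! = m≤n⇒m≤1+n (prime-∣n!⇒≤ n pr p∣n!)

C≤2^ : ∀ n k → n C k ≤ 2 ^ n
C≤2^ n       zero    = m^n>0 2 n
C≤2^ zero    (suc k) = ≤-trans (≤-reflexive (k>n⇒nCk≡0 {0} {suc k} (s≤s z≤n))) z≤n
C≤2^ (suc n) (suc k) = begin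
  suc n C suc k          ≡⟨ nCk+nC[k+1]≡[n+1]C[k+1] n k ⟨
  n C k + n C suc k      ≤⟨ +-mono-≤ (C≤2^ n k) (C≤2^ n (suc k)) ⟩
  2 ^ n + 2 ^ n          ≡⟨ cong (2 ^ n +_) (+-identityʳ (2 ^ n)) ⟨
  2 ^ suc n              ∎
  where open ≤-Reasoning

C-factorials : ∀ {n k} → k ≤ n → (n C k) * (k ! * (n ∸ k) !) ≡ n !
C-factorials {n} {k} k≤n = trans (cong (_* (k ! * (n ∸ k) !)) (nCk≡n!/k![n-k]! k≤n)) (m/n*n≡m (k![n∸k]!∣n! k≤n))
  where instance _ = k !* (n ∸ k) !≢0

-- The prime divides (2 m)! but, being larger than m, neither factor m! of the denominator.
prime-∣-centralBinomial : ∀ {p} m → Prime p → m < p → p ≤ m + m → p ∣ (m + m) C m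
prime-∣-centralBinomial {p} m pr m<p p≤2m
  with euclidsLemma ((m + m) C m) (m ! * (m + m ∸ m) !) pr
         (subst (p ∣_) (sym (C-factorials (m≤m+n m m))) (∣n! (m + m) (≤-<-trans z≤n m<p) p≤2m))
... | inj₁ p∣C = p∣C
... | inj₂ p∣m!m! with euclidsLemma (m !) ((m + m ∸ m) !) pr p∣m!m!
...   | inj₁ p∣m! = contradiction (prime-∣n!⇒≤ m pr p∣m!) (<⇒≱ m<p)
...   | inj₂ p∣m! = contradiction (prime-∣n!⇒≤ m pr (subst (λ t → p ∣ t !) (m+n∸n≡m m m) p∣m!)) (<⇒≱ m<p)

centralBinomial-nonZero : ∀ m → NonZero ((m + m) C m)
centralBinomial-nonZero m = m*n≢0⇒m≢0 ((m + m) C m) {m ! * (m + m ∸ m) !} {{subst NonZero (sym (C-factorials (m≤m+n m m))) ((m + m) !≢0)}}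

primesAbove-≤ : ∀ m → primesAbove m m ≤ 2 ^ (m + m)
primesAbove-≤ m = ≤-trans
  (∣⇒≤ {{centralBinomial-nonZero m}} (primesAbove-∣ m m ((m + m) C m) (λ k m<k k≤2m pr → prime-∣-centralBinomial m pr m<k k≤2m)))
  (C≤2^ (m + m) m)

primeOrOne≥1 : ∀ k → 1 ≤ primeOrOne (suc k)
primeOrOne≥1 k with does (prime? (suc k))
... | true  = s≤s z≤n
... | false = ≤-refl

primorial≥1 : ∀ n → 1 ≤ primorial n
primorial≥1 zero    = ≤-refl
primorial≥1 (suc n) = *-mono-≤ (primeOrOne≥1 n) (primorial≥1 n)

primorial-step : ∀ n → primorial n ≤ primorial (suc n)
primorial-step n = ≤-trans (≤-reflexive (sym (*-identityˡ _))) (*-monoˡ-≤ (primorial n) (primeOrOne≥1 n))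

-- Doubling from m costs 2 m + 4 m = 6 m in the exponent. The constant 4 leaves room for odd n = 2 m
-- - 1, which is first raised to 2 m: 6 m ≤ 4 (2 m - 1) holds from m = 2 on.
primorial-≤ : ∀ n → primorial n ≤ 2 ^ (4 * n)
primorial-≤ = <-rec (λ n → primorial n ≤ 2 ^ (4 * n)) step
  where
  double : ∀ m n → m < n → 2 ≤ m → 6 * m ≤ 4 * n → primorial m ≤ 2 ^ (4 * m) → primorial (m + m) ≤ 2 ^ (4 * n)
  double m n m<n 2≤m 6m≤4n ih = begin
    primorial (m + m)                  ≡⟨ primesAbove-+ m m ⟩
    primesAbove m m * primorial m      ≤⟨ *-mono-≤ (primesAbove-≤ m) ih ⟩
    2 ^ (m + m) * 2 ^ (4 * m)          ≡⟨ ^-distribˡ-+-* 2 (m + m) (4 * m) ⟨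
    2 ^ (m + m + 4 * m)                ≡⟨ cong (2 ^_) (arith m) ⟩
    2 ^ (6 * m)                        ≤⟨ ^-monoʳ-≤ 2 6m≤4n ⟩
    2 ^ (4 * n)                        ∎
    where
    open ≤-Reasoning
    arith : ∀ m → m + m + 4 * m ≡ 6 * m
    arith = solve-∀
  halve : ∀ n → (∀ {k} → k < n → primorial k ≤ 2 ^ (4 * k)) → 2 < n → (∃ λ k → n ≡ k + k ⊎ n ≡ suc (k + k)) → primorial n ≤ 2 ^ (4 * n)
  halve .(0)     rec ()                 (zero        , inj₁ refl)
  halve .(1)     rec (s≤s ())           (zero        , inj₂ refl)
  halve .(2)     rec (s≤s (s≤s ()))     (suc zero    , inj₁ refl)
  halve n rec 2<n (suc (suc k) , inj₁ refl) =
    double m n m<n (s≤s (s≤s z≤n)) (subst (6 * m ≤_) (arith m) (m≤m+n (6 * m) (2 * m))) (rec m<n)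
    where
    m = suc (suc k)
    m<n : m < m + m
    m<n = m<m+n m (s≤s z≤n)
    arith : ∀ m → 6 * m + 2 * m ≡ 4 * (m + m)
    arith = solve-∀
  halve n rec 2<n (suc k , inj₂ refl) = ≤-trans (primorial-step n)
    (≤-trans (≤-reflexive (cong primorial (cong suc (sym (+-suc (suc k) (suc k))))))
      (double m n m<n (s≤s (s≤s z≤n)) (subst₂ _≤_ (arith₁ k) (arith₂ k) (m≤m+n (6 * k + 12) (2 * k))) (rec m<n)))
    where
    m = suc (suc k)
    m<n : m < suc (suc k + suc k)
    m<n = s≤s (m<m+n (suc k) (s≤s z≤n))
    arith₁ : ∀ k → 6 * k + 12 ≡ 6 * (2 + k)
    arith₁ = solve-∀
    arith₂ : ∀ k → 6 * k + 12 + 2 * k ≡ 4 * (suc (suc k + suc k))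
    arith₂ = solve-∀
  step : ∀ n → (∀ {k} → k < n → primorial k ≤ 2 ^ (4 * k)) → primorial n ≤ 2 ^ (4 * n)
  step 0 _ = ≤-refl
  step 1 _ = s≤s z≤n
  step 2 _ = s≤s (s≤s z≤n)
  step n@(suc (suc (suc _))) rec = halve n rec (s≤s (s≤s (s≤s z≤n))) (even-or-odd n)

⟦⟧≤1 : ∀ b → ⟦ b ⟧ ≤ 1
⟦⟧≤1 true  = ≤-refl
⟦⟧≤1 false = z≤n

sum-mono-≤ : ∀ n {f g} → (∀ i → i < n → f i ≤ g i) → Σ.sum n f ≤ Σ.sum n g
sum-mono-≤ zero    h = z≤n
sum-mono-≤ (suc n) h = +-mono-≤ (sum-mono-≤ n (λ i i<n → h i (m<n⇒m<1+n i<n))) (h n (n<1+n n))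

sum-const : ∀ n c → Σ.sum n (λ _ → c) ≡ n * c
sum-const zero    c = refl
sum-const (suc n) c = trans (cong (_+ c) (sum-const n c)) (+-comm (n * c) c)

term≤sum : ∀ n f k → k < n → f k ≤ Σ.sum n f
term≤sum (suc n) f k k<1+n with k ≟ n
... | yes refl = m≤n+m (f k) (Σ.sum n f)
... | no k≢n   = ≤-trans (term≤sum n f k (≤∧≢⇒< (≤-pred k<1+n) k≢n)) (m≤m+n _ (f n))

π : ℕ → ℕ
π n = Σ.sum (suc n) (λ p → ⟦ does (prime? p) ⟧)

π≤ : ∀ n → π n ≤ suc n
π≤ n = ≤-trans (sum-mono-≤ (suc n) (λ p _ → ⟦⟧≤1 (does (prime? p)))) (≤-reflexive (trans (sum-const (suc n) 1) (*-identityʳ (suc n))))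

-- Each prime that is at least a contributes a factor of at least a to the primorial; a^a pays for
-- the primes below a.
π-power : ∀ a n → 1 ≤ a → a ^ π n ≤ a ^ a * primorial n
π-power a zero    1≤a = ≤-trans (m^n>0 a {{>-nonZero 1≤a}} a) (≤-reflexive (sym (*-identityʳ (a ^ a))))
π-power a (suc n) 1≤a with prime? (suc n) in eq
... | no _ = ≤-trans (≤-reflexive (cong (a ^_) (+-identityʳ (π n)))) (≤-trans (π-power a n 1≤a) (*-monoʳ-≤ (a ^ a) (≤-reflexive (sym (+-identityʳ (primorial n))))))
... | yes _ with a ≤? suc n
...   | yes a≤1+n = begin
  a ^ (π n + 1)                          ≡⟨ cong (a ^_) (+-comm (π n) 1) ⟩
  a * a ^ π n                            ≤⟨ *-mono-≤ a≤1+n (π-power a n 1≤a) ⟩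
  suc n * (a ^ a * primorial n)          ≡⟨ arith (suc n) (a ^ a) (primorial n) ⟩
  a ^ a * (suc n * primorial n)          ∎
  where
  open ≤-Reasoning
  arith : ∀ x y z → x * (y * z) ≡ y * (x * z)
  arith = solve-∀
...   | no a≰1+n = begin
  a ^ (π n + 1)                          ≤⟨ ^-monoʳ-≤ a {{>-nonZero 1≤a}} (≤-trans (+-monoˡ-≤ 1 (π≤ n)) (≤-trans (≤-reflexive (+-comm (suc n) 1)) (≰⇒> a≰1+n))) ⟩
  a ^ a                                  ≡⟨ *-identityʳ (a ^ a) ⟨
  a ^ a * 1                              ≤⟨ *-monoʳ-≤ (a ^ a) (*-mono-≤ (s≤s (z≤n {n})) (primorial≥1 n)) ⟩
  a ^ a * (suc n * primorial n)          ∎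
  where open ≤-Reasoning

^-cancelʳ-≤ : ∀ a → 1 < a → ∀ m n → a ^ m ≤ a ^ n → m ≤ n
^-cancelʳ-≤ a 1<a m n a^m≤a^n with m ≤? n
... | yes m≤n = m≤n
... | no m≰n  = contradiction a^m≤a^n (<⇒≱ (^-monoʳ-< a 1<a (≰⇒> m≰n)))

-- Base-2 logarithms of `π-power` at a = 2^(4k): the primorial costs 4 n, which is n after division
-- by 4. As k is arbitrary, the primes have density 0.
π-bound : ∀ k n → k * π n ≤ k * 2 ^ (4 * k) + n
π-bound k n = *-cancelˡ-≤ 4 (^-cancelʳ-≤ 2 (s≤s (s≤s z≤n)) _ _ (begin
  2 ^ (4 * (k * π n))                ≡⟨ cong (2 ^_) (sym (*-assoc 4 k (π n))) ⟩
  2 ^ (4 * k * π n)                  ≡⟨ ^-*-assoc 2 (4 * k) (π n) ⟨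
  a ^ π n                            ≤⟨ π-power a n (m^n>0 2 (4 * k)) ⟩
  a ^ a * primorial n                ≤⟨ *-monoʳ-≤ (a ^ a) (primorial-≤ n) ⟩
  a ^ a * 2 ^ (4 * n)                ≡⟨ cong (_* 2 ^ (4 * n)) (^-*-assoc 2 (4 * k) a) ⟩
  2 ^ (4 * k * a) * 2 ^ (4 * n)      ≡⟨ ^-distribˡ-+-* 2 (4 * k * a) (4 * n) ⟨
  2 ^ (4 * k * a + 4 * n)            ≡⟨ cong (2 ^_) (arith k a n) ⟩
  2 ^ (4 * (k * a + n))              ∎))
  where
  open ≤-Reasoning
  a = 2 ^ (4 * k)
  arith : ∀ k a n → 4 * k * a + 4 * n ≡ 4 * (k * a + n)
  arith = solve-∀

-- The numbers p s²

¬odd⇒even : ∀ n → ¬ (isOdd n ≡ true) → 2 ∣ n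
¬odd⇒even n ¬odd with even-or-odd n
... | k , inj₁ refl = divides k (trans (cong (k +_) (sym (+-identityʳ k))) (*-comm 2 k))
... | k , inj₂ refl = contradiction (cong not (isOdd-double k)) ¬odd

¬even⇒odd : ∀ n → ¬ 2 ∣ n → 1 ≤ ⟦ isOdd n ⟧
¬even⇒odd n 2∤n with isOdd n in eq
... | true  = ≤-refl
... | false = contradiction (¬odd⇒even n (λ odd → contradiction (trans (sym odd) eq) (λ ()))) 2∤n

prime-∣-prime : ∀ {p q} → Prime p → Prime q → p ∣ q → p ≡ q
prime-∣-prime prp prq p∣q with prime⇒irreducible prq p∣q
... | inj₁ p≡1 = contradiction (subst Prime p≡1 prp) ¬prime[1]
... | inj₂ p≡q = p≡q

-- The exponent of p in q s² is even. Since p differs from q it divides s, and cancelling p² lowers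
-- e by one.
even-exponent : ∀ {p q} → Prime p → Prime q → p ≢ q → ∀ e s →
  p ^ (2 * e + 1) ∣ q * (s * s) → p ^ (2 * e + 2) ∣ q * (s * s)
even-exponent {p} {q} prp prq p≢q e s d with p∣s
  where
  p∣s : p ∣ s
  p∣s with euclidsLemma q (s * s) prp (∣-trans (subst (λ t → p ∣ p ^ t) (+-comm 1 (2 * e)) (m∣m*n (p ^ (2 * e)))) d)
  ... | inj₁ p∣q = contradiction (prime-∣-prime prp prq p∣q) p≢q
  ... | inj₂ p∣s² with euclidsLemma s s prp p∣s²
  ...   | inj₁ p∣s = p∣s
  ...   | inj₂ p∣s = p∣s
... | divides t refl with e
...   | zero  = divides (q * (t * t)) (arith p q t)
  where
  arith : ∀ p q t → q * (t * p * (t * p)) ≡ q * (t * t) * (p * (p * 1))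
  arith = solve-∀
...   | suc e = subst₂ _∣_ (raise 2) (arith p q t) (*-monoʳ-∣ p (*-monoʳ-∣ p (even-exponent prp prq p≢q e t
        (*-cancelˡ-∣ p {{prime⇒nonZero prp}} (*-cancelˡ-∣ p {{prime⇒nonZero prp}} (subst₂ _∣_ (sym (raise 1)) (sym (arith p q t)) d))))))
  where
  raise : ∀ k → p * (p * p ^ (2 * e + k)) ≡ p ^ (2 * suc e + k)
  raise k = cong (p ^_) (exponent e k)
    where
    exponent : ∀ e k → 2 + (2 * e + k) ≡ 2 * suc e + k
    exponent = solve-∀
  arith : ∀ p q t → p * (p * (q * (t * t))) ≡ q * (t * p * (t * p))
  arith = solve-∀

three-times-square : ∀ p s → p % 4 ≡ 3 → p * (s * s) % 4 ≢ 1
three-times-square p s p%4≡3 eq = bad i (m%n<n s 4) (begin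
  3 * (i * i) % 4
    ≡⟨ [m+kn]%n≡m%n (3 * (i * i)) (u * (i * i) + (3 + u * 4) * (2 * i * j + 4 * (j * j))) 4 ⟨
  (3 * (i * i) + (u * (i * i) + (3 + u * 4) * (2 * i * j + 4 * (j * j))) * 4) % 4
    ≡⟨ cong (_% 4) (arith u i j) ⟩
  (3 + u * 4) * ((i + j * 4) * (i + j * 4)) % 4
    ≡⟨ cong₂ (λ a b → a * (b * b) % 4) p≡ (m≡m%n+[m/n]*n s 4) ⟨
  p * (s * s) % 4
    ≡⟨ eq ⟩
  1 ∎)
  where
  open ≡-Reasoning
  i = s % 4
  j = s / 4
  u = p / 4
  p≡ : p ≡ 3 + u * 4
  p≡ = trans (m≡m%n+[m/n]*n p 4) (cong (_+ u * 4) p%4≡3)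
  arith : ∀ u i j → 3 * (i * i) + (u * (i * i) + (3 + u * 4) * (2 * i * j + 4 * (j * j))) * 4 ≡
                    (3 + u * 4) * ((i + j * 4) * (i + j * 4))
  arith = solve-∀
  bad : ∀ i → i < 4 → 3 * (i * i) % 4 ≢ 1
  bad 0 _ ()
  bad 1 _ ()
  bad 2 _ ()
  bad 3 _ ()
  bad (suc (suc (suc (suc _)))) (s≤s (s≤s (s≤s (s≤s ()))))

cp-even : ∀ n p → Prime p → p % 4 ≡ 3 →
  (∃ λ e → (p ^ (2 * e + 1) ∣ 24 * n + 5) × ¬ (p ^ (2 * e + 2) ∣ 24 * n + 5)) → 2 ∣ cp 3 1 4 n
cp-even n p prp p%4≡3 (e , odd∣ , even∤) = ¬odd⇒even (cp 3 1 4 n) (λ odd → impossible (cp-odd⇒prime*square n odd))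
  where
  impossible : ¬ (∃₂ λ q s → Prime q × 24 * n + 5 ≡ q * (s * s))
  impossible (q , s , prq , N≡) with p ≟ q
  ... | yes refl = three-times-square p s p%4≡3 (trans (cong (_% 4) (sym N≡)) ([24n+5]%4≡1 n))
  ... | no p≢q   = even∤ (subst (p ^ (2 * e + 2) ∣_) (sym N≡) (even-exponent prp prq p≢q e s (subst (p ^ (2 * e + 1) ∣_) N≡ odd∣)))

-- Density of the numbers p s²

hits≤1 : ∀ n (e : ℕ → ℕ) a → (∀ {i j} → i < j → e i ≢ e j) → Σ.sum n (λ k → ⟦ a ≡ᵇ e k ⟧) ≤ 1
hits≤1 zero    e a inj = z≤n
hits≤1 (suc n) e a inj with a ≟ e n
... | no a≢   = subst (_≤ 1) (trans (sym (+-identityʳ _)) (cong (λ t → Σ.sum n (λ k → ⟦ a ≡ᵇ e k ⟧) + ⟦ t ⟧) (sym (≡ᵇ-false a (e n) a≢)))) (hits≤1 n e a inj)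
... | yes refl = +-mono-≤ (≤-reflexive (Σ.sum-ε n (λ k k<n → cong ⟦_⟧ (≡ᵇ-false (e n) (e k) (inj k<n ∘ sym))))) (⟦⟧≤1 (e n ≡ᵇ e n))

hits≤bound : ∀ n (e : ℕ → ℕ) a y → (∀ {i j} → i < j → e i ≢ e j) → (∀ k → k < n → e k ≤ y) →
  Σ.sum n (λ k → ⟦ a ≡ᵇ e k ⟧) ≤ ⟦ does (a ≤? y) ⟧
hits≤bound n e a y inj e≤y with a ≤? y
... | yes a≤y = subst (λ t → Σ.sum n (λ k → ⟦ a ≡ᵇ e k ⟧) ≤ ⟦ t ⟧) (sym (dec-true (a ≤? y) a≤y)) (hits≤1 n e a inj)
... | no a≰y  = ≤-trans (≤-reflexive (Σ.sum-ε n (λ k k<n → cong ⟦_⟧ (≡ᵇ-false a (e k) (λ { refl → a≰y (e≤y k k<n) }))))) z≤n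

multiples≤ : ∀ b m y → Σ.sum b (λ c → ⟦ does (suc c * m ≤? y) ⟧) * m ≤ y
multiples≤ zero    m y = z≤n
multiples≤ (suc b) m y with suc b * m ≤? y
... | no ≰y = subst (λ t → t * m ≤ y)
  (trans (sym (+-identityʳ _)) (cong (λ t → Σ.sum b (λ c → ⟦ does (suc c * m ≤? y) ⟧) + ⟦ t ⟧) (sym (dec-false (suc b * m ≤? y) ≰y))))
  (multiples≤ b m y)
... | yes ≤y = ≤-trans (*-monoˡ-≤ m (≤-trans (sum-mono-≤ (suc b) (λ c _ → ⟦⟧≤1 (does (suc c * m ≤? y))))
    (≤-reflexive (trans (sum-const (suc b) 1) (*-identityʳ (suc b)))))) ≤y

-- Telescoping with 1/u² ≤ 1/(u-1) - 1/u, cleared of denominators.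
square-tail : ∀ s y f → .{{NonZero s}} → (∀ t → f t * ((suc s + t) * (suc s + t)) ≤ y) → ∀ t → s * (s + t) * Σ.sum t f ≤ t * y
square-tail s y f h zero    = ≤-reflexive (*-zeroʳ (s * (s + 0)))
square-tail s y f h (suc t) = *-cancelˡ-≤ (s + t) {{>-nonZero (≤-trans (>-nonZero⁻¹ s) (m≤m+n s t))}} (begin
  (s + t) * (s * (s + suc t) * (Σ.sum t f + f t))
    ≡⟨ arith₁ s t (Σ.sum t f) (f t) ⟩
  (suc s + t) * (s * (s + t) * Σ.sum t f) + s * (f t * ((suc s + t) * (s + t)))
    ≤⟨ +-mono-≤ (*-monoʳ-≤ (suc s + t) (square-tail s y f h t)) (*-monoʳ-≤ s (≤-trans (*-monoʳ-≤ (f t) (*-monoʳ-≤ (suc s + t) (n≤1+n (s + t)))) (h t))) ⟩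
  (suc s + t) * (t * y) + s * y
    ≡⟨ arith₂ s t y ⟩
  (s + t) * (suc t * y) ∎)
  where
  open ≤-Reasoning
  arith₁ : ∀ s t a b → (s + t) * (s * (s + suc t) * (a + b)) ≡
    (suc s + t) * (s * (s + t) * a) + s * (b * ((suc s + t) * (s + t)))
  arith₁ = solve-∀
  arith₂ : ∀ s t y → (suc s + t) * (t * y) + s * y ≡ (s + t) * (suc t * y)
  arith₂ = solve-∀

square-tail-bound : ∀ s y f → .{{NonZero s}} → (∀ t → f t * ((suc s + t) * (suc s + t)) ≤ y) → ∀ t → s * Σ.sum t f ≤ y
square-tail-bound s y f h t = *-cancelˡ-≤ (s + t) {{>-nonZero (≤-trans (>-nonZero⁻¹ s) (m≤m+n s t))}} (begin
  (s + t) * (s * Σ.sum t f)    ≡⟨ arith s t (Σ.sum t f) ⟩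
  s * (s + t) * Σ.sum t f      ≤⟨ square-tail s y f h t ⟩
  t * y                        ≤⟨ *-monoˡ-≤ y (m≤n+m t s) ⟩
  (s + t) * y                  ∎)
  where
  open ≤-Reasoning
  arith : ∀ s t a → (s + t) * (s * a) ≡ s * (s + t) * a
  arith = solve-∀

module OddCount (odd : ℕ → Bool) (odd⇒prime*square : ∀ n → odd n ≡ true → ∃₂ λ p s → Prime p × 24 * n + 5 ≡ p * (s * s))
  (S n : ℕ) .{{_ : NonZero S}} where

  N : ℕ → ℕ
  N k = 24 * suc k + 5

  Y : ℕ
  Y = 24 * n + 5

  N-≢ : ∀ {i j} → i < j → N i ≢ N j
  N-≢ i<j eq = <⇒≢ i<j (suc-injective (*-cancelˡ-≡ _ _ 24 (+-cancelʳ-≡ 5 _ _ eq)))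

  N≤Y : ∀ k → k < n → N k ≤ Y
  N≤Y k k<n = +-monoˡ-≤ 5 (*-monoʳ-≤ 24 k<n)

  odds : ℕ
  odds = Σ.sum n (λ k → ⟦ odd (suc k) ⟧)

  smallRoot largeRoot : ℕ → ℕ
  smallRoot m = Σ.sum (suc S) (λ s → Σ.sum (suc Y) (λ p → ⟦ does (prime? p) ∧ (p * (s * s) ≡ᵇ m) ⟧))
  largeRoot m = Σ.sum Y (λ t → Σ.sum Y (λ c → ⟦ suc c * ((suc S + t) * (suc S + t)) ≡ᵇ m ⟧))

  odd≤roots : ∀ k → k < n → ⟦ odd (suc k) ⟧ ≤ smallRoot (N k) + largeRoot (N k)
  odd≤roots k k<n with odd (suc k) in eq
  ... | false = z≤n
  ... | true with odd⇒prime*square (suc k) eq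
  ...   | zero  , s , prp , N≡ = contradiction N≡ (λ ())
  ...   | suc c , s , prp , N≡ with s ≤? S
  ...     | yes s≤S = ≤-trans (≤-trans (≤-reflexive (sym hit))
                (≤-trans (term≤sum (suc Y) (λ p → ⟦ does (prime? p) ∧ (p * (s * s) ≡ᵇ N k) ⟧) (suc c) (s≤s p≤Y))
                         (term≤sum (suc S) _ s (s≤s s≤S))))
              (m≤m+n _ (largeRoot (N k)))
    where
    s≢0 : s ≢ 0
    s≢0 refl = contradiction (trans N≡ (*-zeroʳ (suc c))) (λ ())
    p≤Y : suc c ≤ Y
    p≤Y = ≤-trans (m≤m*n (suc c) (s * s) {{m*n≢0 s s {{≢-nonZero s≢0}} {{≢-nonZero s≢0}}}}) (≤-trans (≤-reflexive (sym N≡)) (N≤Y k k<n))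
    hit : ⟦ does (prime? (suc c)) ∧ (suc c * (s * s) ≡ᵇ N k) ⟧ ≡ 1
    hit = cong ⟦_⟧ (cong₂ _∧_ (dec-true (prime? (suc c)) prp) (≡ᵇ-true _ _ (sym N≡)))
  ...     | no s≰S = ≤-trans (≤-trans (≤-reflexive (sym hit))
                (≤-trans (term≤sum Y (λ c → ⟦ suc c * ((suc S + t) * (suc S + t)) ≡ᵇ N k ⟧) c c<Y)
                         (term≤sum Y _ t t<Y)))
              (m≤n+m _ (smallRoot (N k)))
    where
    t = s ∸ suc S
    s≡ : suc S + t ≡ s
    s≡ = m+[n∸m]≡n (≰⇒> s≰S)
    s>0 : 0 < s
    s>0 = ≤-trans (s≤s z≤n) (≰⇒> s≰S)
    c<Y : c < Y
    c<Y = ≤-trans (m≤m*n (suc c) (s * s) {{m*n≢0 s s {{>-nonZero s>0}} {{>-nonZero s>0}}}}) (≤-trans (≤-reflexive (sym N≡)) (N≤Y k k<n))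
    t<Y : t < Y
    t<Y = <-≤-trans (subst (t <_) s≡ (s≤s (m≤n+m t S))) (≤-trans (m≤m*m s) (≤-trans (m≤n*m (s * s) (suc c)) (≤-trans (≤-reflexive (sym N≡)) (N≤Y k k<n))))
    hit : ⟦ suc c * ((suc S + t) * (suc S + t)) ≡ᵇ N k ⟧ ≡ 1
    hit = cong ⟦_⟧ (≡ᵇ-true _ _ (trans (cong (λ u → suc c * (u * u)) s≡) (sym N≡)))

  tail : ℕ → ℕ
  tail t = Σ.sum Y (λ c → ⟦ does (suc c * ((suc S + t) * (suc S + t)) ≤? Y) ⟧)

  smallRoot-sum : Σ.sum n (smallRoot ∘ N) ≤ suc S * π Y
  smallRoot-sum = begin
    Σ.sum n (smallRoot ∘ N)
      ≡⟨ Σ.sum-swap n (suc S) (λ k s → Σ.sum (suc Y) (λ p → hit p s k)) ⟩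
    Σ.sum (suc S) (λ s → Σ.sum n (λ k → Σ.sum (suc Y) (λ p → hit p s k)))
      ≡⟨ Σ.sum-cong (suc S) (λ s → Σ.sum-swap n (suc Y) (λ k p → hit p s k)) ⟩
    Σ.sum (suc S) (λ s → Σ.sum (suc Y) (λ p → Σ.sum n (hit p s)))
      ≤⟨ sum-mono-≤ (suc S) (λ s _ → sum-mono-≤ (suc Y) (λ p _ → once (does (prime? p)) (p * (s * s)))) ⟩
    Σ.sum (suc S) (λ s → π Y)
      ≡⟨ sum-const (suc S) (π Y) ⟩
    suc S * π Y ∎
    where
    open ≤-Reasoning
    hit : ℕ → ℕ → ℕ → ℕ
    hit p s k = ⟦ does (prime? p) ∧ (p * (s * s) ≡ᵇ N k) ⟧
    once : ∀ b a → Σ.sum n (λ k → ⟦ b ∧ (a ≡ᵇ N k) ⟧) ≤ ⟦ b ⟧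
    once true  a = hits≤1 n N a N-≢
    once false a = ≤-reflexive (Σ.sum-ε n (λ _ _ → refl))

  largeRoot-sum : Σ.sum n (largeRoot ∘ N) ≤ Σ.sum Y tail
  largeRoot-sum = begin
    Σ.sum n (largeRoot ∘ N)
      ≡⟨ Σ.sum-swap n Y (λ k t → Σ.sum Y (λ c → hit t c k)) ⟩
    Σ.sum Y (λ t → Σ.sum n (λ k → Σ.sum Y (λ c → hit t c k)))
      ≡⟨ Σ.sum-cong Y (λ t → Σ.sum-swap n Y (λ k c → hit t c k)) ⟩
    Σ.sum Y (λ t → Σ.sum Y (λ c → Σ.sum n (hit t c)))
      ≤⟨ sum-mono-≤ Y (λ t _ → sum-mono-≤ Y (λ c _ → hits≤bound n N (suc c * ((suc S + t) * (suc S + t))) Y N-≢ N≤Y)) ⟩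
    Σ.sum Y tail ∎
    where
    open ≤-Reasoning
    hit : ℕ → ℕ → ℕ → ℕ
    hit t c k = ⟦ suc c * ((suc S + t) * (suc S + t)) ≡ᵇ N k ⟧

  tail-bound : S * Σ.sum Y tail ≤ Y
  tail-bound = square-tail-bound S Y tail (λ t → multiples≤ Y ((suc S + t) * (suc S + t)) Y) Y

  odds-bound : odds ≤ suc S * π Y + Σ.sum Y tail
  odds-bound = ≤-trans (sum-mono-≤ n odd≤roots)
    (≤-trans (≤-reflexive (Σ.sum-∙ n (smallRoot ∘ N) (largeRoot ∘ N))) (+-mono-≤ smallRoot-sum largeRoot-sum))

filter-complement : ∀ {A : Set} {P : A → Set} (P? : ∀ x → Dec (P x)) (g : A → ℕ) → (∀ x → ¬ P x → 1 ≤ g x) →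
  ∀ f n → n ≤ length (filter P? (applyUpTo f n)) + Σ.sum n (g ∘ f)
filter-complement P? g h f zero    = z≤n
filter-complement P? g h f (suc n) with P? (f 0) | filter-complement P? g h (f ∘ suc) n
... | yes p | ih = s≤s (≤-trans ih (+-monoʳ-≤ (length (filter P? (applyUpTo (f ∘ suc) n)))
                     (≤-trans (m≤n+m _ (g (f 0))) (≤-reflexive (sym (Σ.sum-first n (g ∘ f)))))))
... | no ¬p | ih = begin
  1 + n                                    ≤⟨ +-mono-≤ (h (f 0) ¬p) ih ⟩
  g (f 0) + (l + Σ.sum n (g ∘ f ∘ suc))    ≡⟨ arith (g (f 0)) l _ ⟩
  l + (g (f 0) + Σ.sum n (g ∘ f ∘ suc))    ≡⟨ cong (l +_) (Σ.sum-first n (g ∘ f)) ⟨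
  l + Σ.sum (suc n) (g ∘ f)                ∎
  where
  open ≤-Reasoning
  l = length (filter P? (applyUpTo (f ∘ suc) n))
  arith : ∀ a b c → a + (b + c) ≡ b + (a + c)
  arith = solve-∀

odd : ℕ → Bool
odd n = isOdd (cp 3 1 4 n)

noneven-count : ∀ n → n ∸ evenCount n ≤ Σ.sum n (λ k → ⟦ odd (suc k) ⟧)
noneven-count n = m≤n+o⇒m∸n≤o n (evenCount n) (filter-complement (λ k → 2 ∣? cp 3 1 4 k) (⟦_⟧ ∘ odd) (λ k → ¬even⇒odd (cp 3 1 4 k)) suc n)

-- Y = 24 n + 5 enters twice, once from the primes and once from the tail, giving 48 n + 10. One
-- further n absorbs R + 10 and another makes the inequality strict: hence 50. K = S (S + 1) is the
-- factor S of the claim times the S + 1 small roots.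
odd-density : ∀ w k → 50 ≤ w → 1 ≤ k → ∃ λ M → ∀ n → M ≤ n → k * (n ∸ evenCount n) < n
odd-density w k 50≤w 1≤k = R + 10 , λ n M≤n → *-cancelˡ-< w _ _ (begin-strict
  w * (k * (n ∸ evenCount n))                                    ≡⟨ *-assoc w k _ ⟨
  S * (n ∸ evenCount n)                                          ≤⟨ *-monoʳ-≤ S (≤-trans (noneven-count n) (O.odds-bound S n)) ⟩
  S * (suc S * π (Y n) + Σ.sum (Y n) (O.tail S n))        ≡⟨ arith₁ S (π (Y n)) _ ⟩
  K * π (Y n) + S * Σ.sum (Y n) (O.tail S n)              ≤⟨ +-mono-≤ (π-bound K (Y n)) (O.tail-bound S n) ⟩
  R + Y n + Y n                                                  ≡⟨ arith₂ R n ⟩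
  R + 10 + 48 * n                                                ≤⟨ +-monoˡ-≤ (48 * n) M≤n ⟩
  49 * n                                                         <⟨ *-monoˡ-< n {{>-nonZero (≤-trans (s≤s z≤n) (≤-trans (m≤n+m 10 R) M≤n))}} (n<1+n 49) ⟩
  50 * n                                                         ≤⟨ *-monoˡ-≤ n 50≤w ⟩
  w * n                                                          ∎)
  where
  open ≤-Reasoning
  module O = OddCount odd cp-odd⇒prime*square
  S = w * k
  K = S * suc S
  R = K * 2 ^ (4 * K)
  Y : ℕ → ℕ
  Y n = 24 * n + 5
  instance
    S≢0 : NonZero S
    S≢0 = >-nonZero (*-mono-≤ (≤-trans (s≤s z≤n) 50≤w) 1≤k)
  arith₁ : ∀ S p t → S * (suc S * p + t) ≡ S * suc S * p + S * t
  arith₁ = solve-∀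
  arith₂ : ∀ R n → R + (24 * n + 5) + (24 * n + 5) ≡ R + 10 + 48 * n
  arith₂ = solve-∀

theorem4p5 :
    ((k : ℕ) → 1 ≤ k → ∃ λ N → (n : ℕ) → N ≤ n → k * (n ∸ evenCount n) < n)
    × ((n p : ℕ) → Prime p → p % 4 ≡ 3
        → (∃ λ e → (p ^ (2 * e + 1) ∣ 24 * n + 5) × ¬ (p ^ (2 * e + 2) ∣ 24 * n + 5))
        → 2 ∣ cp 3 1 4 n)
theorem4p5 = (λ k 1≤k → odd-density 50 k ≤-refl 1≤k) , cp-even
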